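{- For every integer $N\geq 2$, $$B_0(N,2)=2\sum_{i=0}^{N-3}B_0(i)\,B_0(N-i-1,2)+\frac{N(N-1)}{2}\,B_0(N-1).$$
   Context: Let $N\ge 1$, $K\ge 1$. A gluing datum with $N$ edges and $K$ faces consists of a composition $(m_1,\dots,m_K)$ of $2N$ into positive integers and a fixed-point-free involution $\iota$ of $\{1,\dots,2N\}$. With $s_0=0$, $s_i=m_1+\dots+m_i$, let $\tau$ have cycles $(s_{i-1}+1,\dots,s_i)$, $i=1,\dots,K$. The datum is connected if $\langle\iota,\tau\rangle$ is transitive, and has genus $g$ if $\tau\iota$ has $N-K+2-2g$ cycles. The datum is bicolored if every $m_i$ is even and $\iota$ maps every element $s_{i-1}+r$ with $r$ odd ("white" edges) to an element $s_{j-1}+r'$ with $r'$ even ("black" edges). (Geometrically: gluings of $K$ numbered polygons whose vertices are properly colored black/white, whose distinguished edge starts at a white vertex, glued pairwise with opposite orientations so that vertex colors match, into a connected closed orientable surface of genus $g$.) $B_g(N,K)$ is the number of connected bicolored gluing data of genus $g$ with $N$ edges and $K$ faces; $B_0(0,1)=1$, $B_g(0,K)=0$ if $g+K>1$, and $B_g(N):=B_g(N,1)$. -}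

module Defs where

-- Counting connected bicolored gluing data of genus g with N edges and K faces,
-- by explicit finite enumeration.  Everything is 0-indexed: the point set
-- {1,…,2N} of the paper is represented by {0,…,2N-1}.

open import Data.Nat using (ℕ; zero; suc; _+_; _*_; _∸_; _≡ᵇ_; _<ᵇ_; _≤ᵇ_; _%_)
open import Data.Bool using (Bool; true; false; _∧_; _∨_; not; if_then_else_)
open import Data.List using (List; []; _∷_; [_]; map; concatMap; length; upTo)
open import Data.Nat.ListAction using (sum)
open import Data.Bool.ListAction using (all; any)
open import Data.Product using (_×_; _,_; proj₁; proj₂)
open import Data.Fin using (Fin; toℕ)
open import Data.List using (allFin)

infix 4 _==_
_==_ : ℕ → ℕ → Bool
_==_ = _≡ᵇ_

filterᵇ : {A : Set} → (A → Bool) → List A → List A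
filterᵇ p [] = []
filterᵇ p (x ∷ xs) = if p x then x ∷ filterᵇ p xs else filterᵇ p xs

allTuples : {A : Set} → ℕ → List A → List (List A)
allTuples zero xs = [ [] ]
allTuples (suc k) xs = concatMap (λ x → map (x ∷_) (allTuples k xs)) xs

isEven : ℕ → Bool
isEven n = n % 2 == 0

compositions : ℕ → ℕ → List (List ℕ)
compositions n K =
  filterᵇ (λ ms → all (λ m → 1 ≤ᵇ m) ms ∧ (sum ms == n)) (allTuples K (upTo (suc n)))

allMaps : ℕ → List (List ℕ)
allMaps n = map (map toℕ) (allTuples n (allFin n))

nth : List ℕ → ℕ → ℕ
nth [] _ = 0
nth (x ∷ xs) zero = x
nth (x ∷ xs) (suc i) = nth xs i

block : ℕ → List ℕ → ℕ → ℕ × ℕ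
block s [] x = s , 0
block s (m ∷ ms) x = if x <ᵇ s + m then (s , m) else block (s + m) ms x

tau : List ℕ → ℕ → ℕ
tau ms x with block 0 ms x
... | s , m = if suc x <ᵇ s + m then suc x else s

-- position of x inside its block, 0-indexed (paper's r minus 1)
offset : List ℕ → ℕ → ℕ
offset ms x = x ∸ proj₁ (block 0 ms x)

iter : ℕ → (ℕ → ℕ) → ℕ → ℕ
iter zero f x = x
iter (suc k) f x = f (iter k f x)

isFPFInvolution : ℕ → (ℕ → ℕ) → Bool
isFPFInvolution n ι = all (λ x → (ι (ι x) == x) ∧ not (ι x == x)) (upTo n)

reach : ℕ → (ℕ → ℕ) → (ℕ → ℕ) → ℕ → ℕ → Bool
reach n ι τ zero y = y == 0
reach n ι τ (suc k) y =
  reach n ι τ k y ∨ any (λ x → reach n ι τ k x ∧ ((ι x == y) ∨ (τ x == y))) (upTo n)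

isTransitive : ℕ → (ℕ → ℕ) → (ℕ → ℕ) → Bool
isTransitive n ι τ = all (reach n ι τ n) (upTo n)

-- number of cycles of a permutation σ of {0..n-1}: count cycle minima
numCycles : ℕ → (ℕ → ℕ) → ℕ
numCycles n σ =
  length (filterᵇ (λ x → all (λ k → x ≤ᵇ iter (suc k) σ x) (upTo n)) (upTo n))

-- bicolored: all parts even; white (paper r odd ⇔ 0-indexed offset even)
-- points are mapped to black (paper r' even ⇔ 0-indexed offset odd) points
isBicolored : ℕ → List ℕ → (ℕ → ℕ) → Bool
isBicolored n ms ι =
  all isEven ms ∧
  all (λ x → not (isEven (offset ms x)) ∨ not (isEven (offset ms (ι x)))) (upTo n)

-- genus g: τι has N - K + 2 - 2g cycles, i.e. cycles + K + 2g = N + 2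
hasGenus : ℕ → ℕ → ℕ → List ℕ → (ℕ → ℕ) → Bool
hasGenus g N K ms ι = (numCycles (2 * N) (λ x → tau ms (ι x)) + K + 2 * g) == N + 2

goodDatum : ℕ → ℕ → ℕ → List ℕ → List ℕ → Bool
goodDatum g N K ms v =
  let ι = nth v in
  isFPFInvolution (2 * N) ι ∧ isTransitive (2 * N) ι (tau ms) ∧
  isBicolored (2 * N) ms ι ∧ hasGenus g N K ms ι

B : ℕ → ℕ → ℕ → ℕ
B g zero K = if (g == 0) ∧ (K == 1) then 1 else 0
B g (suc n) K =
  sum (map (λ ms → length (filterᵇ (goodDatum g (suc n) K ms) (allMaps (2 * suc n))))
           (compositions (2 * suc n) K))

B₁ : ℕ → ℕ → ℕ
B₁ g N = B g N 1

{-# OPTIONS --safe #-}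
-- Delete the edge glued to the distinguished edge of the first polygon.  If both of its sides lie
-- on that polygon, the polygon splits in two, and by Euler's inequality a planar gluing cannot
-- connect the two pieces: one piece is glued to itself, the other to the second polygon.  If the
-- edge joins both polygons, they merge into one polygon with N - 1 edges, the second side being
-- any of the q black edges of the second polygon.  Hence the number A(p,q) of planar gluings of
-- polygons with 2p and 2q sides satisfies
--   A(p,q) = 2 Σ_{j<p} B₀(j) A(p-1-j,q) + q B₀(p+q-1),
-- and summing over p + q = N gives the theorem, q adding up to N(N-1)/2.
module Submission where

open import Defs
open import Data.Bool using (Bool; true; false; _∧_; _∨_; not; if_then_else_)
open import Data.Bool.ListAction using (all; any)
open import Data.Bool.Properties using (not-involutive; ¬-not; T-≡; ∨-zeroʳ)
open import Data.Empty using (⊥; ⊥-elim)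
open import Data.Fin using (toℕ; fromℕ<)
open import Data.Fin.Properties using (toℕ-injective; toℕ<n; toℕ-fromℕ<)
open import Data.List
  using (List; []; _∷_; [_]; _++_; map; concat; concatMap; length; upTo; applyUpTo; allFin; take;
    drop; cartesianProduct)
open import Data.List.Properties
  using (++-assoc; ++-identityʳ; length-++; length-map; length-upTo; concat-++; ++-conicalˡ;
    ++-conicalʳ; ∷-injective; map-++; map-∘; map-injective; map-cong-local)
open import Data.List.Membership.Propositional using (_∈_; _∉_)
open import Data.List.Membership.Propositional.Properties
  using (∈-++⁺ˡ; ∈-++⁺ʳ; ∈-++⁻; ∈-∃++; ∈-map⁺; ∈-map⁻; ∈-upTo⁺; ∈-upTo⁻; ∈-concat⁻′;
    ∈-cartesianProduct⁺; ∈-cartesianProduct⁻; ∈-allFin)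
open import Data.List.Relation.Binary.Permutation.Propositional
  using (_↭_; prep; swap; ↭-refl; ↭-sym; ↭-trans; ↭-reflexive; module PermutationReasoning)
open import Data.List.Relation.Binary.Permutation.Propositional.Properties
  using (All-resp-↭; ∈-resp-↭; ↭-length; ++⁺ˡ; ++⁺ʳ; ++⁺; shift; shifts; ++-comm; drop-∷;
    ↭-singleton-inv; ↭-empty-inv; ↭-map-inv; map⁺)
open import Data.List.Relation.Unary.All as All using (All; []; _∷_)
open import Data.List.Relation.Unary.AllPairs using ([]; _∷_)
open import Data.List.Relation.Unary.Any using (here; there)
open import Data.List.Relation.Unary.Unique.Propositional using (Unique)
open import Data.List.Relation.Unary.Unique.Propositional.Properties as Uniq using (upTo⁺; allFin⁺)
open import Data.Nat
open import Data.Nat.DivMod using (m*n/n≡m)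
open import Data.Nat.ListAction using (sum)
open import Data.Nat.ListAction.Properties using (sum-++)
open import Data.Nat.Properties
open import Data.Nat.Tactic.RingSolver using (solve-∀)
open import Data.Product using (Σ; ∃; _×_; _,_; proj₁; proj₂)
open import Data.Sum using (_⊎_; inj₁; inj₂)
open import Data.Unit using (⊤; tt)
open import Function using (_∘_; id)
open import Function.Bundles using (Equivalence)
open import Relation.Binary.PropositionalEquality hiding ([_])
open import Relation.Nullary using (yes; no)

-- The genus is defined through the cycles of `tau ∘ ι`, while the recursion deletes edges. The
-- link: deleting the edge {x, y} composes the current permutation with the transposition (x y),
-- which splits or merges its cycles just as it splits or merges polygons. When no edge is left, the
-- permutation is `tau ∘ ι` and each polygon that has become empty is one of its cycles, that is,
-- one vertex. A derivation (`Deriv`) therefore counts vertices from words alone.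
--
-- Euler's inequality needs arbitrarily many polygons, even for a gluing of one or two: cutting a
-- polygon leaves two, and whether they are still connected is known only after a search. Its
-- equality case yields an inductive description of the planar gluings; conversely such a
-- description yields a derivation with the required number of vertices.
--
-- The described gluings are then listed without repetition. The sizes in this recursion do not
-- decrease structurally, so it carries a fuel argument; comparison with the brute-force count at
-- every sufficient fuel makes its value immaterial.

private variable
  X Y : Set
  σ φ ι : ℕ → ℕ
  x y z k m V : ℕ
  b e : Bool
  a r u v w C W : List ℕ
  S S′ Q Q′ : List (List ℕ)
  D D′ : ℕ → Set

-- Boolean tests, filters and duplicate-free lists

not-true : ∀ {b} → not b ≡ true → b ≡ false
not-true {false} _ = refl

∧-split : ∀ {a b} → a ∧ b ≡ true → a ≡ true × b ≡ true
∧-split {true} {true} _ = refl , refl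

≡ᵇ-true : ∀ {m n} → (m ≡ᵇ n) ≡ true → m ≡ n
≡ᵇ-true {m} {n} h = ≡ᵇ⇒≡ m n (Equivalence.from T-≡ h)

true-≡ᵇ : ∀ {m n} → m ≡ n → (m ≡ᵇ n) ≡ true
true-≡ᵇ {m} {n} h = Equivalence.to T-≡ (≡⇒≡ᵇ m n h)

≤ᵇ-true : ∀ {m n} → (m ≤ᵇ n) ≡ true → m ≤ n
≤ᵇ-true {m} {n} h = ≤ᵇ⇒≤ m n (Equivalence.from T-≡ h)

true-≤ᵇ : ∀ {m n} → m ≤ n → (m ≤ᵇ n) ≡ true
true-≤ᵇ h = Equivalence.to T-≡ (≤⇒≤ᵇ h)

<ᵇ-true : ∀ {m n} → (m <ᵇ n) ≡ true → m < n
<ᵇ-true {m} {n} h = <ᵇ⇒< m n (Equivalence.from T-≡ h)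

true-<ᵇ : ∀ {m n} → m < n → (m <ᵇ n) ≡ true
true-<ᵇ h = Equivalence.to T-≡ (<⇒<ᵇ h)

false-<ᵇ : ∀ {m n} → n ≤ m → (m <ᵇ n) ≡ false
false-<ᵇ {m} {n} h with m <ᵇ n in eq
... | false = refl
... | true  = ⊥-elim (<⇒≱ (<ᵇ-true eq) h)

all⁻ : (p : X → Bool) (xs : List X) → all p xs ≡ true → ∀ {z} → z ∈ xs → p z ≡ true
all⁻ p (x ∷ xs) h (here refl) = proj₁ (∧-split h)
all⁻ p (x ∷ xs) h (there z∈)  = all⁻ p xs (proj₂ (∧-split {p x} h)) z∈

all⁺ : (p : X → Bool) (xs : List X) → (∀ {z} → z ∈ xs → p z ≡ true) → all p xs ≡ true
all⁺ p []       h = refl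
all⁺ p (x ∷ xs) h rewrite h (here refl) = all⁺ p xs (h ∘ there)

any⁺ : (p : X → Bool) (xs : List X) → ∀ {z} → z ∈ xs → p z ≡ true → any p xs ≡ true
any⁺ p (x ∷ xs) (here refl) h rewrite h = refl
any⁺ p (x ∷ xs) (there z∈) h with p x
... | true  = refl
... | false = any⁺ p xs z∈ h

any⁻ : (p : X → Bool) (xs : List X) → any p xs ≡ true → ∃ λ z → z ∈ xs × p z ≡ true
any⁻ p (x ∷ xs) h with p x in eq
... | true  = x , here refl , eq
... | false with any⁻ p xs h
...   | z , z∈ , pz = z , there z∈ , pz

∈-filterᵇ⁺ : (p : X → Bool) (xs : List X) → ∀ {z} → z ∈ xs → p z ≡ true → z ∈ filterᵇ p xs
∈-filterᵇ⁺ p (x ∷ xs) (here refl) h rewrite h = here refl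
∈-filterᵇ⁺ p (x ∷ xs) (there z∈) h with p x
... | true  = there (∈-filterᵇ⁺ p xs z∈ h)
... | false = ∈-filterᵇ⁺ p xs z∈ h

∈-filterᵇ⁻ : (p : X → Bool) (xs : List X) → ∀ {z} → z ∈ filterᵇ p xs → z ∈ xs × p z ≡ true
∈-filterᵇ⁻ p (x ∷ xs) z∈ with p x in eq
∈-filterᵇ⁻ p (x ∷ xs) (here refl) | true = here refl , eq
∈-filterᵇ⁻ p (x ∷ xs) (there z∈)  | true with ∈-filterᵇ⁻ p xs z∈
... | z∈′ , pz = there z∈′ , pz
∈-filterᵇ⁻ p (x ∷ xs) z∈ | false with ∈-filterᵇ⁻ p xs z∈
... | z∈′ , pz = there z∈′ , pz

≢-All : ∀ {x : X} {xs} → (∀ {z} → z ∈ xs → x ≢ z) → All (x ≢_) xs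
≢-All = All.tabulate

Unique-filterᵇ : (p : X → Bool) {xs : List X} → Unique xs → Unique (filterᵇ p xs)
Unique-filterᵇ p [] = []
Unique-filterᵇ p {x ∷ xs} (x∉ ∷ u) with p x
... | true  = ≢-All (λ z∈ → All.lookup x∉ (proj₁ (∈-filterᵇ⁻ p xs z∈))) ∷ Unique-filterᵇ p u
... | false = Unique-filterᵇ p u

Unique-resp-↭ : {xs ys : List X} → xs ↭ ys → Unique xs → Unique ys
Unique-resp-↭ _↭_.refl u = u
Unique-resp-↭ (prep x p) (x∉ ∷ u) = All-resp-↭ p x∉ ∷ Unique-resp-↭ p u
Unique-resp-↭ (_↭_.swap x y p) ((x≢y ∷ x∉) ∷ y∉ ∷ u) =
  (≢-sym x≢y ∷ All-resp-↭ p y∉) ∷ All-resp-↭ p x∉ ∷ Unique-resp-↭ p u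
Unique-resp-↭ (_↭_.trans p q) u = Unique-resp-↭ q (Unique-resp-↭ p u)

Unique-++ʳ : (xs : List X) {ys : List X} → Unique (xs ++ ys) → Unique ys
Unique-++ʳ []       u       = u
Unique-++ʳ (x ∷ xs) (_ ∷ u) = Unique-++ʳ xs u

Unique-++ˡ : (xs : List X) {ys : List X} → Unique (xs ++ ys) → Unique xs
Unique-++ˡ []       u        = []
Unique-++ˡ (x ∷ xs) (x∉ ∷ u) =
  ≢-All (λ z∈ → All.lookup x∉ (∈-++⁺ˡ z∈)) ∷ Unique-++ˡ xs u

Unique-disjoint : (xs : List X) {ys : List X} → Unique (xs ++ ys) → ∀ {z} → z ∈ xs → z ∈ ys → ⊥
Unique-disjoint (x ∷ xs) (x∉ ∷ u) (here refl) z∈ = All.lookup x∉ (∈-++⁺ʳ xs z∈) refl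
Unique-disjoint (x ∷ xs) (x∉ ∷ u) (there z∈) z∈′ = Unique-disjoint xs u z∈ z∈′

Unique-++⁺ : {xs ys : List X} → Unique xs → Unique ys → (∀ {z} → z ∈ xs → z ∈ ys → ⊥) →
             Unique (xs ++ ys)
Unique-++⁺ ux uy d = Uniq.++⁺ ux uy (λ (a , b) → d a b)

Unique-map-on : (f : X → Y) {xs : List X} → (∀ {x y} → x ∈ xs → y ∈ xs → f x ≡ f y → x ≡ y) →
                Unique xs → Unique (map f xs)
Unique-map-on f inj [] = []
Unique-map-on f {x ∷ xs} inj (x∉ ∷ u) =
  ≢-All fx∉ ∷ Unique-map-on f (λ a b → inj (there a) (there b)) u
  where
  fx∉ : ∀ {z} → z ∈ map f xs → f x ≢ z
  fx∉ z∈ refl with ∈-map⁻ f z∈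
  ... | y , y∈ , eq = All.lookup x∉ y∈ (inj (here refl) (there y∈) eq)

∈-concatMap⁺′ : (g : X → List Y) {xs : List X} → ∀ {x z} → x ∈ xs → z ∈ g x → z ∈ concatMap g xs
∈-concatMap⁺′ g (here refl) z∈ = ∈-++⁺ˡ z∈
∈-concatMap⁺′ g {x ∷ xs} (there x∈) z∈ = ∈-++⁺ʳ (g x) (∈-concatMap⁺′ g x∈ z∈)

∈-concatMap⁻′ : (g : X → List Y) (xs : List X) → ∀ {z} → z ∈ concatMap g xs →
                ∃ λ x → x ∈ xs × z ∈ g x
∈-concatMap⁻′ g (x ∷ xs) z∈ with ∈-++⁻ (g x) z∈
... | inj₁ z∈′ = x , here refl , z∈′
... | inj₂ z∈′ with ∈-concatMap⁻′ g xs z∈′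
...   | y , y∈ , z∈″ = y , there y∈ , z∈″

Unique-concatMap : (g : X → List Y) {xs : List X} → Unique xs → (∀ {x} → x ∈ xs → Unique (g x)) →
  (∀ {x y z} → x ∈ xs → y ∈ xs → z ∈ g x → z ∈ g y → x ≡ y) → Unique (concatMap g xs)
Unique-concatMap g [] ug d = []
Unique-concatMap g {x ∷ xs} (x∉ ∷ u) ug d =
  Unique-++⁺ (ug (here refl))
    (Unique-concatMap g u (ug ∘ there) (λ a b → d (there a) (there b)))
    λ z∈ z∈′ → let (y , y∈ , z∈y) = ∈-concatMap⁻′ g xs z∈′ in
      All.lookup x∉ y∈ (d (here refl) (there y∈) z∈ z∈y)

∈⇒↭ : {x : X} {xs : List X} → x ∈ xs → ∃ λ ys → xs ↭ x ∷ ys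
∈⇒↭ {x = x} x∈ with ∈-∃++ x∈
... | us , vs , refl = us ++ vs , shift x us vs

unique-⊆-length : {xs ys : List X} → Unique xs → (∀ {z} → z ∈ xs → z ∈ ys) → length xs ≤ length ys
unique-⊆-length [] _ = z≤n
unique-⊆-length {xs = x ∷ xs} {ys} (x∉ ∷ u) sub with ∈⇒↭ (sub (here refl))
... | ys′ , p = ≤-trans (s≤s (unique-⊆-length u sub′)) (≤-reflexive (sym (↭-length p)))
  where
  sub′ : ∀ {z} → z ∈ xs → z ∈ ys′
  sub′ z∈ with ∈-resp-↭ p (sub (there z∈))
  ... | here refl = ⊥-elim (All.lookup x∉ z∈ refl)
  ... | there h   = h

-- The brute-force counts are evaluated through this: a filtered list and an explicit enumeration
-- are compared by membership alone.
unique-set-length : {xs ys : List X} → Unique xs → Unique ys →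
  (∀ {z} → z ∈ xs → z ∈ ys) → (∀ {z} → z ∈ ys → z ∈ xs) → length xs ≡ length ys
unique-set-length ux uy f g = ≤-antisym (unique-⊆-length ux f) (unique-⊆-length uy g)

filterᵇ-++ : (p : X → Bool) (xs ys : List X) → filterᵇ p (xs ++ ys) ≡ filterᵇ p xs ++ filterᵇ p ys
filterᵇ-++ p [] ys = refl
filterᵇ-++ p (x ∷ xs) ys with p x
... | true  = cong (x ∷_) (filterᵇ-++ p xs ys)
... | false = filterᵇ-++ p xs ys

concat-↭ : {xss yss : List (List X)} → xss ↭ yss → concat xss ↭ concat yss
concat-↭ _↭_.refl = ↭-refl
concat-↭ (prep xs p) = ++⁺ˡ xs (concat-↭ p)
concat-↭ (_↭_.swap xs ys p) = ↭-trans (shifts xs ys) (++⁺ˡ ys (++⁺ˡ xs (concat-↭ p)))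
concat-↭ (_↭_.trans p q) = ↭-trans (concat-↭ p) (concat-↭ q)

-- Vertices of a gluing

-- Both endpoints stay outside the list, so a cycle is a closed path written from its first point,
-- and consecutive paths join without repeating a point.
Path : (ℕ → ℕ) → ℕ → List ℕ → ℕ → Set
Path σ a []      b = σ a ≡ b
Path σ a (c ∷ u) b = σ a ≡ c × Path σ c u b

path-++ : ∀ u → Path σ x u y → Path σ y v z → Path σ x (u ++ y ∷ v) z
path-++ []      p       q = p , q
path-++ (_ ∷ u) (e , p) q = e , path-++ u p q

path-split : ∀ u → Path σ x (u ++ y ∷ v) z → Path σ x u y × Path σ y v z
path-split []      (e , p) = e , p
path-split (_ ∷ u) (e , p) with path-split u p
... | q , r = (e , q) , r

path-transfer : ∀ u → φ y ≡ σ x → (∀ {z} → z ∈ u → φ z ≡ σ z) → Path σ x u z → Path φ y u z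
path-transfer []      e h p       = trans e p
path-transfer (_ ∷ u) e h (q , p) = trans e q , path-transfer u (h (here refl)) (h ∘ there) p

Cyc : (ℕ → ℕ) → List ℕ → Set
Cyc σ []      = ⊥
Cyc σ (c ∷ u) = Path σ c u c

-- The list of a cycle has a base point; the surgery below needs it at the deleted letter, which may
-- stand anywhere.
cyc-rotate : ∀ u → Cyc σ (u ++ y ∷ v) → Path σ y (v ++ u) y
cyc-rotate {σ = σ} {y = y} {v = v} [] p = subst (λ t → Path σ y t y) (sym (++-identityʳ v)) p
cyc-rotate {v = v} (c ∷ u) p with path-split u p
... | q , r = path-++ v r q

cyc-transfer : ∀ {σ φ} C → (∀ {z} → z ∈ C → φ z ≡ σ z) → Cyc σ C → Cyc φ C
cyc-transfer (c ∷ u) h p = path-transfer u (h (here refl)) (h ∘ there) p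

-- A cycle of the current permutation also contains the endpoints of the edges removed so far;
-- Thin D C w says that w is what remains of C once these letters (which satisfy D) are forgotten.
data Thin (D : ℕ → Set) : List ℕ → List ℕ → Set where
  []   : Thin D [] []
  live : Thin D C w → Thin D (x ∷ C) (x ∷ w)
  dead : D x → Thin D C w → Thin D (x ∷ C) w

thin-⊆ : Thin D C w → z ∈ w → z ∈ C
thin-⊆ (live t)   (here e)   = here e
thin-⊆ (live t)   (there z∈) = there (thin-⊆ t z∈)
thin-⊆ (dead _ t) z∈         = there (thin-⊆ t z∈)

thin-map : (∀ {z} → D z → D′ z) → Thin D C w → Thin D′ C w
thin-map f []         = []
thin-map f (live t)   = live (thin-map f t)
thin-map f (dead d t) = dead (f d) (thin-map f t)

thin-++ : Thin D C w → Thin D W v → Thin D (C ++ W) (w ++ v)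
thin-++ []         s = s
thin-++ (live t)   s = live (thin-++ t s)
thin-++ (dead d t) s = dead d (thin-++ t s)

-- Forgotten letters in front of the first live one go to the end when the cycle is rotated; this
-- form avoids a trailing `++ []` in the word.
thin-++-dead : Thin D C w → Thin D W [] → Thin D (C ++ W) w
thin-++-dead []         s = s
thin-++-dead (live t)   s = live (thin-++-dead t s)
thin-++-dead (dead d t) s = dead d (thin-++-dead t s)

thin-split : ∀ u → Thin D C (u ++ y ∷ v) →
  ∃ λ U → ∃ λ W → C ≡ U ++ y ∷ W × Thin D U u × Thin D W v
thin-split []      (live t) = [] , _ , refl , [] , t
thin-split (_ ∷ u) (live t) with thin-split u t
... | U , W , refl , p , q = _ ∷ U , W , refl , live p , q
thin-split u (dead d t) with thin-split u t
... | U , W , refl , p , q = _ ∷ U , W , refl , dead d p , q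

thin-dead : Thin D C [] → z ∈ C → D z
thin-dead (dead d t) (here refl) = d
thin-dead (dead d t) (there z∈)  = thin-dead t z∈

-- This is `σ` composed with the transposition (x y). The edges are disjoint pairs, so doing it once
-- for each of them turns `σ` into `σ ∘ ι`.
twist : (ℕ → ℕ) → ℕ → ℕ → ℕ → ℕ
twist σ x y z with z ≟ x | z ≟ y
... | yes _ | _     = σ y
... | no _  | yes _ = σ x
... | no _  | no _  = σ z

twist-l : ∀ σ x y → twist σ x y x ≡ σ y
twist-l σ x y with x ≟ x | x ≟ y
... | yes _ | _ = refl
... | no n  | _ = ⊥-elim (n refl)

twist-r : ∀ σ x y → twist σ x y y ≡ σ x
twist-r σ x y with y ≟ x | y ≟ y
... | yes refl | _ = refl
... | no _ | yes _ = refl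
... | no _ | no n = ⊥-elim (n refl)

twist-o : ∀ σ x y → z ≢ x → z ≢ y → twist σ x y z ≡ σ z
twist-o {z = z} σ x y z≢x z≢y with z ≟ x | z ≟ y
... | yes e | _     = ⊥-elim (z≢x e)
... | no _  | yes e = ⊥-elim (z≢y e)
... | no _  | no _  = refl

-- The points `x` and `y` exchange successors, so the arc that led from `x` to `y` closes up at `y`,
-- and the arc from `y` to `x` closes up at `x`.
cyc-split : ∀ {U} → x ∉ U → y ∉ U → x ∉ W → y ∉ W → Path σ x (U ++ y ∷ W) x →
  Cyc (twist σ x y) (y ∷ U) × Cyc (twist σ x y) (x ∷ W)
cyc-split {x = x} {y = y} {W = W} {σ = σ} {U = U} xU yU xW yW p with path-split U p
... | q , r =
  path-transfer U (twist-r σ x y) (λ z∈ → twist-o σ x y (λ { refl → xU z∈ }) (λ { refl → yU z∈ })) q ,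
  path-transfer W (twist-l σ x y) (λ z∈ → twist-o σ x y (λ { refl → xW z∈ }) (λ { refl → yW z∈ })) r

-- The same exchange of successors between two cycles: after `x` comes the whole cycle of `y`, and
-- after `y` the rest of the cycle of `x`.
cyc-merge : ∀ {Z} → x ∉ Z → y ∉ Z → x ∉ W → y ∉ W → Path σ x W x → Path σ y Z y →
  Cyc (twist σ x y) (x ∷ Z ++ y ∷ W)
cyc-merge {x = x} {y = y} {W = W} {σ = σ} {Z = Z} xZ yZ xW yW p q = path-++ Z
  (path-transfer Z (twist-l σ x y) (λ z∈ → twist-o σ x y (λ { refl → xZ z∈ }) (λ { refl → yZ z∈ })) q)
  (path-transfer W (twist-r σ x y) (λ z∈ → twist-o σ x y (λ { refl → xW z∈ }) (λ { refl → yW z∈ })) p)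

-- Deriv ι S V: deleting the edges {x, ι x} one at a time from the polygons S leaves V empty
-- polygons; these are the vertices of the surface glued from S along ι.
data Deriv (ι : ℕ → ℕ) : List (List ℕ) → ℕ → Set where
  nil   : Deriv ι [] 0
  empty : Deriv ι S V → Deriv ι ([] ∷ S) (suc V)
  split : ι x ≡ y → ι y ≡ x → Deriv ι (u ∷ v ∷ S) V → Deriv ι ((x ∷ u ++ y ∷ v) ∷ S) V
  merge : ι x ≡ y → ι y ≡ x → Deriv ι ((v ++ u ++ w) ∷ S) V →
          Deriv ι ((x ∷ w) ∷ (u ++ y ∷ v) ∷ S) V
  perm  : S ↭ S′ → Deriv ι S V → Deriv ι S′ V

State : Set
State = List (List ℕ × List ℕ)

cycles words : State → List (List ℕ)
cycles = map proj₁
words  = map proj₂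

Tracks : (φ σ : ℕ → ℕ) → List ℕ × List ℕ → Set
Tracks φ σ (C , w) = Cyc σ C × Thin (λ d → φ d ≡ σ d) C w

-- Here `φ` is the final permutation and `σ` the current one. They agree on the deleted letters, as
-- recorded in `Tracks`; for a live letter the transposition of its edge is still to come, whence
-- `φ z ≡ σ (ι z)`.
record Inv (φ ι σ : ℕ → ℕ) (P : State) : Set where
  constructor inv
  field
    tracks : All (Tracks φ σ) P
    lives  : ∀ {z} → z ∈ concat (words P) → φ z ≡ σ (ι z) × ι (ι z) ≡ z
    unique : Unique (concat (cycles P))

Result : (φ : ℕ → ℕ) → State → ℕ → Set
Result φ P V = ∃ λ F → length F ≡ V × All (Cyc φ) F × concat F ↭ concat (cycles P)

words-⊆-cycles : ∀ {P} → All (Tracks φ σ) P → z ∈ concat (words P) → z ∈ concat (cycles P)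
words-⊆-cycles {P = (C , w) ∷ P} ((_ , t) ∷ ts) z∈ with ∈-++⁻ w z∈
... | inj₁ h = ∈-++⁺ˡ (thin-⊆ t h)
... | inj₂ h = ∈-++⁺ʳ C (words-⊆-cycles ts h)

module Step {φ ι σ : ℕ → ℕ} {x y : ℕ} (ιx : ι x ≡ y) (ιy : ι y ≡ x)
            (φx : φ x ≡ σ (ι x)) (φy : φ y ≡ σ (ι y)) where

  σ′ : ℕ → ℕ
  σ′ = twist σ x y

  dead′ : φ z ≡ σ z → φ z ≡ σ′ z
  dead′ {z} e with z ≟ x | z ≟ y
  ... | yes refl | _ = trans φx (cong σ ιx)
  ... | no _ | yes refl = trans φy (cong σ ιy)
  ... | no _ | no _ = e

  dead-x : φ x ≡ σ′ x
  dead-x = trans φx (trans (cong σ ιx) (sym (twist-l σ x y)))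

  dead-y : φ y ≡ σ′ y
  dead-y = trans φy (trans (cong σ ιy) (sym (twist-r σ x y)))

  others : ∀ {P} → x ∉ concat (cycles P) → y ∉ concat (cycles P) →
           All (Tracks φ σ) P → All (Tracks φ σ′) P
  others x∉ y∉ [] = []
  others {(C , w) ∷ P} x∉ y∉ ((c , t) ∷ ts) =
    (cyc-transfer {σ} {σ′} C (λ {z} z∈ → twist-o {z = z} σ x y (λ { refl → x∉ (∈-++⁺ˡ z∈) }) (λ { refl → y∉ (∈-++⁺ˡ z∈) })) c
      , thin-map dead′ t) ∷ others (x∉ ∘ ∈-++⁺ʳ C) (y∉ ∘ ∈-++⁺ʳ C) ts

  -- Since `ι` is an involution on live letters, the partner of `z` is neither `x` nor `y`, and the
  -- new transposition leaves its image alone.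
  live′ : z ≢ x → z ≢ y → φ z ≡ σ (ι z) × ι (ι z) ≡ z → φ z ≡ σ′ (ι z) × ι (ι z) ≡ z
  live′ {z} z≢x z≢y (e , i) = trans e (sym (twist-o σ x y
    (λ h → z≢y (trans (sym i) (trans (cong ι h) ιx)))
    (λ h → z≢x (trans (sym i) (trans (cong ι h) ιy))))) , i

∉-tail : Unique (x ∷ w) → x ∉ w
∉-tail (h ∷ _) x∈ = All.lookup h x∈ refl


∉-++ : ∀ u → x ∉ u ++ v → x ∉ u × x ∉ v
∉-++ u h = h ∘ ∈-++⁺ˡ , h ∘ ∈-++⁺ʳ u

-- Rotated to its live letter `x`, the cycle reads x U y W with `U` thinning to `u` and `W` to `v`.
-- Exchanging successors leaves the cycles y U and x W, in which `y` and `x` are dead from now on.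
sound-split : ∀ {P} → Inv φ ι σ ((C , x ∷ u ++ y ∷ v) ∷ P) → ι x ≡ y → ι y ≡ x →
  ∃ λ σ′ → ∃ λ C₁ → ∃ λ C₂ → Inv φ ι σ′ ((C₁ , u) ∷ (C₂ , v) ∷ P) × C₁ ++ C₂ ↭ C
sound-split {φ} {ι} {σ} {C} {x} {u} {y} {v} {P} (inv ((c , t) ∷ ts) lv un) ιx ιy
  with thin-split [] t
... | A , C′ , refl , tA , tC′ with thin-split u (thin-++-dead tC′ tA)
... | U , W , eq , tU , tW =
  σ′ , y ∷ U , x ∷ W ,
  inv ((proj₁ cs , dead dead-y (thin-map dead′ tU)) ∷ (proj₂ cs , dead dead-x (thin-map dead′ tW)) ∷
        others (proj₂ (∉-++ W xWP)) (proj₂ (∉-++ W yWP)) ts)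
      lv′ (subst Unique (++-assoc (y ∷ U) (x ∷ W) _) un′) , p
  where
  open Step {φ} {ι} {σ} ιx ιy (proj₁ (lv (here refl)))
    (proj₁ (lv (there (∈-++⁺ˡ (∈-++⁺ʳ u (here refl))))))
  K = concat (cycles P)
  p : (y ∷ U) ++ x ∷ W ↭ A ++ x ∷ C′
  p = begin
    (y ∷ U) ++ x ∷ W   ↭⟨ shift x (y ∷ U) W ⟩
    x ∷ y ∷ U ++ W     ↭⟨ prep x (↭-sym (shift y U W)) ⟩
    x ∷ U ++ y ∷ W     ≡⟨ cong (x ∷_) eq ⟨
    x ∷ C′ ++ A        ↭⟨ ++-comm (x ∷ C′) A ⟩
    A ++ x ∷ C′        ∎
    where open PermutationReasoning
  un′ : Unique (((y ∷ U) ++ x ∷ W) ++ K)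
  un′ = Unique-resp-↭ (++⁺ʳ K (↭-sym p)) un
  un-y : Unique (y ∷ U ++ x ∷ W ++ K)
  un-y = subst Unique (++-assoc (y ∷ U) (x ∷ W) K) un′
  un-x : Unique (x ∷ U ++ W ++ K)
  un-x with un-y
  ... | _ ∷ h = Unique-resp-↭ (shift x U (W ++ K)) h
  xU : x ∉ U
  xU = proj₁ (∉-++ U (∉-tail un-x))
  xWP : x ∉ W ++ K
  xWP = proj₂ (∉-++ U (∉-tail un-x))
  yU : y ∉ U
  yU = proj₁ (∉-++ U (∉-tail un-y))
  yWP : y ∉ W ++ K
  yWP = proj₂ (∉-++ U (∉-tail un-y)) ∘ there
  cs = cyc-split xU yU (proj₁ (∉-++ W xWP)) (proj₁ (∉-++ W yWP))
         (subst (λ t → Path σ x t x) eq (cyc-rotate A c))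
  lv′ : ∀ {z} → z ∈ concat (words ((y ∷ U , u) ∷ (x ∷ W , v) ∷ P)) → φ z ≡ σ′ (ι z) × ι (ι z) ≡ z
  lv′ z∈ with ∈-++⁻ u z∈
  ... | inj₁ h = live′ (λ { refl → xU (thin-⊆ tU h) }) (λ { refl → yU (thin-⊆ tU h) })
                   (lv (there (∈-++⁺ˡ (∈-++⁺ˡ h))))
  ... | inj₂ h′ with ∈-++⁻ v h′
  ...   | inj₁ h = live′ (λ { refl → xWP (∈-++⁺ˡ (thin-⊆ tW h)) }) (λ { refl → yWP (∈-++⁺ˡ (thin-⊆ tW h)) })
                   (lv (there (∈-++⁺ˡ (∈-++⁺ʳ u (there h)))))
  ...   | inj₂ h = live′ (λ { refl → xWP (∈-++⁺ʳ W (words-⊆-cycles ts h)) })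
                         (λ { refl → yWP (∈-++⁺ʳ W (words-⊆-cycles ts h)) })
                   (lv (there (∈-++⁺ʳ (u ++ y ∷ v) h)))

-- The order `v ++ u ++ w` is that of the merged cycle: from `x` to what followed `y`, round to `y`
-- itself, then on to what followed `x`.
sound-merge : ∀ {P} → Inv φ ι σ ((C , x ∷ w) ∷ (W , u ++ y ∷ v) ∷ P) → ι x ≡ y → ι y ≡ x →
  ∃ λ σ′ → ∃ λ C′ → Inv φ ι σ′ ((C′ , v ++ u ++ w) ∷ P) × C′ ↭ C ++ W
sound-merge {φ} {ι} {σ} {C} {x} {w} {W} {u} {y} {v} {P} (inv ((c , t) ∷ (d , s) ∷ ts) lv un) ιx ιy
  with thin-split [] t | thin-split u s
... | A , C′ , refl , tA , tC′ | U , W′ , refl , tU , tW =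
  σ′ , x ∷ Z ++ y ∷ A′ ,
  inv ((cyc-merge (proj₁ (∉-++ Z (∉-tail un-x))) (proj₁ (∉-++ Z (∉-tail un-y)))
         (proj₁ (∉-++ A′ xXP)) (proj₁ (∉-++ A′ yXP))
         (cyc-rotate A c) (cyc-rotate U d) ,
        dead dead-x (subst (Thin _ (Z ++ y ∷ A′)) (++-assoc v u w)
          (thin-++ (thin-++ (thin-map dead′ tW) (thin-map dead′ tU))
                   (dead dead-y (thin-map dead′ (thin-++-dead tC′ tA)))))) ∷
       others (proj₂ (∉-++ A′ xXP)) (proj₂ (∉-++ A′ yXP)) ts)
      lv′ un′ , p
  where
  Z A′ K : List ℕ
  Z = W′ ++ U
  A′ = C′ ++ A
  K = concat (cycles P)
  open Step {φ} {ι} {σ} ιx ιy (proj₁ (lv (here refl)))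
    (proj₁ (lv (there (∈-++⁺ʳ w (∈-++⁺ˡ (∈-++⁺ʳ u (here refl)))))))
  p : x ∷ Z ++ y ∷ A′ ↭ (A ++ x ∷ C′) ++ U ++ y ∷ W′
  p = begin
    x ∷ Z ++ y ∷ A′                    ↭⟨ prep x (++-comm Z (y ∷ A′)) ⟩
    x ∷ y ∷ A′ ++ Z                    ↭⟨ prep x (↭-sym (shift y A′ Z)) ⟩
    x ∷ A′ ++ y ∷ Z                    ↭⟨ ++⁺ (++-comm (x ∷ C′) A) (++-comm (y ∷ W′) U) ⟩
    (A ++ x ∷ C′) ++ U ++ y ∷ W′      ∎
    where open PermutationReasoning
  un′ : Unique ((x ∷ Z ++ y ∷ A′) ++ K)
  un′ = Unique-resp-↭ (++⁺ʳ K (↭-sym p))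
          (subst Unique (sym (++-assoc (A ++ x ∷ C′) (U ++ y ∷ W′) K)) un)
  un-x : Unique (x ∷ Z ++ y ∷ A′ ++ K)
  un-x = subst Unique (++-assoc (x ∷ Z) (y ∷ A′) K) un′
  un-y : Unique (y ∷ Z ++ A′ ++ K)
  un-y with un-x
  ... | _ ∷ h = Unique-resp-↭ (shift y Z (A′ ++ K)) h
  xXP : x ∉ A′ ++ K
  xXP = proj₂ (∉-++ Z (∉-tail un-x)) ∘ there
  yXP : y ∉ A′ ++ K
  yXP = proj₂ (∉-++ Z (∉-tail un-y))
  on-Z : ∀ {z} → z ∈ Z → z ∈ concat (words ((C , x ∷ w) ∷ (W , u ++ y ∷ v) ∷ P)) →
         φ z ≡ σ′ (ι z) × ι (ι z) ≡ z
  on-Z h l = live′ (λ { refl → proj₁ (∉-++ Z (∉-tail un-x)) h })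
                   (λ { refl → proj₁ (∉-++ Z (∉-tail un-y)) h }) (lv l)
  on-XP : ∀ {z} → z ∈ A′ ++ K → z ∈ concat (words ((C , x ∷ w) ∷ (W , u ++ y ∷ v) ∷ P)) →
         φ z ≡ σ′ (ι z) × ι (ι z) ≡ z
  on-XP h l = live′ (λ { refl → xXP h }) (λ { refl → yXP h }) (lv l)
  lv′ : ∀ {z} → z ∈ concat ((v ++ u ++ w) ∷ words P) → φ z ≡ σ′ (ι z) × ι (ι z) ≡ z
  lv′ z∈ with ∈-++⁻ (v ++ u ++ w) z∈
  ... | inj₂ h = on-XP (∈-++⁺ʳ A′ (words-⊆-cycles ts h)) (there (∈-++⁺ʳ w (∈-++⁺ʳ (u ++ y ∷ v) h)))
  ... | inj₁ h with ∈-++⁻ v h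
  ...   | inj₁ i = on-Z (∈-++⁺ˡ (thin-⊆ tW i)) (there (∈-++⁺ʳ w (∈-++⁺ˡ (∈-++⁺ʳ u (there i)))))
  ...   | inj₂ h₁ with ∈-++⁻ u h₁
  ...     | inj₁ i = on-Z (∈-++⁺ʳ W′ (thin-⊆ tU i)) (there (∈-++⁺ʳ w (∈-++⁺ˡ (∈-++⁺ˡ i))))
  ...     | inj₂ i = on-XP (∈-++⁺ˡ (∈-++⁺ˡ (thin-⊆ tC′ i))) (there (∈-++⁺ˡ i))

inv-perm : ∀ {P Q} → P ↭ Q → Inv φ ι σ P → Inv φ ι σ Q
inv-perm p (inv t l u) = inv (All-resp-↭ p t)
  (λ z∈ → l (∈-resp-↭ (concat-↭ (map⁺ proj₂ (↭-sym p))) z∈))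
  (Unique-resp-↭ (concat-↭ (map⁺ proj₁ p)) u)

sound : Deriv ι S V → ∀ {σ} P → words P ≡ S → Inv φ ι σ P → Result φ P V
sound nil [] _ _ = [] , refl , [] , ↭-refl
-- With an empty word all letters of `C` are dead, so `φ` and `σ` agree on `C` and this cycle is
-- already one of `φ`.
sound (empty D) ((C , []) ∷ P) refl (inv ((c , t) ∷ ts) lv un)
  with sound D P refl (inv ts lv (Unique-++ʳ C un))
... | F , l , cs , p = C ∷ F , cong suc l , cyc-transfer C (thin-dead t) c ∷ cs , ++⁺ˡ C p
sound (split ιx ιy D) ((C , _) ∷ P) refl I with sound-split I ιx ιy
... | _ , C₁ , C₂ , I′ , p with sound D _ refl I′
...   | F , l , cs , q = F , l , cs ,
        ↭-trans q (↭-trans (↭-reflexive (sym (++-assoc C₁ C₂ _))) (++⁺ʳ _ p))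
sound (merge ιx ιy D) ((C , _) ∷ (W , _) ∷ P) refl I with sound-merge I ιx ιy
... | _ , C′ , I′ , p with sound D _ refl I′
...   | F , l , cs , q = F , l , cs ,
        ↭-trans q (↭-trans (++⁺ʳ _ p) (↭-reflexive (++-assoc C W _)))
sound (perm s D) P refl I with ↭-map-inv proj₂ (↭-sym s)
... | Q , e , p with sound D Q (sym e) (inv-perm p I)
...   | F , l , cs , q = F , l , cs , ↭-trans q (concat-↭ (map⁺ proj₁ (↭-sym p)))

-- Counting cycles by their minima

iter-shift : ∀ σ k x → iter k σ (σ x) ≡ iter (suc k) σ x
iter-shift σ zero    x = refl
iter-shift σ (suc k) x = cong σ (iter-shift σ k x)

path-iter : ∀ u → Path σ x u y → z ∈ u ++ [ y ] → ∃ λ k → k < suc (length u) × iter (suc k) σ x ≡ z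
path-iter [] p (here refl) = 0 , s≤s z≤n , p
path-iter (c ∷ u) (e , p) (here refl) = 0 , s≤s z≤n , e
path-iter {σ} {x} (c ∷ u) (e , p) (there z∈) with path-iter u p z∈
... | k , k< , q = suc k , s≤s k< , trans (sym (iter-shift σ (suc k) x)) (trans (cong (iter (suc k) σ) e) q)

-- With at least one application of `σ`, even `x` itself is reached, by a full turn. For cycles of
-- length at most `n` these iterates are among those that `numCycles` tests.
cyc-iter : Cyc σ C → x ∈ C → z ∈ C → ∃ λ k → k < length C × iter (suc k) σ x ≡ z
cyc-iter {σ} {C} {x} c x∈ z∈ with ∈-∃++ x∈
... | A , B₀ , refl with path-iter (B₀ ++ A) (cyc-rotate A c)
        (subst (_ ∈_) (sym (++-assoc B₀ A [ x ])) (∈-resp-↭ (p A B₀) z∈))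
  where
  p : ∀ A B₀ → A ++ x ∷ B₀ ↭ B₀ ++ A ++ [ x ]
  p A B₀ = ↭-trans (++-comm A (x ∷ B₀)) (↭-trans (↭-sym (shift x B₀ A)) (++⁺ˡ B₀ (++-comm [ x ] A)))
... | k , k< , e = k , <-≤-trans k< (≤-reflexive (↭-length q)) , e
  where
  q : x ∷ B₀ ++ A ↭ A ++ x ∷ B₀
  q = ++-comm (x ∷ B₀) A

cyc-closed : Cyc σ C → x ∈ C → σ x ∈ C
cyc-closed {σ} {C} {x} c x∈ with ∈-∃++ x∈
... | A , [] , refl with A | cyc-rotate A c
...   | []    | e     = here e
...   | _ ∷ _ | e , _ = here e
cyc-closed c x∈ | A , _ ∷ _ , refl with cyc-rotate A c
...   | e , _ = ∈-++⁺ʳ A (there (here e))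

cyc-iter-closed : Cyc σ C → x ∈ C → ∀ k → iter k σ x ∈ C
cyc-iter-closed c x∈ zero    = x∈
cyc-iter-closed c x∈ (suc k) = cyc-closed c (cyc-iter-closed c x∈ k)

isMin : ℕ → (ℕ → ℕ) → ℕ → Bool
isMin n σ x = all (λ k → x ≤ᵇ iter (suc k) σ x) (upTo n)

isMin⁺ : ∀ n → Cyc σ C → x ∈ C → (∀ {z} → z ∈ C → x ≤ z) → isMin n σ x ≡ true
isMin⁺ n c x∈ h = all⁺ _ (upTo n) (λ {k} _ → true-≤ᵇ (h (cyc-iter-closed c x∈ (suc k))))

isMin⁻ : ∀ n → Cyc σ C → length C ≤ n → x ∈ C → isMin n σ x ≡ true → z ∈ C → x ≤ z
isMin⁻ n c l x∈ h z∈ with cyc-iter c x∈ z∈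
... | k , k< , refl = ≤ᵇ-true (all⁻ _ (upTo n) h (∈-upTo⁺ (<-≤-trans k< l)))

minimum : ∀ c u → ∃ λ m → m ∈ c ∷ u × (∀ {z} → z ∈ c ∷ u → m ≤ z)
minimum c [] = c , here refl , λ { (here refl) → ≤-refl }
minimum c (d ∷ u) with minimum d u
... | m , m∈ , h with ≤-total c m
...   | inj₁ c≤m = c , here refl , λ { (here refl) → ≤-refl ; (there z∈) → ≤-trans c≤m (h z∈) }
...   | inj₂ m≤c = m , there m∈ , λ { (here refl) → m≤c ; (there z∈) → h z∈ }

cyc-one-min : ∀ n → Cyc σ C → length C ≤ n → Unique C → length (filterᵇ (isMin n σ) C) ≡ 1
cyc-one-min {σ} {c₀ ∷ u} n c l un with minimum c₀ u
... | m , m∈ , h = unique-set-length {ys = [ m ]} (Unique-filterᵇ (isMin n σ) un) ([] ∷ [])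
  (λ z∈ → let (z∈C , zmin) = ∈-filterᵇ⁻ (isMin n σ) (c₀ ∷ u) z∈ in
     here (≤-antisym (isMin⁻ n c l z∈C zmin m∈) (h z∈C)))
  λ { (here refl) → ∈-filterᵇ⁺ (isMin n σ) (c₀ ∷ u) m∈ (isMin⁺ n c m∈ h) }

cycs-mins : ∀ n F → All (Cyc σ) F → length (concat F) ≤ n → Unique (concat F) →
  length (filterᵇ (isMin n σ) (concat F)) ≡ length F
cycs-mins n [] [] _ _ = refl
cycs-mins {σ} n (C ∷ F) (c ∷ cs) l un = begin
  length (filterᵇ p (C ++ concat F))                     ≡⟨ cong length (filterᵇ-++ p C (concat F)) ⟩
  length (filterᵇ p C ++ filterᵇ p (concat F))           ≡⟨ length-++ (filterᵇ p C) ⟩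
  length (filterᵇ p C) + length (filterᵇ p (concat F))   ≡⟨ cong₂ _+_
     (cyc-one-min n c (m+n≤o⇒m≤o _ l′) (Unique-++ˡ C un))
     (cycs-mins n F cs (m+n≤o⇒n≤o (length C) l′) (Unique-++ʳ C un)) ⟩
  suc (length F)                                         ∎
  where
  open ≡-Reasoning
  p = isMin n σ
  l′ : length C + length (concat F) ≤ n
  l′ = subst (_≤ n) (length-++ C) l

numCycles-length : ∀ n F → All (Cyc σ) F → concat F ↭ upTo n → numCycles n σ ≡ length F
numCycles-length {σ} n F cs p = trans
  (unique-set-length (Unique-filterᵇ _ (upTo⁺ n)) (Unique-filterᵇ _ un)
    (transport (↭-sym p)) (transport p))
  (cycs-mins n F cs (≤-reflexive (trans (↭-length p) (length-upTo n))) un)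
  where
  un : Unique (concat F)
  un = Unique-resp-↭ (↭-sym p) (upTo⁺ n)
  transport : ∀ {xs ys} → xs ↭ ys → ∀ {z} → z ∈ filterᵇ (isMin n σ) xs → z ∈ filterᵇ (isMin n σ) ys
  transport {xs} {ys} q z∈ with ∈-filterᵇ⁻ (isMin n σ) xs z∈
  ... | z∈′ , h = ∈-filterᵇ⁺ (isMin n σ) ys (∈-resp-↭ q z∈′) h

fresh : List (List ℕ) → State
fresh = map (λ C → C , C)

words-fresh : ∀ S → words (fresh S) ≡ S
words-fresh []      = refl
words-fresh (C ∷ S) = cong (C ∷_) (words-fresh S)

cycles-fresh : ∀ S → cycles (fresh S) ≡ S
cycles-fresh []      = refl
cycles-fresh (C ∷ S) = cong (C ∷_) (cycles-fresh S)

thin-refl : ∀ C → Thin D C C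
thin-refl []      = []
thin-refl (x ∷ C) = live (thin-refl C)

tracks-fresh : All (Cyc σ) S → All (Tracks φ σ) (fresh S)
tracks-fresh []       = []
tracks-fresh (c ∷ cs) = (c , thin-refl _) ∷ tracks-fresh cs

-- At the start every letter is live, and the invariant for `φ = σ ∘ ι` holds by definition. From
-- here on the vertices are counted by derivations only.
numCycles-deriv : ∀ n S → All (Cyc σ) S → concat S ≡ upTo n →
  (∀ {z} → z < n → ι (ι z) ≡ z) → Deriv ι S V → numCycles n (σ ∘ ι) ≡ V
numCycles-deriv {σ} {ι} n S cs e inv-ι D
  with sound {φ = σ ∘ ι} D (fresh S) (words-fresh S) (inv (tracks-fresh cs)
         (λ z∈ → refl , inv-ι (∈-upTo⁻ (subst (_ ∈_) (trans (cong concat (words-fresh S)) e) z∈)))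
         (subst Unique (sym (trans (cong concat (cycles-fresh S)) e)) (upTo⁺ n)))
... | F , l , cF , p = trans (numCycles-length n F cF
        (↭-trans p (↭-reflexive (trans (cong concat (cycles-fresh S)) e)))) l

-- Planarity and Euler's inequality

-- Colours are parities of points, because every block of an even composition starts at an even
-- point. Opposite colours also exclude fixed points of `ι`.
Opp : ℕ → ℕ → Set
Opp x y = isEven x ≢ isEven y

data NC (ι : ℕ → ℕ) : List ℕ → Set where
  []  : NC ι []
  arc : ι x ≡ y → ι y ≡ x → Opp x y → NC ι u → NC ι v → NC ι (x ∷ u ++ y ∷ v)

-- Annular noncrossing matchings, described by the possible fates of the first edge of `w`. No
-- constructor has `w` empty, for an empty polygon is joined to nothing.
data Ann (ι : ℕ → ℕ) : List ℕ → List ℕ → Set where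
  left   : ι x ≡ y → ι y ≡ x → Opp x y → NC ι u → Ann ι v w → Ann ι (x ∷ u ++ y ∷ v) w
  right  : ι x ≡ y → ι y ≡ x → Opp x y → Ann ι u w → NC ι v → Ann ι (x ∷ u ++ y ∷ v) w
  bridge : ι x ≡ y → ι y ≡ x → Opp x y → NC ι (v ++ u ++ w) → Ann ι (x ∷ w) (u ++ y ∷ v)

-- Planar ι w Q: the component of the polygon w is a sphere, and Q lists its other polygons.
data Planar (ι : ℕ → ℕ) : List ℕ → List (List ℕ) → Set where
  nil   : Planar ι [] []
  split : ι x ≡ y → ι y ≡ x → Opp x y → Planar ι u Q → Planar ι v Q′ →
          Planar ι (x ∷ u ++ y ∷ v) (Q ++ Q′)
  merge : ι x ≡ y → ι y ≡ x → Opp x y → Planar ι (v ++ u ++ w) Q →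
          Planar ι (x ∷ w) ((u ++ y ∷ v) ∷ Q)

planar-NC : Planar ι w Q → Q ≡ [] → NC ι w
planar-NC nil _ = []
planar-NC (split {Q = Q} {Q′ = Q′} e f o p q) h =
  arc e f o (planar-NC p (++-conicalˡ Q Q′ h)) (planar-NC q (++-conicalʳ Q Q′ h))

planar-Ann : Planar ι w Q → Q ≡ [ W ] → Ann ι w W
planar-Ann (split {Q = []} e f o p q) h = left e f o (planar-NC p refl) (planar-Ann q h)
planar-Ann (split {Q = _ ∷ []} {Q′ = []} e f o p q) refl =
  right e f o (planar-Ann p refl) (planar-NC q refl)
planar-Ann (merge e f o p) refl = bridge e f o (planar-NC p refl)

Closed : (ℕ → ℕ) → List ℕ → Set
Closed ι xs = ∀ {z} → z ∈ xs → ι z ∈ xs × ι (ι z) ≡ z × Opp z (ι z)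

closed-↭ : ∀ {xs ys} → xs ↭ ys → Closed ι xs → Closed ι ys
closed-↭ p c z∈ with c (∈-resp-↭ (↭-sym p) z∈)
... | h , r = ∈-resp-↭ p h , r

closed-drop : ∀ {xs} → ι x ≡ y → ι y ≡ x → Unique (x ∷ y ∷ xs) → Closed ι (x ∷ y ∷ xs) → Closed ι xs
closed-drop {ι} ιx ιy ((_ ∷ x∉) ∷ (y∉ ∷ _)) c z∈ with c (there (there z∈))
... | here e , i , o = ⊥-elim (All.lookup y∉ z∈ (trans (sym ιx) (trans (sym (cong ι e)) i)))
... | there (here e) , i , o = ⊥-elim (All.lookup x∉ z∈ (trans (sym ιy) (trans (sym (cong ι e)) i)))
... | there (there h) , i , o = h , i , o

-- Each arc costs two letters and adds one vertex, the empty word being a single vertex: V = E + 1,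
-- doubled so that lengths need not be halved. The arbitrary `S` lets the derivations of the two
-- pieces be stacked.
nc-deriv : NC ι w → Deriv ι S V → ∃ λ V′ → 2 * V′ ≡ length w + 2 + 2 * V × Deriv ι (w ∷ S) V′
nc-deriv {V = V} [] D = suc V , eq V , empty D
  where
  eq : ∀ V → 2 * suc V ≡ 2 + 2 * V
  eq = solve-∀
nc-deriv {V = V} (arc {x = x} {y} {u} {v} e f _ p q) D with nc-deriv q D
... | V₁ , e₁ , D₁ with nc-deriv p D₁
...   | V₂ , e₂ , D₂ = V₂ , eq , split e f D₂
  where
  lem : ∀ u v V → u + 2 + (v + 2 + V) ≡ suc (u + suc v) + 2 + V
  lem = solve-∀
  eq : 2 * V₂ ≡ length (x ∷ u ++ y ∷ v) + 2 + 2 * V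
  eq = begin
    2 * V₂                                       ≡⟨ e₂ ⟩
    length u + 2 + 2 * V₁                        ≡⟨ cong (length u + 2 +_) e₁ ⟩
    length u + 2 + (length v + 2 + 2 * V)        ≡⟨ lem (length u) (length v) (2 * V) ⟩
    suc (length u + suc (length v)) + 2 + 2 * V  ≡⟨ cong (λ t → suc t + 2 + 2 * V) (length-++ u) ⟨
    length (x ∷ u ++ y ∷ v) + 2 + 2 * V          ∎
    where open ≡-Reasoning

-- For two polygons on a sphere V - E + 2 = 2, so the new vertices are as many as the edges.
ann-deriv : Ann ι w W → Deriv ι S V →
  ∃ λ V′ → 2 * V′ ≡ length w + length W + 2 * V × Deriv ι (w ∷ W ∷ S) V′
ann-deriv {V = V} (left {x = x} {y} {u} {v} {w} e f _ p q) D with ann-deriv q D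
... | V₁ , e₁ , D₁ with nc-deriv p D₁
...   | V₂ , e₂ , D₂ = V₂ , eq , split e f D₂
  where
  lem : ∀ u v w V → u + 2 + (v + w + V) ≡ suc (u + suc v) + w + V
  lem = solve-∀
  eq : 2 * V₂ ≡ length (x ∷ u ++ y ∷ v) + length w + 2 * V
  eq rewrite length-++ u {y ∷ v} = trans e₂ (trans (cong (length u + 2 +_) e₁)
         (lem (length u) (length v) (length w) (2 * V)))
ann-deriv {V = V} (right {x = x} {y} {u} {w} {v} e f _ p q) D with nc-deriv q D
... | V₁ , e₁ , D₁ with ann-deriv p D₁
...   | V₂ , e₂ , D₂ = V₂ , eq , split e f (perm (prep u (swap w v ↭-refl)) D₂)
  where
  lem : ∀ u v w V → u + w + (v + 2 + V) ≡ suc (u + suc v) + w + V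
  lem = solve-∀
  eq : 2 * V₂ ≡ length (x ∷ u ++ y ∷ v) + length w + 2 * V
  eq rewrite length-++ u {y ∷ v} = trans e₂ (trans (cong (length u + length w +_) e₁)
         (lem (length u) (length v) (length w) (2 * V)))
ann-deriv {V = V} (bridge {x = x} {y} {v} {u} {w} e f _ p) D with nc-deriv p D
... | V₁ , e₁ , D₁ = V₁ , eq , merge e f D₁
  where
  lem : ∀ u v w V → v + (u + w) + 2 + V ≡ suc w + (u + suc v) + V
  lem = solve-∀
  eq : 2 * V₁ ≡ length (x ∷ w) + length (u ++ y ∷ v) + 2 * V
  eq rewrite length-++ u {y ∷ v} = trans e₁ (trans
    (cong (λ t → t + 2 + 2 * V) (trans (length-++ v) (cong (length v +_) (length-++ u))))
    (lem (length u) (length v) (length w) (2 * V)))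

closed-++ : ∀ {xs ys} → Closed ι xs → Closed ι ys → Closed ι (xs ++ ys)
closed-++ {xs = xs} c d z∈ with ∈-++⁻ xs z∈
... | inj₁ h = let (i , r) = c h in ∈-++⁺ˡ i , r
... | inj₂ h = let (i , r) = d h in ∈-++⁺ʳ xs i , r

closed-pair : ι x ≡ y → ι y ≡ x → Opp x y → Closed ι (x ∷ y ∷ [])
closed-pair {ι} ιx ιy o (here refl) =
  there (here ιx) , trans (cong ι ιx) ιy , λ e → o (trans e (cong isEven ιx))
closed-pair {ι} ιx ιy o (there (here refl)) =
  here ιy , trans (cong ι ιy) ιx , λ e → o (trans (cong isEven (sym ιy)) (sym e))

pair-↭ : ∀ {x y : ℕ} u v → x ∷ y ∷ u ++ v ↭ x ∷ u ++ y ∷ v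
pair-↭ u v = prep _ (↭-sym (shift _ u v))

nc-closed : NC ι w → Closed ι w
nc-closed []                               = λ ()
nc-closed (arc {u = u} {v} ιx ιy o p q) =
  closed-↭ (pair-↭ u v) (closed-++ (closed-pair ιx ιy o) (closed-++ (nc-closed p) (nc-closed q)))

ann-closed : Ann ι w W → Closed ι (w ++ W)
ann-closed (left {y = y} {u = u} {v} {w} ιx ιy o p q) =
  closed-↭ (↭-trans (pair-↭ u (v ++ w)) (↭-reflexive (cong (_ ∷_) (sym (++-assoc u (y ∷ v) w)))))
    (closed-++ (closed-pair ιx ιy o) (closed-++ (nc-closed p) (ann-closed q)))
ann-closed (right {y = y} {u = u} {w} {v} ιx ιy o p q) =
  closed-↭ (↭-trans (pair-↭ u (v ++ w)) (↭-reflexive (cong (_ ∷_) (sym (++-assoc u (y ∷ v) w)))))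
    (closed-++ (closed-pair ιx ιy o)
      (closed-↭ (↭-trans (↭-reflexive (++-assoc u w v)) (++⁺ˡ u (++-comm w v)))
        (closed-++ (ann-closed p) (nc-closed q))))
ann-closed (bridge {x = x} {y} {v} {u} {w} ιx ιy o p) =
  closed-↭ q (closed-++ (closed-pair ιx ιy o) (nc-closed p))
  where
  q : x ∷ y ∷ v ++ u ++ w ↭ (x ∷ w) ++ u ++ y ∷ v
  q = prep x (begin
    y ∷ v ++ u ++ w      ↭⟨ ++-comm (y ∷ v) (u ++ w) ⟩
    (u ++ w) ++ y ∷ v    ↭⟨ ++⁺ʳ (y ∷ v) (++-comm u w) ⟩
    (w ++ u) ++ y ∷ v    ≡⟨ ++-assoc w u (y ∷ v) ⟩
    w ++ u ++ y ∷ v      ∎)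
    where open PermutationReasoning

-- Every chain of `left` and `right` ends in a `bridge`. This edge makes the gluing connected and
-- tells it from a pair of separate spheres.
ann-cross : Ann ι w W → ∃ λ a → a ∈ w × ι a ∈ W
ann-cross (left {u = u} _ _ _ _ q) with ann-cross q
... | a , a∈ , h = a , there (∈-++⁺ʳ u (there a∈)) , h
ann-cross (right _ _ _ p _) with ann-cross p
... | a , a∈ , h = a , there (∈-++⁺ˡ a∈) , h
ann-cross (bridge {u = u} refl _ _ _) = _ , here refl , ∈-++⁺ʳ u (here refl)

-- With `w` and k further polygons, V - E + F ≤ 2 becomes 2V + 2k ≤ 2E + 2 after doubling, as F = k
-- + 1. The left side is `excess`; the right side is `capacity`, the letters numbering 2E.
excess : ℕ → List (List ℕ) → ℕ
excess V Q = 2 * V + 2 * length Q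

capacity : List ℕ → List (List ℕ) → ℕ
capacity w Q = length w + length (concat Q) + 2

-- The component of the polygon w, found by depth-first search: inside lists its other
-- polygons, outside the polygons not in it.  bound is Euler's inequality V − E + F ≤ 2.
record Component (ι : ℕ → ℕ) (w : List ℕ) (S : List (List ℕ)) : Set where
  field
    inside outside : List (List ℕ)
    vertices : ℕ
    part     : S ↭ inside ++ outside
    closed   : Closed ι (concat outside)
    deriv    : ∀ {V′} → Deriv ι outside V′ → Deriv ι (w ∷ S) (vertices + V′)
    bound    : excess vertices inside ≤ capacity w inside
    tight    : excess vertices inside ≡ capacity w inside → Planar ι w inside

+-tight : ∀ {a b c d} → a ≤ b → c ≤ d → a + c ≡ b + d → a ≡ b × c ≡ d
+-tight {a} {b} {c} {d} a≤b c≤d e = a≡b , +-cancelˡ-≡ b c d (trans (cong (_+ c) (sym a≡b)) e)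
  where
  a≡b : a ≡ b
  a≡b = ≤-antisym a≤b (+-cancelʳ-≤ d b a (subst (_≤ a + d) e (+-monoʳ-≤ a c≤d)))

module _ {ι : ℕ → ℕ} where

  -- The deletion disconnects the surface, so all counts add up, the two letters of the edge
  -- providing the second constant 2 of the capacities. Equality in the sum of two inequalities
  -- forces equality in both.
  component-split-apart : ι x ≡ y → ι y ≡ x → Opp x y → (c : Component ι u (v ∷ S)) → ∀ {R′} →
    Component.outside c ↭ v ∷ R′ → Component ι v R′ → Component ι (x ∷ u ++ y ∷ v) S
  component-split-apart {x} {y} {u} {v} {S} ιx ιy o c {R′} p d = record
    { inside = C.inside ++ D.inside
    ; outside = D.outside
    ; vertices = C.vertices + D.vertices
    ; part = begin
        S                    ↭⟨ drop-∷ (begin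
          v ∷ S              ↭⟨ C.part ⟩
          C.inside ++ C.outside         ↭⟨ ++⁺ˡ C.inside p ⟩
          C.inside ++ v ∷ R′      ↭⟨ shift v C.inside R′ ⟩
          v ∷ C.inside ++ R′      ∎) ⟩
        C.inside ++ R′            ↭⟨ ++⁺ˡ C.inside D.part ⟩
        C.inside ++ D.inside ++ D.outside    ≡⟨ ++-assoc C.inside D.inside D.outside ⟨
        (C.inside ++ D.inside) ++ D.outside  ∎
    ; closed = D.closed
    ; deriv = λ {V′} h → split ιx ιy (subst (Deriv ι _) (sym (+-assoc C.vertices D.vertices V′))
                (C.deriv (perm (↭-sym p) (D.deriv h))))
    ; bound = subst₂ _≤_ (sym ex) (sym ca) (+-mono-≤ C.bound D.bound)
    ; tight = λ h → let (s , t) = +-tight C.bound D.bound (trans (sym ex) (trans h ca)) in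
                split ιx ιy o (C.tight s) (D.tight t)
    }
    where
    module C = Component c
    module D = Component d
    open PermutationReasoning
    lem₁ : ∀ a b c d → 2 * (a + b) + 2 * (c + d) ≡ (2 * a + 2 * c) + (2 * b + 2 * d)
    lem₁ = solve-∀
    ex : excess (C.vertices + D.vertices) (C.inside ++ D.inside) ≡ excess C.vertices C.inside + excess D.vertices D.inside
    ex rewrite length-++ C.inside {D.inside} = lem₁ C.vertices D.vertices (length C.inside) (length D.inside)
    lem₂ : ∀ a b c d → suc (a + suc b) + (c + d) + 2 ≡ (a + c + 2) + (b + d + 2)
    lem₂ = solve-∀
    ca : capacity (x ∷ u ++ y ∷ v) (C.inside ++ D.inside) ≡ capacity u C.inside + capacity v D.inside
    ca rewrite length-++ u {y ∷ v} | sym (concat-++ C.inside D.inside) | length-++ (concat C.inside) {concat D.inside} =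
      lem₂ (length u) (length v) (length (concat C.inside)) (length (concat D.inside))

  -- Both pieces of the cut polygon hang together through other edges, so the edge closes a handle.
  -- Compared with the component of `u`, `excess` loses 2 because `v` is no longer a polygon, and
  -- `capacity` gains 2 from the edge. The slack is at least 4, twice the loss of Euler
  -- characteristic by one handle.
  component-split-joined : ι x ≡ y → ι y ≡ x → (c : Component ι u (v ∷ S)) → ∀ {Q′} →
    Component.inside c ↭ v ∷ Q′ → Component ι (x ∷ u ++ y ∷ v) S
  component-split-joined {x} {y} {u} {v} {S} ιx ιy c {Q′} p = record
    { inside = Q′
    ; outside = C.outside
    ; vertices = C.vertices
    ; part = drop-∷ (↭-trans C.part (++⁺ʳ C.outside p))
    ; closed = C.closed
    ; deriv = λ h → split ιx ιy (C.deriv h)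
    ; bound = <⇒≤ strict
    ; tight = λ h → ⊥-elim (<⇒≢ strict h)
    }
    where
    module C = Component c
    lem₁ : ∀ a q → 2 * a + 2 * suc q ≡ 2 + (2 * a + 2 * q)
    lem₁ = solve-∀
    lem₂ : ∀ u v q → 2 + (u + (v + q) + 2) ≡ suc (u + suc v) + q + 2
    lem₂ = solve-∀
    lo : 2 + excess C.vertices Q′ ≡ excess C.vertices C.inside
    lo rewrite ↭-length p = sym (lem₁ C.vertices (length Q′))
    hi : 2 + capacity u C.inside ≡ capacity (x ∷ u ++ y ∷ v) Q′
    hi rewrite ↭-length (concat-↭ p) | length-++ v {concat Q′} | length-++ u {y ∷ v} =
      lem₂ (length u) (length v) (length (concat Q′))
    strict : excess C.vertices Q′ < capacity (x ∷ u ++ y ∷ v) Q′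
    strict = begin-strict
      excess C.vertices Q′                  <⟨ n<1+n _ ⟩
      1 + excess C.vertices Q′              ≤⟨ n≤1+n _ ⟩
      2 + excess C.vertices Q′              ≡⟨ lo ⟩
      excess C.vertices C.inside                 ≤⟨ C.bound ⟩
      capacity u C.inside                 ≤⟨ m≤n+m _ 2 ⟩
      2 + capacity u C.inside             ≡⟨ hi ⟩
      capacity (x ∷ u ++ y ∷ v) Q′   ∎
      where open ≤-Reasoning

  -- One polygon and one edge disappear and the vertices remain, so both sides of the bound change
  -- by 2 and tightness carries over.
  component-merge : ι x ≡ y → ι y ≡ x → Opp x y → S ↭ (u ++ y ∷ v) ∷ S′ →
    Component ι (v ++ u ++ w) S′ → Component ι (x ∷ w) S
  component-merge {x} {y} {S} {u} {v} {S′} {w} ιx ιy o p c = record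
    { inside = (u ++ y ∷ v) ∷ C.inside
    ; outside = C.outside
    ; vertices = C.vertices
    ; part = ↭-trans p (prep _ C.part)
    ; closed = C.closed
    ; deriv = λ h → perm (prep _ (↭-sym p)) (merge ιx ιy (C.deriv h))
    ; bound = subst₂ _≤_ lo hi (+-monoʳ-≤ 2 C.bound)
    ; tight = λ h → merge ιx ιy o (C.tight (+-cancelˡ-≡ 2 _ _ (trans lo (trans h (sym hi)))))
    }
    where
    module C = Component c
    lem₁ : ∀ a q → 2 * a + 2 * suc q ≡ 2 + (2 * a + 2 * q)
    lem₁ = solve-∀
    lem₂ : ∀ u v w q → 2 + (v + (u + w) + q + 2) ≡ suc w + (u + suc v + q) + 2
    lem₂ = solve-∀
    lo : 2 + excess C.vertices C.inside ≡ excess C.vertices ((u ++ y ∷ v) ∷ C.inside)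
    lo = sym (lem₁ C.vertices (length C.inside))
    hi : 2 + capacity (v ++ u ++ w) C.inside ≡ capacity (x ∷ w) ((u ++ y ∷ v) ∷ C.inside)
    hi rewrite length-++ v {u ++ w} | length-++ u {w} | length-++ (u ++ y ∷ v) {concat C.inside}
             | length-++ u {y ∷ v} = lem₂ (length u) (length v) (length w) (length (concat C.inside))

  -- Each deletion removes two letters, so their number bounds the recursion. When the first edge
  -- cuts `w`, the search starts from `u` with `v` among the other polygons: meeting `v` reveals a
  -- handle; otherwise `v` is searched next, within what the first search left outside.
  component : ∀ f w S → length (w ++ concat S) ≤ f → Unique (w ++ concat S) →
              Closed ι (w ++ concat S) → Component ι w S
  -- An empty polygon is a sphere with one vertex and no edge, and the bound reads 2 ≤ 2.
  component f [] S _ _ c = record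
    { inside = [] ; outside = S ; vertices = 1 ; part = ↭-refl ; closed = c ; deriv = empty
    ; bound = ≤-refl ; tight = λ _ → nil }
  component (suc f) (x ∷ r) S (s≤s l) un c with c (here refl)
  -- A letter glued to itself would differ from itself in colour.
  ... | here e , _ , o = ⊥-elim (o (cong isEven (sym e)))
  ... | there ιx∈ , ιy , o with ∈-++⁻ r ιx∈
  ...   | inj₁ ιx∈r with ∈-∃++ ιx∈r
  ...     | u , v , refl = go
    where
    x′ = ι x
    p : x ∷ x′ ∷ u ++ v ++ concat S ↭ x ∷ (u ++ x′ ∷ v) ++ concat S
    p = ↭-trans (pair-↭ u (v ++ concat S)) (↭-reflexive (cong (x ∷_) (sym (++-assoc u (x′ ∷ v) (concat S)))))
    unp = Unique-resp-↭ (↭-sym p) un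
    l′ : length (u ++ v ++ concat S) ≤ f
    l′ = ≤-trans (n≤1+n _) (≤-trans (≤-reflexive (suc-injective (↭-length p))) l)
    first : Component ι u (v ∷ S)
    first = component f u (v ∷ S) l′ (Unique-++ʳ (x ∷ x′ ∷ []) unp)
              (closed-drop refl ιy unp (closed-↭ (↭-sym p) c))
    module C = Component first
    q : concat C.inside ++ concat C.outside ↭ v ++ concat S
    q = ↭-trans (↭-reflexive (concat-++ C.inside C.outside)) (concat-↭ (↭-sym C.part))
    go : Component ι (x ∷ u ++ x′ ∷ v) S
    go with ∈-++⁻ C.inside (∈-resp-↭ C.part (here refl))
    ... | inj₁ v∈Q = component-split-joined refl ιy first (proj₂ (∈⇒↭ v∈Q))
    ... | inj₂ v∈R with ∈⇒↭ v∈R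
    ...   | R′ , s = component-split-apart refl ιy o first s (component f v R′ l″
              (Unique-resp-↭ (concat-↭ s) (Unique-++ʳ (concat C.inside) (Unique-resp-↭ (↭-sym q)
                 (Unique-++ʳ (x ∷ x′ ∷ u) unp))))
              (closed-↭ (concat-↭ s) C.closed))
      where
      l″ : length (concat (v ∷ R′)) ≤ f
      l″ = begin
        length (concat (v ∷ R′))                   ≡⟨ ↭-length (concat-↭ s) ⟨
        length (concat C.outside)                        ≤⟨ m≤n+m _ (length (concat C.inside)) ⟩
        length (concat C.inside) + length (concat C.outside)  ≡⟨ length-++ (concat C.inside) ⟨
        length (concat C.inside ++ concat C.outside)          ≡⟨ ↭-length q ⟩
        length (v ++ concat S)                     ≤⟨ m≤n+m _ (length u) ⟩
        length u + length (v ++ concat S)          ≡⟨ length-++ u ⟨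
        length (u ++ v ++ concat S)                ≤⟨ l′ ⟩
        f                                          ∎
        where open ≤-Reasoning
  component (suc f) (x ∷ r) S (s≤s l) un c | there ιx∈ , ιy , o | inj₂ ιx∈S
    with ∈-concat⁻′ S ιx∈S
  ... | W , ιx∈W , W∈S with ∈-∃++ ιx∈W | ∈⇒↭ W∈S
  ...   | u , v , refl | S′ , s = component-merge refl ιy o s
            (component f (v ++ u ++ r) S′ l′ (Unique-++ʳ (x ∷ x′ ∷ []) unp)
              (closed-drop refl ιy unp (closed-↭ (↭-sym p) c)))
    where
    x′ = ι x
    p : x ∷ x′ ∷ (v ++ u ++ r) ++ concat S′ ↭ x ∷ r ++ concat S
    p = prep x (begin
      (x′ ∷ v ++ u ++ r) ++ concat S′         ↭⟨ ++⁺ʳ (concat S′) (begin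
        (x′ ∷ v) ++ u ++ r                    ≡⟨ ++-assoc (x′ ∷ v) u r ⟨
        ((x′ ∷ v) ++ u) ++ r                  ↭⟨ ++-comm ((x′ ∷ v) ++ u) r ⟩
        r ++ (x′ ∷ v) ++ u                    ↭⟨ ++⁺ˡ r (++-comm (x′ ∷ v) u) ⟩
        r ++ u ++ x′ ∷ v                      ∎) ⟩
      (r ++ u ++ x′ ∷ v) ++ concat S′         ≡⟨ ++-assoc r (u ++ x′ ∷ v) (concat S′) ⟩
      r ++ concat ((u ++ x′ ∷ v) ∷ S′)        ↭⟨ ++⁺ˡ r (concat-↭ (↭-sym s)) ⟩
      r ++ concat S                          ∎)
      where open PermutationReasoning
    unp = Unique-resp-↭ (↭-sym p) un
    l′ : length ((v ++ u ++ r) ++ concat S′) ≤ f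
    l′ = ≤-trans (n≤1+n _) (≤-trans (≤-reflexive (suc-injective (↭-length p))) l)

-- Gluings of one polygon

∑ : ℕ → (ℕ → ℕ) → ℕ
∑ zero    f = 0
∑ (suc n) f = f 0 + ∑ n (f ∘ suc)

∑-cong : ∀ n {f g : ℕ → ℕ} → (∀ i → i < n → f i ≡ g i) → ∑ n f ≡ ∑ n g
∑-cong zero    h = refl
∑-cong (suc n) h = cong₂ _+_ (h 0 (s≤s z≤n)) (∑-cong n (λ i i<n → h (suc i) (s≤s i<n)))

length-concatMap-applyUpTo : ∀ (g : ℕ → List X) h n →
  length (concatMap g (applyUpTo h n)) ≡ ∑ n (length ∘ g ∘ h)
length-concatMap-applyUpTo g h zero    = refl
length-concatMap-applyUpTo g h (suc n) = trans (length-++ (g (h 0)))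
  (cong (length (g (h 0)) +_) (length-concatMap-applyUpTo g (h ∘ suc) n))

length-cartesianProduct : ∀ (xs : List X) (ys : List Y) →
  length (cartesianProduct xs ys) ≡ length xs * length ys
length-cartesianProduct []       ys = refl
length-cartesianProduct (x ∷ xs) ys = trans (length-++ (map (x ,_) ys))
  (cong₂ _+_ (length-map (x ,_) ys) (length-cartesianProduct xs ys))

++-injective : ∀ (xs xs′ : List X) {ys ys′} → length xs ≡ length xs′ → xs ++ ys ≡ xs′ ++ ys′ →
  xs ≡ xs′ × ys ≡ ys′
++-injective []       []         l h = refl , h
++-injective (x ∷ xs) (x′ ∷ xs′) l h with ∷-injective h
... | refl , t with ++-injective xs xs′ (suc-injective l) t
...   | refl , t′ = refl , t′

Cut : Set
Cut = List ℕ × ℕ × List ℕ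

-- Total, with dummy values when the word is too short. Hence the number of entries in the
-- enumerations depends on the sizes alone and can be computed for arbitrary words.
cut : ℕ → List ℕ → Cut
cut i       []      = [] , 0 , []
cut zero    (x ∷ r) = [] , x , r
cut (suc i) (x ∷ r) = let (u , y , v) = cut i r in x ∷ u , y , v

cut-++ : ∀ u → cut (length u) (u ++ y ∷ v) ≡ (u , y , v)
cut-++ []      = refl
cut-++ {y} {v} (x ∷ u) rewrite cut-++ {y} {v} u = refl

cut-spec : ∀ i r → i < length r → ∃ λ u → ∃ λ y → ∃ λ v →
  r ≡ u ++ y ∷ v × length u ≡ i × cut i r ≡ (u , y , v)
cut-spec zero    (x ∷ r) _ = [] , x , r , refl , refl , refl
cut-spec (suc i) (x ∷ r) (s≤s l) with cut-spec i r l
... | u , y , v , refl , refl , h = x ∷ u , y , v , refl , refl , cong (λ (u , y , v) → x ∷ u , y , v) h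

split-unique : ∀ u u′ {v v′} → Unique (u ++ y ∷ v) → u ++ y ∷ v ≡ u′ ++ y ∷ v′ → length u ≡ length u′
split-unique []      []       un h = refl
split-unique []      (_ ∷ u′) (p ∷ _) h with ∷-injective h
... | refl , refl = ⊥-elim (All.lookup p (∈-++⁺ʳ u′ (here refl)) refl)
split-unique (_ ∷ u) []       (p ∷ _) h with ∷-injective h
... | refl , _ = ⊥-elim (All.lookup p (∈-++⁺ʳ u (here refl)) refl)
split-unique (_ ∷ u) (_ ∷ u′) (_ ∷ un) h = cong suc (split-unique u u′ un (proj₂ (∷-injective h)))

-- In an alternating word, the colour found `n` places after a letter of colour `b`.
flips : ℕ → Bool → Bool
flips zero    b = b
flips (suc n) b = flips n (not b)

flips-+ : ∀ m n b → flips (m + n) b ≡ flips n (flips m b)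
flips-+ zero    n b = refl
flips-+ (suc m) n b = flips-+ m n (not b)

flips-2* : ∀ n b → flips (2 * n) b ≡ b
flips-2* zero    b = refl
flips-2* (suc n) b rewrite +-suc n (n + 0) | not-involutive b = flips-2* n b

not-≢ : ∀ b → not b ≢ b
not-≢ true  ()
not-≢ false ()

flips-even : ∀ m b → flips m b ≡ b → ∃ λ j → m ≡ 2 * j
flips-odd  : ∀ m b → flips m b ≡ not b → ∃ λ j → m ≡ suc (2 * j)
flips-even zero    b h = 0 , refl
flips-even (suc m) b h with flips-odd m (not b) (trans h (sym (not-involutive b)))
... | j , refl = suc j , cong suc (sym (+-suc j (j + 0)))
flips-odd zero    b h = ⊥-elim (not-≢ b (sym h))
flips-odd (suc m) b h with flips-even m (not b) h
... | j , refl = j , refl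

-- Words stay alternating when edges between opposite colours are deleted. A position thus
-- determines a colour, and `Opp` becomes a condition on lengths.
Alt : Bool → List ℕ → Set
Alt b []      = ⊤
Alt b (x ∷ w) = isEven x ≡ b × Alt (not b) w

alt-++⁻ : ∀ u → Alt b (u ++ v) → Alt b u × Alt (flips (length u) b) v
alt-++⁻ []      h       = tt , h
alt-++⁻ (x ∷ u) (e , h) with alt-++⁻ u h
... | p , q = (e , p) , q

alt-++⁺ : ∀ u → Alt b u → Alt (flips (length u) b) v → Alt b (u ++ v)
alt-++⁺ []      _       q = q
alt-++⁺ (x ∷ u) (e , p) q = e , alt-++⁺ u p q

record AltArc (b : Bool) (x : ℕ) (u : List ℕ) (y : ℕ) (v : List ℕ) : Set where
  field
    alt-u : Alt (not b) u
    alt-v : Alt b v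
    opp   : Opp x y

alt-arc : ∀ j → length u ≡ 2 * j → Alt b (x ∷ u ++ y ∷ v) → AltArc b x u y v
alt-arc {u = u} {b = b} {v = v} j l (ex , h) with alt-++⁻ u h
... | p , (ey , q) rewrite l | flips-2* j (not b) = record
  { alt-u = p
  ; alt-v = subst (λ c → Alt c v) (not-involutive b) q
  ; opp = λ e → not-≢ b (trans (sym ey) (trans (sym e) ex)) }

-- Between letters of opposite colours lie evenly many others, so the cuts at `2 * j` in `enumNC`
-- reach every admissible partner.
opp-even : ∀ u → Alt b (x ∷ u ++ y ∷ v) → Opp x y → ∃ λ j → length u ≡ 2 * j
opp-even {b = b} u (ex , h) o with alt-++⁻ u h
... | _ , (ey , _) = flips-even (length u) (not b) (trans (sym ey)
        (¬-not (λ e → o (trans ex (sym e)))))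

joinArc : ℕ → ℕ → List ℕ × List ℕ → List ℕ
joinArc x y (a , b) = y ∷ a ++ x ∷ b

-- enumNC f k w lists map ι w for the noncrossing ι on a word w of length 2k, provided k ≤ f.
mutual
  enumNC : ℕ → ℕ → List ℕ → List (List ℕ)
  enumNC f       zero    w = [ [] ]
  enumNC zero    (suc k) w = []
  enumNC (suc f) (suc k) w = concatMap (λ j → arcs f j (k ∸ j) (nth w 0) (cut (2 * j) (drop 1 w))) (upTo (suc k))

  arcs : ℕ → ℕ → ℕ → ℕ → Cut → List (List ℕ)
  arcs f j i x (u , y , v) = map (joinArc x y) (cartesianProduct (enumNC f j u) (enumNC f i v))

-- For k ≤ f these are the Catalan numbers, by Segner's recursion.
cat : ℕ → ℕ → ℕ
cat f       zero    = 1
cat zero    (suc k) = 0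
cat (suc f) (suc k) = ∑ (suc k) (λ j → cat f j * cat f (k ∸ j))

length-enumNC : ∀ f k w → length (enumNC f k w) ≡ cat f k
length-enumNC f       zero    w = refl
length-enumNC zero    (suc k) w = refl
length-enumNC (suc f) (suc k) w = trans (length-concatMap-applyUpTo (λ j → arcs f j (k ∸ j) (nth w 0) (cut (2 * j) (drop 1 w))) id (suc k))
  (∑-cong (suc k) λ j _ → let (u , y , v) = cut (2 * j) (drop 1 w) in begin
    length (arcs f j (k ∸ j) (nth w 0) (u , y , v))                   ≡⟨ length-map (joinArc (nth w 0) y) (cartesianProduct (enumNC f j u) (enumNC f (k ∸ j) v)) ⟩
    length (cartesianProduct (enumNC f j u) (enumNC f (k ∸ j) v))     ≡⟨ length-cartesianProduct (enumNC f j u) (enumNC f (k ∸ j) v) ⟩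
    length (enumNC f j u) * length (enumNC f (k ∸ j) v)               ≡⟨ cong₂ _*_ (length-enumNC f j u) (length-enumNC f (k ∸ j) v) ⟩
    cat f j * cat f (k ∸ j)                                           ∎)
  where open ≡-Reasoning

2*suc : ∀ k → 2 * suc k ≡ suc (suc (2 * k))
2*suc k = cong suc (+-suc k (k + 0))

record CutAt (k j : ℕ) (r : List ℕ) : Set where
  constructor cutAt
  field
    {front}   : List ℕ
    {partner} : ℕ
    {back}    : List ℕ
    eq        : r ≡ front ++ partner ∷ back
    len-front : length front ≡ 2 * j
    len-back  : length back ≡ 2 * (k ∸ j)
    cut-≡     : cut (2 * j) r ≡ (front , partner , back)

len-rest : ∀ k j l → j ≤ k → 2 * j + suc l ≡ suc (2 * k) → l ≡ 2 * (k ∸ j)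
len-rest k j l j≤k h = +-cancelˡ-≡ (2 * j) l _ (begin
  2 * j + l             ≡⟨ suc-injective (trans (sym (+-suc (2 * j) l)) h) ⟩
  2 * k                 ≡⟨ cong (2 *_) (m+[n∸m]≡n j≤k) ⟨
  2 * (j + (k ∸ j))     ≡⟨ *-distribˡ-+ 2 j (k ∸ j) ⟩
  2 * j + 2 * (k ∸ j)   ∎)
  where open ≡-Reasoning

cut-at : ∀ k j r → length r ≡ suc (2 * k) → j < suc k → CutAt k j r
cut-at k j r l (s≤s j≤k) with cut-spec (2 * j) r (≤-trans (s≤s (*-monoʳ-≤ 2 j≤k)) (≤-reflexive (sym l)))
... | u , y , v , refl , lu , h = cutAt refl lu
  (len-rest k j (length v) j≤k (trans (cong (_+ suc (length v)) (sym lu)) (trans (sym (length-++ u)) l))) h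

tail-length : ∀ k → suc m ≡ 2 * suc k → m ≡ suc (2 * k)
tail-length k h = suc-injective (trans h (2*suc k))

∈-arcs⁻ : ∀ f j i {x u y v z} → z ∈ arcs f j i x (u , y , v) →
  ∃ λ a → ∃ λ b → z ≡ y ∷ a ++ x ∷ b × a ∈ enumNC f j u × b ∈ enumNC f i v
∈-arcs⁻ f j i {x} {u} {y} {v} z∈ with ∈-map⁻ (joinArc x y) z∈
... | (a , b) , ab∈ , refl with ∈-cartesianProduct⁻ (enumNC f j u) (enumNC f i v) ab∈
...   | a∈ , b∈ = a , b , refl , a∈ , b∈

∈-arcs⁺ : ∀ f j i {x u y v a b} → a ∈ enumNC f j u → b ∈ enumNC f i v →
  y ∷ a ++ x ∷ b ∈ arcs f j i x (u , y , v)
∈-arcs⁺ f j i {x} {u} {y} a∈ b∈ = ∈-map⁺ (joinArc x y) (∈-cartesianProduct⁺ a∈ b∈)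

∈-enumNC⁻ : ∀ f k x r {z} → length r ≡ suc (2 * k) → z ∈ enumNC (suc f) (suc k) (x ∷ r) →
  ∃ λ j → Σ (CutAt k j r) λ c → let open CutAt c in z ∈ arcs f j (k ∸ j) x (front , partner , back)
∈-enumNC⁻ f k x r {z} l z∈ with ∈-concatMap⁻′ _ (upTo (suc k)) z∈
... | j , j∈ , z∈′ with cut-at k j r l (∈-upTo⁻ j∈)
...   | c = j , c , subst (λ t → z ∈ arcs f j (k ∸ j) x t) (CutAt.cut-≡ c) z∈′

length-++-∷ : ∀ (a u : List ℕ) {b v} → length a ≡ length u → length b ≡ length v →
  length (a ++ x ∷ b) ≡ length (u ++ y ∷ v)
length-++-∷ a u p q = trans (length-++ a) (trans (cong₂ _+_ p (cong suc q)) (sym (length-++ u)))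

-- Entries are concatenations without separators; only their lengths allow `++-injective` to recover
-- the pieces.
enumNC-length : ∀ f k w → length w ≡ 2 * k → ∀ {s} → s ∈ enumNC f k w → length s ≡ length w
enumNC-length f zero [] l (here refl) = refl
enumNC-length (suc f) (suc k) (x ∷ r) l s∈ with ∈-enumNC⁻ f k x r (tail-length k l) s∈
... | j , cutAt {u} {y} {v} refl lu lv _ , s∈′ with ∈-arcs⁻ f j (k ∸ j) s∈′
...   | a , b , refl , a∈ , b∈ = cong suc
        (length-++-∷ a u (enumNC-length f j u lu a∈) (enumNC-length f (k ∸ j) v lv b∈))

map-joinArc : ∀ u {v a b} → length a ≡ length u → map ι (x ∷ u ++ y ∷ v) ≡ y ∷ a ++ x ∷ b →
  ι x ≡ y × ι y ≡ x × map ι u ≡ a × map ι v ≡ b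
map-joinArc {ι} {y = y} u {v} {a} l h with ∷-injective h
... | ιx , t with ++-injective (map ι u) a (trans (length-map ι u) (sym l)) (trans (sym (map-++ ι u (y ∷ v))) t)
...   | p , q with ∷-injective q
...     | ιy , s = ιx , ιy , p , s

NC-sound : ∀ f k w → length w ≡ 2 * k → Alt b w → map ι w ∈ enumNC f k w → NC ι w
NC-sound f zero [] l h s∈ = []
NC-sound (suc f) (suc k) (x ∷ r) l h s∈ with ∈-enumNC⁻ f k x r (tail-length k l) s∈
... | j , cutAt {u} {y} {v} refl lu lv _ , s∈′ with ∈-arcs⁻ f j (k ∸ j) s∈′
...   | a , b , e , a∈ , b∈ with map-joinArc u (enumNC-length f j u lu a∈) e
...     | ιx , ιy , refl , refl =
  let open AltArc (alt-arc {u = u} {x = x} j lu h) in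
  arc ιx ιy opp (NC-sound f j u lu alt-u a∈) (NC-sound f (k ∸ j) v lv alt-v b∈)

∈-enumNC⁺ : ∀ f k j {x u y v} → length (u ++ y ∷ v) ≡ suc (2 * k) → length u ≡ 2 * j →
  ∀ {z} → z ∈ arcs f j (k ∸ j) x (u , y , v) → z ∈ enumNC (suc f) (suc k) (x ∷ u ++ y ∷ v)
∈-enumNC⁺ f k j {x} {u} {y} {v} l lu {z} z∈ = ∈-concatMap⁺′ _ (∈-upTo⁺ j<)
  (subst (λ t → z ∈ arcs f j (k ∸ j) x t) (sym (trans (cong (λ i → cut i (u ++ y ∷ v)) (sym lu)) (cut-++ u))) z∈)
  where
  j< : j < suc k
  j< = s≤s (*-cancelˡ-≤ 2 (≤-pred (begin
    suc (2 * j)                  ≡⟨ cong suc lu ⟨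
    suc (length u)               ≤⟨ m≤m+n _ (length v) ⟩
    suc (length u + length v)    ≡⟨ +-suc (length u) (length v) ⟨
    length u + suc (length v)    ≡⟨ length-++ u ⟨
    length (u ++ y ∷ v)          ≡⟨ l ⟩
    suc (2 * k)                  ∎)))
    where open ≤-Reasoning

j≤k-from : ∀ k j l → 2 * j + suc l ≡ suc (2 * k) → j ≤ k
j≤k-from k j l h = *-cancelˡ-≤ 2 (≤-pred (≤-trans (s≤s (m≤m+n (2 * j) l)) (≤-reflexive (trans (sym (+-suc (2 * j) l)) h))))

NC-complete : ∀ f k w → k ≤ f → length w ≡ 2 * k → Alt b w → NC ι w → map ι w ∈ enumNC f k w
NC-complete f zero [] _ l h n = here refl
NC-complete {ι = ι} (suc f) (suc k) _ (s≤s k≤f) l h (arc {x = x} {y} {u} {v} ιx ιy o p q)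
  with opp-even {x = x} u h o
... | j , lu = subst (_∈ enumNC (suc f) (suc k) (x ∷ u ++ y ∷ v)) (sym eq)
        (∈-enumNC⁺ f k j l′ lu (∈-arcs⁺ f j (k ∸ j)
          (NC-complete f j u (≤-trans j≤k k≤f) lu alt-u p)
          (NC-complete f (k ∸ j) v (≤-trans (m∸n≤m k j) k≤f) (len-rest k j (length v) j≤k l″) alt-v q)))
  where
  open AltArc (alt-arc {u = u} {x = x} j lu h)
  l′ : length (u ++ y ∷ v) ≡ suc (2 * k)
  l′ = tail-length k l
  l″ : 2 * j + suc (length v) ≡ suc (2 * k)
  l″ = trans (cong (_+ suc (length v)) (sym lu)) (trans (sym (length-++ u)) l′)
  j≤k : j ≤ k
  j≤k = j≤k-from k j (length v) l″
  eq : map ι (x ∷ u ++ y ∷ v) ≡ y ∷ map ι u ++ x ∷ map ι v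
  eq = cong₂ _∷_ ιx (trans (map-++ ι u (y ∷ v)) (cong (λ t → map ι u ++ t ∷ map ι v) ιy))

joinArc-injective : ∀ {a a′ b b′} → length a ≡ length a′ → joinArc x y (a , b) ≡ joinArc x y (a′ , b′) →
  (a , b) ≡ (a′ , b′)
joinArc-injective {a = a} {a′} l h with ++-injective a a′ l (proj₂ (∷-injective h))
... | refl , t with ∷-injective t
...   | _ , refl = refl

unique-arcs : ∀ f j i {x u y v} → length u ≡ 2 * j → Unique (enumNC f j u) → Unique (enumNC f i v) →
  Unique (arcs f j i x (u , y , v))
unique-arcs f j i {x} {u} {y} {v} lu p q = Unique-map-on (joinArc x y)
  (λ s t → joinArc-injective (trans (len s) (sym (len t)))) (Uniq.cartesianProduct⁺ p q)
  where
  len : ∀ {ab} → ab ∈ cartesianProduct (enumNC f j u) (enumNC f i v) → length (proj₁ ab) ≡ length u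
  len s = enumNC-length f j u lu (proj₁ (∈-cartesianProduct⁻ (enumNC f j u) (enumNC f i v) s))

cutAt-injective : ∀ {k j j′ r} → Unique r → (c : CutAt k j r) (c′ : CutAt k j′ r) →
  CutAt.partner c ≡ CutAt.partner c′ → j ≡ j′
cutAt-injective {j = j} {j′} un (cutAt {u} refl lu _ _) (cutAt {u′} e lu′ _ _) refl =
  *-cancelˡ-≡ j j′ 2 (trans (sym lu) (trans (split-unique u u′ un e) lu′))

-- The first value of an entry is the partner of the first letter. As letters do not repeat, it
-- determines the cut, so different `j` give disjoint lists.
unique-enumNC : ∀ f k w → length w ≡ 2 * k → Unique w → Unique (enumNC f k w)
unique-enumNC f zero w l un = [] ∷ []
unique-enumNC zero (suc k) w l un = []
unique-enumNC (suc f) (suc k) (x ∷ r) l (_ ∷ un) = Unique-concatMap _ (upTo⁺ (suc k)) each cross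
  where
  l′ = tail-length k l
  at : ∀ {j} → j ∈ upTo (suc k) → CutAt k j r
  at j∈ = cut-at k _ r l′ (∈-upTo⁻ j∈)
  each : ∀ {j} → j ∈ upTo (suc k) → Unique (arcs f j (k ∸ j) x (cut (2 * j) r))
  each {j} j∈ with at j∈
  ... | cutAt {u} {y} {v} refl lu lv h rewrite h = unique-arcs f j (k ∸ j) lu
    (unique-enumNC f j u lu (Unique-++ˡ u un))
    (unique-enumNC f (k ∸ j) v lv (Unique-++ʳ (y ∷ []) (Unique-++ʳ u un)))
  head≡ : ∀ {j} (c : CutAt k j r) {z} → z ∈ arcs f j (k ∸ j) x (cut (2 * j) r) → nth z 0 ≡ CutAt.partner c
  head≡ {j} (cutAt refl lu lv h) z∈ rewrite h with ∈-arcs⁻ f j (k ∸ j) z∈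
  ... | a , b , refl , _ = refl
  cross : ∀ {i j z} → i ∈ upTo (suc k) → j ∈ upTo (suc k) → z ∈ arcs f i (k ∸ i) x (cut (2 * i) r) →
          z ∈ arcs f j (k ∸ j) x (cut (2 * j) r) → i ≡ j
  cross i∈ j∈ p q = cutAt-injective un (at i∈) (at j∈) (trans (sym (head≡ (at i∈) p)) (head≡ (at j∈) q))

-- Gluings of two polygons

-- start e b is the colour of the first letter of W when w starts with the colour b; pos e i are
-- the positions in W of the letters of the colour opposite to b.
start : Bool → Bool → Bool
start true  b = b
start false b = not b

pos : Bool → ℕ → ℕ
pos true  i = suc (2 * i)
pos false i = 2 * i

-- The front piece `u` starts with the other colour while `W` is unchanged; flipping `e` as well
-- compensates. Hence `not e` in `loops`.
start-not : ∀ e b → start (not e) (not b) ≡ start e b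
start-not true  b = not-involutive b
start-not false b = refl

flips-pos : ∀ e i b → flips (pos e i) (start e b) ≡ not b
flips-pos true  i b = flips-2* i (not b)
flips-pos false i b = flips-2* i (not b)

flips-pos⁻ : ∀ e m b → flips m (start e b) ≡ not b → ∃ λ i → m ≡ pos e i
flips-pos⁻ true  m b = flips-odd m b
flips-pos⁻ false m b = flips-even m (not b)

pos-< : ∀ e {i q} → i < q → pos e i < 2 * q
pos-< e {i} {q} i<q = ≤-trans (bound e) (≤-trans (≤-reflexive (sym (2*suc i))) (*-monoʳ-≤ 2 i<q))
  where
  bound : ∀ e → suc (pos e i) ≤ suc (suc (2 * i))
  bound true  = ≤-refl
  bound false = n≤1+n _

pos-<⁻ : ∀ e {i q} → pos e i < 2 * q → i < q
pos-<⁻ e {i} {q} h = *-cancelˡ-< 2 i q (≤-trans (s≤s (bound e)) h)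
  where
  bound : ∀ e → 2 * i ≤ pos e i
  bound true  = n≤1+n _
  bound false = ≤-refl

pos-injective : ∀ e {i j} → pos e i ≡ pos e j → i ≡ j
pos-injective true  h = *-cancelˡ-≡ _ _ 2 (suc-injective h)
pos-injective false h = *-cancelˡ-≡ _ _ 2 h

joinL : ℕ → ℕ → List ℕ × (List ℕ × List ℕ) → List ℕ × List ℕ
joinL x y (a , (b , c)) = y ∷ a ++ x ∷ b , c

joinR : ℕ → ℕ → (List ℕ × List ℕ) × List ℕ → List ℕ × List ℕ
joinR x y ((a , c) , b) = y ∷ a ++ x ∷ b , c

-- The list `s` holds the values on the merged word `v ++ u ++ r`. They are put back in the order of
-- the two polygons `x ∷ r` and `u ++ y ∷ v`, with the values of the bridge inserted.
joinB : ℕ → ℕ → List ℕ → List ℕ → List ℕ → List ℕ × List ℕ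
joinB x y u v s = let t = drop (length v) s in
  y ∷ drop (length u) t , take (length u) t ++ x ∷ take (length v) s

bridges : ℕ → ℕ → ℕ → List ℕ → Cut → List (List ℕ × List ℕ)
bridges f k x r (u , y , v) = map (joinB x y u v) (enumNC f k (v ++ u ++ r))

-- enumAnn f e p q w W lists (map ι w , map ι W) for the planar connected ι on words of
-- lengths 2p and 2q, provided p + q ≤ f.
mutual
  enumAnn : ℕ → Bool → ℕ → ℕ → List ℕ → List ℕ → List (List ℕ × List ℕ)
  enumAnn f       e zero    q w W = []
  enumAnn zero    e (suc p) q w W = []
  enumAnn (suc f) e (suc p) q w W =
    concatMap (λ j → loops f e j (p ∸ j) q (nth w 0) W (cut (2 * j) (drop 1 w))) (upTo (suc p)) ++
    concatMap (λ i → bridges f (p + q) (nth w 0) (drop 1 w) (cut (pos e i) W)) (upTo q)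

  loops : ℕ → Bool → ℕ → ℕ → ℕ → ℕ → List ℕ → Cut → List (List ℕ × List ℕ)
  loops f e j i q x W (u , y , v) =
    map (joinL x y) (cartesianProduct (enumNC f j u) (enumAnn f e i q v W)) ++
    map (joinR x y) (cartesianProduct (enumAnn f (not e) j q u W) (enumNC f i v))

-- For p + q ≤ f this is A(p,q) of the overview. The flag `e` has gone, because a word of length 2q
-- has `q` letters of either colour.
ann : ℕ → ℕ → ℕ → ℕ
ann f       zero    q = 0
ann zero    (suc p) q = 0
ann (suc f) (suc p) q =
  ∑ (suc p) (λ j → cat f j * ann f (p ∸ j) q + ann f j q * cat f (p ∸ j)) + ∑ q (λ _ → cat f (p + q))

length-enumAnn : ∀ f e p q w W → length (enumAnn f e p q w W) ≡ ann f p q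
length-enumAnn f       e zero    q w W = refl
length-enumAnn zero    e (suc p) q w W = refl
length-enumAnn (suc f) e (suc p) q w W = trans (length-++ (concatMap loop (upTo (suc p)))) (cong₂ _+_
  (trans (length-concatMap-applyUpTo loop id (suc p)) (∑-cong (suc p) λ j _ → loop≡ j (cut (2 * j) (drop 1 w))))
  (trans (length-concatMap-applyUpTo bridges′ id q) (∑-cong q λ i _ → bridge≡ (cut (pos e i) W))))
  where
  loop bridges′ : ℕ → List (List ℕ × List ℕ)
  loop j = loops f e j (p ∸ j) q (nth w 0) W (cut (2 * j) (drop 1 w))
  bridges′ i = bridges f (p + q) (nth w 0) (drop 1 w) (cut (pos e i) W)
  loop≡ : ∀ j c → length (loops f e j (p ∸ j) q (nth w 0) W c) ≡
                  cat f j * ann f (p ∸ j) q + ann f j q * cat f (p ∸ j)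
  loop≡ j (u , y , v) = trans (length-++ (map (joinL (nth w 0) y) (cartesianProduct (enumNC f j u) (enumAnn f e (p ∸ j) q v W))))
    (cong₂ _+_
      (trans (length-map (joinL (nth w 0) y) (cartesianProduct (enumNC f j u) (enumAnn f e (p ∸ j) q v W)))
        (trans (length-cartesianProduct (enumNC f j u) (enumAnn f e (p ∸ j) q v W))
          (cong₂ _*_ (length-enumNC f j u) (length-enumAnn f e (p ∸ j) q v W))))
      (trans (length-map (joinR (nth w 0) y) (cartesianProduct (enumAnn f (not e) j q u W) (enumNC f (p ∸ j) v)))
        (trans (length-cartesianProduct (enumAnn f (not e) j q u W) (enumNC f (p ∸ j) v))
          (cong₂ _*_ (length-enumAnn f (not e) j q u W) (length-enumNC f (p ∸ j) v)))))
  bridge≡ : ∀ c → length (bridges f (p + q) (nth w 0) (drop 1 w) c) ≡ cat f (p + q)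
  bridge≡ (u , y , v) = trans (length-map (joinB (nth w 0) y u v) (enumNC f (p + q) (v ++ u ++ drop 1 w)))
    (length-enumNC f (p + q) (v ++ u ++ drop 1 w))

record BridgeAt (e : Bool) (i : ℕ) (W : List ℕ) : Set where
  constructor bridgeAt
  field
    {front}   : List ℕ
    {partner} : ℕ
    {back}    : List ℕ
    eq        : W ≡ front ++ partner ∷ back
    len-front : length front ≡ pos e i
    cut-≡     : cut (pos e i) W ≡ (front , partner , back)

bridge-at : ∀ e i q W → length W ≡ 2 * q → i < q → BridgeAt e i W
bridge-at e i q W l i<q with cut-spec (pos e i) W (≤-trans (pos-< e i<q) (≤-reflexive (sym l)))
... | u , y , v , h , lu , c = bridgeAt h lu c

length-bridge : ∀ p q → length r ≡ suc (2 * p) → ∀ u → length (u ++ y ∷ v) ≡ 2 * q →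
  length (v ++ u ++ r) ≡ 2 * (p + q)
length-bridge {r} {y} {v} p q lr u l = begin
  length (v ++ u ++ r)                     ≡⟨ trans (length-++ v) (cong (length v +_) (length-++ u)) ⟩
  length v + (length u + length r)         ≡⟨ cong (λ t → length v + (length u + t)) lr ⟩
  length v + (length u + suc (2 * p))      ≡⟨ lem (length v) (length u) (2 * p) ⟩
  2 * p + (length u + suc (length v))      ≡⟨ cong (2 * p +_) (trans (sym (length-++ u)) l) ⟩
  2 * p + 2 * q                            ≡⟨ *-distribˡ-+ 2 p q ⟨
  2 * (p + q)                              ∎
  where
  open ≡-Reasoning
  lem : ∀ v u p → v + (u + suc p) ≡ p + (u + suc v)
  lem = solve-∀

-- The colours fit at both junctions: `W` has even length, so its colours alternate cyclically from
-- `v` into `u`; and `u` is followed in `W` by `y`, which has the colour of the first letter of `r`,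
-- opposite to that of `x`.
alt-bridge : ∀ q → Alt b (x ∷ r) → Alt (start e b) (u ++ y ∷ v) → length (u ++ y ∷ v) ≡ 2 * q →
  flips (length u) (start e b) ≡ not b → Alt b (v ++ u ++ r) × Opp x y
alt-bridge {b} {x} {r} {e} {u} {y} {v} q (ex , ar) h l fl with alt-++⁻ u h
... | au , (ey , av) =
  alt-++⁺ v (subst (λ c → Alt c v) (trans (cong not fl) (not-involutive b)) av)
    (subst (λ c → Alt c (u ++ r)) (sym flv) (alt-++⁺ u au (subst (λ c → Alt c r) (sym fl) ar))) ,
  λ o → not-≢ b (trans (sym (trans ey fl)) (trans (sym o) ex))
  where
  open ≡-Reasoning
  flv : flips (length v) b ≡ start e b
  flv = begin
    flips (length v) b                                         ≡⟨ cong (flips (length v)) (not-involutive b) ⟨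
    flips (length v) (not (not b))                             ≡⟨ cong (flips (suc (length v))) fl ⟨
    flips (suc (length v)) (flips (length u) (start e b))      ≡⟨ flips-+ (length u) (suc (length v)) (start e b) ⟨
    flips (length u + suc (length v)) (start e b)              ≡⟨ cong (λ n → flips n (start e b)) (trans (sym (length-++ u)) l) ⟩
    flips (2 * q) (start e b)                                  ≡⟨ flips-2* q (start e b) ⟩
    start e b                                                  ∎

opp-pos : ∀ e u → Alt b (x ∷ r) → Alt (start e b) (u ++ y ∷ v) → Opp x y → ∃ λ i → length u ≡ pos e i
opp-pos {b = b} e u (ex , _) h o with alt-++⁻ u h
... | _ , (ey , _) = flips-pos⁻ e (length u) b (trans (sym ey) (¬-not (λ t → o (trans ex (sym t)))))

split-length : ∀ (u : List ℕ) n (s : List ℕ) → length s ≡ length u + n → ∃ λ a → ∃ λ t →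
  s ≡ a ++ t × length a ≡ length u × length t ≡ n × take (length u) s ≡ a × drop (length u) s ≡ t
split-length []      n s l = [] , s , refl , refl , l , refl , refl
split-length (_ ∷ u) n (c ∷ s) l with split-length u n s (suc-injective l)
... | a , t , refl , la , lt , h , h′ = c ∷ a , t , refl , cong suc la , lt , cong (c ∷_) h , h′

record Pieces (x y : ℕ) (u v r s : List ℕ) : Set where
  constructor pieces
  field
    {at-u at-v at-r} : List ℕ
    eq    : s ≡ at-v ++ at-u ++ at-r
    len-u : length at-u ≡ length u
    len-v : length at-v ≡ length v
    len-r : length at-r ≡ length r
    join  : joinB x y u v s ≡ (y ∷ at-r , at-u ++ x ∷ at-v)

pieces-of : ∀ x y u v r s → length s ≡ length (v ++ u ++ r) → Pieces x y u v r s
pieces-of x y u v r s l with split-length v (length (u ++ r)) s (trans l (length-++ v))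
... | a , t , refl , la , lt , h , h′ with split-length u (length r) t (trans lt (length-++ u))
...   | c , d , refl , lc , ld , g , g′ = pieces refl lc la ld
  (cong₂ _,_ (cong (y ∷_) (trans (cong (drop (length u)) h′) g′))
    (cong₂ (λ p q → p ++ x ∷ q) (trans (cong (take (length u)) h′) g) h))

∈-bridges⁻ : ∀ f k x r {u y v z} → z ∈ bridges f k x r (u , y , v) →
  ∃ λ s → s ∈ enumNC f k (v ++ u ++ r) × z ≡ joinB x y u v s
∈-bridges⁻ f k x r {u} {y} {v} z∈ = ∈-map⁻ (joinB x y u v) z∈

data InLoops (f : ℕ) (e : Bool) (j i q x : ℕ) (W u : List ℕ) (y : ℕ) (v : List ℕ) :
             List ℕ × List ℕ → Set where
  inL : ∀ {a b c} → a ∈ enumNC f j u → (b , c) ∈ enumAnn f e i q v W →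
        InLoops f e j i q x W u y v (y ∷ a ++ x ∷ b , c)
  inR : ∀ {a b c} → (a , c) ∈ enumAnn f (not e) j q u W → b ∈ enumNC f i v →
        InLoops f e j i q x W u y v (y ∷ a ++ x ∷ b , c)

∈-loops⁻ : ∀ f e j i q x W {u y v z} → z ∈ loops f e j i q x W (u , y , v) → InLoops f e j i q x W u y v z
∈-loops⁻ f e j i q x W {u} {y} {v} z∈
  with ∈-++⁻ (map (joinL x y) (cartesianProduct (enumNC f j u) (enumAnn f e i q v W))) z∈
... | inj₁ h with ∈-map⁻ (joinL x y) h
...   | (a , (b , c)) , abc∈ , refl with ∈-cartesianProduct⁻ (enumNC f j u) (enumAnn f e i q v W) abc∈
...     | a∈ , bc∈ = inL a∈ bc∈
∈-loops⁻ f e j i q x W {u} {y} {v} z∈ | inj₂ h with ∈-map⁻ (joinR x y) h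
...   | ((a , c) , b) , acb∈ , refl with ∈-cartesianProduct⁻ (enumAnn f (not e) j q u W) (enumNC f i v) acb∈
...     | ac∈ , b∈ = inR ac∈ b∈

∈-loops⁺ : ∀ f e j i q x W {u y v z} → InLoops f e j i q x W u y v z → z ∈ loops f e j i q x W (u , y , v)
∈-loops⁺ f e j i q x W {u} {y} {v} (inL a∈ bc∈) =
  ∈-++⁺ˡ (∈-map⁺ (joinL x y) (∈-cartesianProduct⁺ a∈ bc∈))
∈-loops⁺ f e j i q x W {u} {y} {v} (inR ac∈ b∈) =
  ∈-++⁺ʳ (map (joinL x y) (cartesianProduct (enumNC f j u) (enumAnn f e i q v W)))
    (∈-map⁺ (joinR x y) (∈-cartesianProduct⁺ ac∈ b∈))

data InAnn (f : ℕ) (e : Bool) (p q x : ℕ) (r W : List ℕ) (z : List ℕ × List ℕ) : Set where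
  loop : ∀ j → (c : CutAt p j r) → let open CutAt c in
         InLoops f e j (p ∸ j) q x W front partner back z → InAnn f e p q x r W z
  link : ∀ i s → (c : BridgeAt e i W) → let open BridgeAt c in
         s ∈ enumNC f (p + q) (back ++ front ++ r) → z ≡ joinB x partner front back s →
         InAnn f e p q x r W z

∈-enumAnn⁻ : ∀ f e p q x r W {z} → length r ≡ suc (2 * p) → length W ≡ 2 * q →
  z ∈ enumAnn (suc f) e (suc p) q (x ∷ r) W → InAnn f e p q x r W z
∈-enumAnn⁻ f e p q x r W {z} lr lW z∈
  with ∈-++⁻ (concatMap (λ j → loops f e j (p ∸ j) q x W (cut (2 * j) r)) (upTo (suc p))) z∈
... | inj₁ h with ∈-concatMap⁻′ _ (upTo (suc p)) h
...   | j , j∈ , h′ with cut-at p j r lr (∈-upTo⁻ j∈)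
...     | c = loop j c (∈-loops⁻ f e j (p ∸ j) q x W
                (subst (λ t → z ∈ loops f e j (p ∸ j) q x W t) (CutAt.cut-≡ c) h′))
∈-enumAnn⁻ f e p q x r W {z} lr lW z∈ | inj₂ h with ∈-concatMap⁻′ _ (upTo q) h
...   | i , i∈ , h′ with bridge-at e i q W lW (∈-upTo⁻ i∈)
...     | c with ∈-bridges⁻ f (p + q) x r {BridgeAt.front c} {BridgeAt.partner c} {BridgeAt.back c}
            (subst (λ t → z ∈ bridges f (p + q) x r t) (BridgeAt.cut-≡ c) h′)
...       | s , s∈ , eq = link i s c s∈ eq

enumAnn-length : ∀ f e p q w W → length w ≡ 2 * p → length W ≡ 2 * q → ∀ {a c} →
  (a , c) ∈ enumAnn f e p q w W → length a ≡ length w × length c ≡ length W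
enumAnn-length (suc f) e (suc p) q (x ∷ r) W l lW z∈
  with ∈-enumAnn⁻ f e p q x r W (tail-length p l) lW z∈
... | loop j (cutAt {u} {y} {v} refl lu lv _) (inL {a} a∈ bc∈) with enumAnn-length f e (p ∸ j) q v W lv lW bc∈
...   | lb , lc = cong suc (length-++-∷ a u (enumNC-length f j u lu a∈) lb) , lc
enumAnn-length (suc f) e (suc p) q (x ∷ r) W l lW z∈
    | loop j (cutAt {u} {y} {v} refl lu lv _) (inR {a} ac∈ b∈) with enumAnn-length f (not e) j q u W lu lW ac∈
...   | la , lc = cong suc (length-++-∷ a u la (enumNC-length f (p ∸ j) v lv b∈)) , lc
enumAnn-length (suc f) e (suc p) q (x ∷ r) W l lW z∈
    | link i s (bridgeAt {u} {y} {v} refl lu _) s∈ eq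
  with pieces-of x y u v r s (enumNC-length f (p + q) (v ++ u ++ r) (length-bridge p q (tail-length p l) u lW) s∈)
... | pieces {su} {sv} {sr} refl lsu lsv lsr j with trans eq j
...   | refl = cong suc lsr , length-++-∷ su u lsu lsv

Ann-sound : ∀ f e p q w W → length w ≡ 2 * p → length W ≡ 2 * q → Alt b w → Alt (start e b) W →
  (map ι w , map ι W) ∈ enumAnn f e p q w W → Ann ι w W
Ann-sound {b} {ι} (suc f) e (suc p) q (x ∷ r) W l lW al aW z∈ = go refl refl
  (∈-enumAnn⁻ f e p q x r W (tail-length p l) lW z∈)
  where
  go : ∀ {s t} → map ι (x ∷ r) ≡ s → map ι W ≡ t → InAnn f e p q x r W (s , t) → Ann ι (x ∷ r) W
  go h refl (loop j (cutAt {u} {y} {v} refl lu lv _) (inL a∈ bc∈))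
    with map-joinArc u (enumNC-length f j u lu a∈) h
  ... | ιx , ιy , refl , refl =
    let open AltArc (alt-arc {u = u} {x = x} j lu al) in
    left ιx ιy opp (NC-sound f j u lu alt-u a∈) (Ann-sound f e (p ∸ j) q v W lv lW alt-v aW bc∈)
  go h refl (loop j (cutAt {u} {y} {v} refl lu lv _) (inR ac∈ b∈))
    with map-joinArc u (proj₁ (enumAnn-length f (not e) j q u W lu lW ac∈)) h
  ... | ιx , ιy , refl , refl =
    let open AltArc (alt-arc {u = u} {x = x} j lu al) in
    right ιx ιy opp (Ann-sound f (not e) j q u W lu lW alt-u
            (subst (λ c → Alt c W) (sym (start-not e b)) aW) ac∈)
          (NC-sound f (p ∸ j) v lv alt-v b∈)
  go h h′ (link i s (bridgeAt {u} {y} {v} refl lu _) s∈ eq)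
    with pieces-of x y u v r s (enumNC-length f (p + q) (v ++ u ++ r) (length-bridge p q (tail-length p l) u lW) s∈)
  ... | pieces {su} {sv} {sr} refl lsu lsv lsr j
    with ∷-injective (trans h (cong proj₁ (trans eq j)))
       | ++-injective (map ι u) su (trans (length-map ι u) (sym lsu))
           (trans (sym (map-++ ι u (y ∷ v))) (trans h′ (cong proj₂ (trans eq j))))
  ...   | ιx , refl | refl , t with ∷-injective t
  ...     | ιy , refl with alt-bridge {x = x} {e = e} {u = u} q al aW lW (trans (cong (λ n → flips n (start e b)) lu) (flips-pos e i b))
  ...       | ab , o = bridge ιx ιy o (NC-sound f (p + q) (v ++ u ++ r)
                (length-bridge p q (tail-length p l) u lW) ab
                (subst (_∈ enumNC f (p + q) (v ++ u ++ r)) (sym eq′) s∈))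
    where
    eq′ : map ι (v ++ u ++ r) ≡ map ι v ++ map ι u ++ map ι r
    eq′ = trans (map-++ ι v (u ++ r)) (cong (map ι v ++_) (map-++ ι u r))

map-arc : ∀ {ι : ℕ → ℕ} {x y} u v → ι x ≡ y → ι y ≡ x → map ι (x ∷ u ++ y ∷ v) ≡ y ∷ map ι u ++ x ∷ map ι v
map-arc {ι} u v ιx ιy = cong₂ _∷_ ιx (trans (map-++ ι u (_ ∷ v)) (cong (λ t → map ι u ++ t ∷ map ι v) ιy))

∈-enumAnn-loop : ∀ f e p q j {x u y v W} → length (u ++ y ∷ v) ≡ suc (2 * p) → length u ≡ 2 * j →
  ∀ {z} → InLoops f e j (p ∸ j) q x W u y v z → z ∈ enumAnn (suc f) e (suc p) q (x ∷ u ++ y ∷ v) W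
∈-enumAnn-loop f e p q j {x} {u} {y} {v} {W} l lu {z} h = ∈-++⁺ˡ (∈-concatMap⁺′
  (λ j → loops f e j (p ∸ j) q x W (cut (2 * j) (u ++ y ∷ v))) (∈-upTo⁺ (s≤s j≤p))
  (subst (λ t → z ∈ loops f e j (p ∸ j) q x W t)
    (sym (trans (cong (λ i → cut i (u ++ y ∷ v)) (sym lu)) (cut-++ u)))
    (∈-loops⁺ f e j (p ∸ j) q x W h)))
  where
  j≤p : j ≤ p
  j≤p = j≤k-from p j (length v) (trans (cong (_+ suc (length v)) (sym lu)) (trans (sym (length-++ u)) l))

∈-enumAnn-link : ∀ f e p q i {x r u y v} → length (u ++ y ∷ v) ≡ 2 * q → length u ≡ pos e i →
  ∀ {s} → s ∈ enumNC f (p + q) (v ++ u ++ r) →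
  joinB x y u v s ∈ enumAnn (suc f) e (suc p) q (x ∷ r) (u ++ y ∷ v)
∈-enumAnn-link f e p q i {x} {r} {u} {y} {v} l lu {s} s∈ =
  ∈-++⁺ʳ (concatMap (λ j → loops f e j (p ∸ j) q x (u ++ y ∷ v) (cut (2 * j) r)) (upTo (suc p)))
    (∈-concatMap⁺′ (λ i → bridges f (p + q) x r (cut (pos e i) (u ++ y ∷ v))) (∈-upTo⁺ i<q)
      (subst (λ t → joinB x y u v s ∈ bridges f (p + q) x r t)
        (sym (trans (cong (λ i → cut i (u ++ y ∷ v)) (sym lu)) (cut-++ u)))
        (∈-map⁺ (joinB x y u v) s∈)))
  where
  i<q : i < q
  i<q = pos-<⁻ e (begin-strict
    pos e i                     ≡⟨ lu ⟨
    length u                    <⟨ m<m+n (length u) (s≤s z≤n) ⟩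
    length u + suc (length v)   ≡⟨ length-++ u ⟨
    length (u ++ y ∷ v)         ≡⟨ l ⟩
    2 * q                       ∎)
    where open ≤-Reasoning

joinB-map : ∀ ι {x y} u v r → ι x ≡ y → ι y ≡ x →
  joinB x y u v (map ι (v ++ u ++ r)) ≡ (map ι (x ∷ r) , map ι (u ++ y ∷ v))
joinB-map ι {x} {y} u v r ιx ιy with pieces-of x y u v r (map ι (v ++ u ++ r)) (length-map ι (v ++ u ++ r))
... | pieces {su} {sv} {sr} eq lu lv lr j
  with ++-injective (map ι v) sv (trans (length-map ι v) (sym lv)) (trans (sym (map-++ ι v (u ++ r))) eq)
...   | refl , t with ++-injective (map ι u) su (trans (length-map ι u) (sym lu)) (trans (sym (map-++ ι u r)) t)
...     | refl , refl = trans j (cong₂ _,_ (cong (_∷ map ι r) (sym ιx))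
            (trans (cong (λ t → map ι u ++ t ∷ map ι v) (sym ιy)) (sym (map-++ ι u (y ∷ v)))))

Ann-complete : ∀ f e p q w W → p + q ≤ f → length w ≡ 2 * p → length W ≡ 2 * q → Alt b w →
  Alt (start e b) W → Ann ι w W → (map ι w , map ι W) ∈ enumAnn f e p q w W
Ann-complete f e zero q (_ ∷ _) W _ () lW al aW n
Ann-complete {b} {ι} (suc f) e (suc p) q (x ∷ _) W (s≤s p+q≤f) l lW al aW (left {y = y} {u} {v} ιx ιy o n a)
  with opp-even {x = x} u al o
... | j , lu = subst (λ t → (t , map ι W) ∈ enumAnn (suc f) e (suc p) q (x ∷ u ++ y ∷ v) W) (sym (map-arc u v ιx ιy))
    (∈-enumAnn-loop f e p q j (tail-length p l) lu
      (inL (NC-complete f j u (≤-trans j≤p (≤-trans (m≤m+n p q) p+q≤f)) lu alt-u n)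
           (Ann-complete f e (p ∸ j) q v W (≤-trans (+-monoˡ-≤ q (m∸n≤m p j)) p+q≤f)
              (len-rest p j (length v) j≤p l″) lW alt-v aW a)))
  where
  open AltArc (alt-arc {u = u} {x = x} j lu al)
  l″ : 2 * j + suc (length v) ≡ suc (2 * p)
  l″ = trans (cong (_+ suc (length v)) (sym lu)) (trans (sym (length-++ u)) (tail-length p l))
  j≤p : j ≤ p
  j≤p = j≤k-from p j (length v) l″
Ann-complete {b} {ι} (suc f) e (suc p) q (x ∷ _) W (s≤s p+q≤f) l lW al aW (right {y = y} {u} {_} {v} ιx ιy o a n)
  with opp-even {x = x} u al o
... | j , lu = subst (λ t → (t , map ι W) ∈ enumAnn (suc f) e (suc p) q (x ∷ u ++ y ∷ v) W) (sym (map-arc u v ιx ιy))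
    (∈-enumAnn-loop f e p q j (tail-length p l) lu
      (inR (Ann-complete f (not e) j q u W (≤-trans (+-monoˡ-≤ q j≤p) p+q≤f) lu lW alt-u
              (subst (λ c → Alt c W) (sym (start-not e b)) aW) a)
           (NC-complete f (p ∸ j) v (≤-trans (m∸n≤m p j) (≤-trans (m≤m+n p q) p+q≤f))
              (len-rest p j (length v) j≤p l″) alt-v n)))
  where
  open AltArc (alt-arc {u = u} {x = x} j lu al)
  l″ : 2 * j + suc (length v) ≡ suc (2 * p)
  l″ = trans (cong (_+ suc (length v)) (sym lu)) (trans (sym (length-++ u)) (tail-length p l))
  j≤p : j ≤ p
  j≤p = j≤k-from p j (length v) l″
Ann-complete {b} {ι} (suc f) e (suc p) q (x ∷ r) _ (s≤s p+q≤f) l lW al aW (bridge {y = y} {v} {u} ιx ιy o n)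
  with opp-pos {x = x} {y = y} e u al aW o
... | i , lu with alt-bridge {x = x} {e = e} {u = u} q al aW lW (trans (cong (λ n → flips n (start e b)) lu) (flips-pos e i b))
...   | ab , _ = subst (_∈ enumAnn (suc f) e (suc p) q (x ∷ r) (u ++ y ∷ v)) (joinB-map ι u v r ιx ιy)
    (∈-enumAnn-link f e p q i lW lu
      (NC-complete f (p + q) (v ++ u ++ r) p+q≤f (length-bridge p q (tail-length p l) u lW) ab n))

-- Turns a bare list of values into a map, so that the soundness lemmas can be applied to entries
-- that do not come from a given `ι`.
assign : List ℕ → List ℕ → ℕ → ℕ
assign (x ∷ w) (a ∷ s) z = if z ≡ᵇ x then a else assign w s z
assign _       _       z = 0

map-assign : ∀ w s → Unique w → length s ≡ length w → map (assign w s) w ≡ s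
map-assign []      []      un l = refl
map-assign (x ∷ w) (a ∷ s) (x∉ ∷ un) l = cong₂ _∷_ eq
  (trans (map-cong-local (All.map neq x∉)) (map-assign w s un (suc-injective l)))
  where
  eq : assign (x ∷ w) (a ∷ s) x ≡ a
  eq rewrite true-≡ᵇ {x} refl = refl
  neq : ∀ {z} → x ≢ z → assign (x ∷ w) (a ∷ s) z ≡ assign w s z
  neq {z} x≢z with z ≡ᵇ x in h
  ... | true  = ⊥-elim (x≢z (sym (≡ᵇ-true {z} {x} h)))
  ... | false = refl

NC-Ann-disjoint : Unique (u ++ W) → NC ι u → Ann ι u W → ⊥
NC-Ann-disjoint {u} un n a with ann-cross a
... | z , z∈ , h = Unique-disjoint u un (proj₁ (nc-closed n z∈)) h

-- Read as a map on `u ++ W`, the values would keep `u` closed by the first membership and send some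
-- letter of `u` into `W` by the second. This separates the two kinds of `loops` that share a
-- partner.
enum-disjoint : ∀ f e p q u W → length u ≡ 2 * p → length W ≡ 2 * q → Unique (u ++ W) → Alt b u →
  Alt (start e b) W → ∀ {a c} → a ∈ enumNC f p u → (a , c) ∈ enumAnn f e p q u W → ⊥
enum-disjoint f e p q u W lu lW un au aW {a} {c} a∈ ac∈ with enumAnn-length f e p q u W lu lW ac∈
... | la , lc with ++-injective (map ι′ u) a (trans (length-map ι′ u) (sym la))
       (trans (sym (map-++ ι′ u W)) (map-assign (u ++ W) (a ++ c) un
         (trans (length-++ a) (trans (cong₂ _+_ la lc) (sym (length-++ u))))))
  where
  ι′ : ℕ → ℕ
  ι′ = assign (u ++ W) (a ++ c)
...   | ea , ec = NC-Ann-disjoint un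
        (NC-sound f p u lu au (subst (_∈ enumNC f p u) (sym ea) a∈))
        (Ann-sound f e p q u W lu lW au aW (subst (_∈ enumAnn f e p q u W) (sym (cong₂ _,_ ea ec)) ac∈))

bridgeAt-injective : ∀ {e i j W} → Unique W → (c : BridgeAt e i W) (c′ : BridgeAt e j W) →
  BridgeAt.partner c ≡ BridgeAt.partner c′ → i ≡ j
bridgeAt-injective {e} un (bridgeAt {u} refl lu _) (bridgeAt {u′} h lu′ _) refl =
  pos-injective e (trans (sym lu) (trans (split-unique u u′ un h) lu′))

unique-bridges : ∀ f p q x r u y v → length r ≡ suc (2 * p) → length (u ++ y ∷ v) ≡ 2 * q →
  Unique (v ++ u ++ r) → Unique (bridges f (p + q) x r (u , y , v))
unique-bridges f p q x r u y v lr lW un =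
  Unique-map-on (joinB x y u v) inj (unique-enumNC f (p + q) (v ++ u ++ r) l un)
  where
  l : length (v ++ u ++ r) ≡ 2 * (p + q)
  l = length-bridge p q lr u lW
  inj : ∀ {s t} → s ∈ enumNC f (p + q) (v ++ u ++ r) → t ∈ enumNC f (p + q) (v ++ u ++ r) →
        joinB x y u v s ≡ joinB x y u v t → s ≡ t
  inj {s} {t} s∈ t∈ h
    with pieces-of x y u v r s (enumNC-length f (p + q) (v ++ u ++ r) l s∈)
       | pieces-of x y u v r t (enumNC-length f (p + q) (v ++ u ++ r) l t∈)
  ... | pieces {su} {sv} {sr} refl lsu lsv lsr j | pieces {tu} {tv} {tr} refl ltu ltv ltr j′
    with trans (sym j) (trans h j′)
  ...   | eq with cong proj₁ eq | ++-injective su tu (trans lsu (sym ltu)) (cong proj₂ eq)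
  ...     | refl | refl , refl = refl

joinL-injective : ∀ {s t : List ℕ × (List ℕ × List ℕ)} → length (proj₁ s) ≡ length (proj₁ t) →
  joinL x y s ≡ joinL x y t → s ≡ t
joinL-injective l h with joinArc-injective l (cong proj₁ h) | cong proj₂ h
... | refl | refl = refl

joinR-injective : ∀ {s t : (List ℕ × List ℕ) × List ℕ} → length (proj₁ (proj₁ s)) ≡ length (proj₁ (proj₁ t)) →
  joinR x y s ≡ joinR x y t → s ≡ t
joinR-injective l h with joinArc-injective l (cong proj₁ h) | cong proj₂ h
... | refl | refl = refl

-- The first value is again the partner of the first letter. It fixes the cut, and it lies in `r`
-- for a loop but in `W` for a bridge.
unique-enumAnn : ∀ f e p q w W → length w ≡ 2 * p → length W ≡ 2 * q → Unique (w ++ W) → Alt b w →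
  Alt (start e b) W → Unique (enumAnn f e p q w W)
unique-loops : ∀ f e j i q x W {u y v} → length u ≡ 2 * j → length v ≡ 2 * i → length W ≡ 2 * q →
  Unique (u ++ W) → Unique (v ++ W) → Alt (not b) u → Alt b v → Alt (start e b) W →
  Unique (loops f e j i q x W (u , y , v))

unique-loops {b} f e j i q x W {u} {y} {v} lu lv lW unu unv au av aW = Unique-++⁺
  (Unique-map-on (joinL x y) (λ s t → joinL-injective (trans (lenL s) (sym (lenL t))))
    (Uniq.cartesianProduct⁺ (unique-enumNC f j u lu (Unique-++ˡ u unu))
                            (unique-enumAnn f e i q v W lv lW unv av aW)))
  (Unique-map-on (joinR x y) (λ s t → joinR-injective (trans (lenR s) (sym (lenR t))))
    (Uniq.cartesianProduct⁺ (unique-enumAnn f (not e) j q u W lu lW unu au aW′)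
                            (unique-enumNC f i v lv (Unique-++ˡ v unv))))
  disjoint
  where
  lefts : List (List ℕ × (List ℕ × List ℕ))
  lefts = cartesianProduct (enumNC f j u) (enumAnn f e i q v W)
  rights : List ((List ℕ × List ℕ) × List ℕ)
  rights = cartesianProduct (enumAnn f (not e) j q u W) (enumNC f i v)
  aW′ : Alt (start (not e) (not b)) W
  aW′ = subst (λ c → Alt c W) (sym (start-not e b)) aW
  lenL : ∀ {s} → s ∈ lefts → length (proj₁ s) ≡ length u
  lenL s∈ = enumNC-length f j u lu (proj₁ (∈-cartesianProduct⁻ (enumNC f j u) (enumAnn f e i q v W) s∈))
  lenR : ∀ {s} → s ∈ rights → length (proj₁ (proj₁ s)) ≡ length u
  lenR s∈ = proj₁ (enumAnn-length f (not e) j q u W lu lW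
    (proj₁ (∈-cartesianProduct⁻ (enumAnn f (not e) j q u W) (enumNC f i v) s∈)))
  disjoint : ∀ {z} → z ∈ map (joinL x y) lefts → z ∈ map (joinR x y) rights → ⊥
  disjoint z∈ z∈′ with ∈-map⁻ (joinL x y) z∈ | ∈-map⁻ (joinR x y) z∈′
  ... | (a , (b , c)) , s∈ , refl | ((a′ , c′) , b′) , t∈ , h
    with ++-injective a a′ (trans (lenL s∈) (sym (lenR t∈))) (proj₂ (∷-injective (cong proj₁ h))) | cong proj₂ h
  ...   | refl , _ | refl = enum-disjoint f (not e) j q u W lu lW unu au aW′
          (proj₁ (∈-cartesianProduct⁻ (enumNC f j u) (enumAnn f e i q v W) s∈))
          (proj₁ (∈-cartesianProduct⁻ (enumAnn f (not e) j q u W) (enumNC f i v) t∈))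

unique-enumAnn f e zero q w W l lW un al aW = []
unique-enumAnn zero e (suc p) q w W l lW un al aW = []
unique-enumAnn {b} (suc f) e (suc p) q (x ∷ r) W l lW (x∉ ∷ un) al aW = Unique-++⁺
  (Unique-concatMap _ (upTo⁺ (suc p)) (λ j∈ → each-loop (at j∈))
    λ i∈ j∈ s t → cutAt-injective (Unique-++ˡ r un) (at i∈) (at j∈)
      (trans (sym (head-loop (at i∈) s)) (head-loop (at j∈) t)))
  (Unique-concatMap _ (upTo⁺ q) (λ i∈ → each-bridge (bt i∈))
    λ i∈ j∈ s t → bridgeAt-injective (Unique-++ʳ r un) (bt i∈) (bt j∈)
      (trans (sym (head-bridge (bt i∈) s)) (head-bridge (bt j∈) t)))
  λ s t → let (i , i∈ , s′) = ∈-concatMap⁻′ loop′ (upTo (suc p)) s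
              (j , j∈ , t′) = ∈-concatMap⁻′ bridge′ (upTo q) t
          in apart (at i∈) (bt j∈) s′ t′
  where
  lr : length r ≡ suc (2 * p)
  lr = tail-length p l
  loop′ bridge′ : ℕ → List (List ℕ × List ℕ)
  loop′ j = loops f e j (p ∸ j) q x W (cut (2 * j) r)
  bridge′ i = bridges f (p + q) x r (cut (pos e i) W)
  head : List ℕ × List ℕ → ℕ
  head s = nth (proj₁ s) 0
  at : ∀ {j} → j ∈ upTo (suc p) → CutAt p j r
  at j∈ = cut-at p _ r lr (∈-upTo⁻ j∈)
  bt : ∀ {i} → i ∈ upTo q → BridgeAt e i W
  bt i∈ = bridge-at e _ q W lW (∈-upTo⁻ i∈)
  each-loop : ∀ {j} → CutAt p j r → Unique (loop′ j)
  each-loop {j} (cutAt {u} {y} {v} refl lu lv h) rewrite h =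
    unique-loops f e j (p ∸ j) q x W lu lv lW
      (Unique-resp-↭ (++-comm W u) (Unique-++ˡ (W ++ u) (subst Unique (sym (++-assoc W u (y ∷ v)))
        (Unique-resp-↭ (++-comm (u ++ y ∷ v) W) un))))
      (Unique-++ʳ (y ∷ []) (Unique-++ʳ u (subst Unique (++-assoc u (y ∷ v) W) un)))
      alt-u alt-v aW
    where open AltArc (alt-arc {u = u} {x = x} j lu al)
  each-bridge : ∀ {i} → BridgeAt e i W → Unique (bridge′ i)
  each-bridge {i} (bridgeAt {u} {y} {v} refl lu h) rewrite h =
    unique-bridges f p q x r u y v lr lW (Unique-++ʳ (y ∷ []) (Unique-resp-↭ perm′ un))
    where
    perm′ : r ++ u ++ y ∷ v ↭ y ∷ v ++ u ++ r
    perm′ = ↭-trans (++-comm r (u ++ y ∷ v)) (↭-trans (++⁺ʳ r (++-comm u (y ∷ v)))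
              (↭-reflexive (++-assoc (y ∷ v) u r)))
  head-loop : ∀ {j} (c : CutAt p j r) {s} → s ∈ loop′ j → head s ≡ CutAt.partner c
  head-loop {j} (cutAt refl lu lv h) s∈ rewrite h with ∈-loops⁻ f e j (p ∸ j) q x W s∈
  ... | inL _ _ = refl
  ... | inR _ _ = refl
  head-bridge : ∀ {i} (c : BridgeAt e i W) {s} → s ∈ bridge′ i → head s ≡ BridgeAt.partner c
  head-bridge {i} (bridgeAt {u} {y} {v} refl lu h) s∈ rewrite h
    with ∈-bridges⁻ f (p + q) x r {u} {y} {v} s∈
  ... | _ , _ , refl = refl
  apart : ∀ {i j s} → CutAt p i r → BridgeAt e j W → s ∈ loop′ i → s ∈ bridge′ j → ⊥
  apart c d s∈ t∈ = Unique-disjoint r un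
    (subst (CutAt.partner c ∈_) (sym (CutAt.eq c)) (∈-++⁺ʳ (CutAt.front c) (here refl)))
    (subst (_∈ W) (trans (sym (head-bridge d t∈)) (head-loop c s∈))
      (subst (BridgeAt.partner d ∈_) (sym (BridgeAt.eq d)) (∈-++⁺ʳ (BridgeAt.front d) (here refl))))

-- The points and the permutation τ

∈-allTuples⁻ : ∀ k (xs : List X) {t} → t ∈ allTuples k xs → length t ≡ k
∈-allTuples⁻ zero    xs (here refl) = refl
∈-allTuples⁻ (suc k) xs t∈ with ∈-concatMap⁻′ (λ x → map (x ∷_) (allTuples k xs)) xs t∈
... | x , _ , h with ∈-map⁻ (x ∷_) h
...   | t , t∈′ , refl = cong suc (∈-allTuples⁻ k xs t∈′)

∈-allTuples⁺ : ∀ {xs : List X} {t} → (∀ {z} → z ∈ t → z ∈ xs) → t ∈ allTuples (length t) xs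
∈-allTuples⁺ {t = []}    h = here refl
∈-allTuples⁺ {xs = xs} {t = x ∷ t} h =
  ∈-concatMap⁺′ (λ x → map (x ∷_) (allTuples (length t) xs)) (h (here refl)) (∈-map⁺ (x ∷_) (∈-allTuples⁺ (h ∘ there)))

unique-allTuples : ∀ k {xs : List X} → Unique xs → Unique (allTuples k xs)
unique-allTuples zero    un = [] ∷ []
unique-allTuples (suc k) {xs} un = Unique-concatMap (λ x → map (x ∷_) (allTuples k xs)) un
  (λ {x} _ → Uniq.map⁺ (proj₂ ∘ ∷-injective) (unique-allTuples k un)) cross
  where
  cross : ∀ {x y t} → x ∈ xs → y ∈ xs → t ∈ map (x ∷_) (allTuples k xs) → t ∈ map (y ∷_) (allTuples k xs) → x ≡ y
  cross {x} {y} _ _ p q with ∈-map⁻ (x ∷_) p | ∈-map⁻ (y ∷_) q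
  ... | _ , _ , refl | _ , _ , h = proj₁ (∷-injective h)

unique-allMaps : ∀ n → Unique (allMaps n)
unique-allMaps n = Uniq.map⁺ (map-injective toℕ-injective) (unique-allTuples n (allFin⁺ n))

∈-allMaps⁻ : ∀ n {s} → s ∈ allMaps n → length s ≡ n × (∀ {z} → z ∈ s → z < n)
∈-allMaps⁻ n s∈ with ∈-map⁻ (map toℕ) s∈
... | t , t∈ , refl = trans (length-map toℕ t) (∈-allTuples⁻ n (allFin n) t∈) ,
  λ z∈ → let (i , _ , eq) = ∈-map⁻ toℕ z∈ in subst (_< n) (sym eq) (toℕ<n i)

fromBounded : ∀ n s → (∀ {z} → z ∈ s → z < n) → ∃ λ t → s ≡ map (toℕ {n}) t
fromBounded n []      h = [] , refl
fromBounded n (x ∷ s) h with fromBounded n s (h ∘ there)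
... | t , eq = fromℕ< (h (here refl)) ∷ t , cong₂ _∷_ (sym (toℕ-fromℕ< (h (here refl)))) eq

∈-allMaps⁺ : ∀ n {s} → length s ≡ n → (∀ {z} → z ∈ s → z < n) → s ∈ allMaps n
∈-allMaps⁺ n {s} l h with fromBounded n s h
... | t , refl = ∈-map⁺ (map toℕ)
  (subst (λ k → t ∈ allTuples k (allFin n)) (trans (sym (length-map toℕ t)) l) (∈-allTuples⁺ (λ {i} _ → ∈-allFin i)))

range : ℕ → ℕ → List ℕ
range s zero    = []
range s (suc m) = s ∷ range (suc s) m

length-range : ∀ s m → length (range s m) ≡ m
length-range s zero    = refl
length-range s (suc m) = cong suc (length-range (suc s) m)

range-++ : ∀ s m n → range s m ++ range (s + m) n ≡ range s (m + n)
range-++ s zero    n = cong (λ t → range t n) (+-identityʳ s)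
range-++ s (suc m) n = cong (s ∷_) (trans (cong (λ t → range (suc s) m ++ range t n) (+-suc s m)) (range-++ (suc s) m n))

applyUpTo-range : ∀ s n (f : ℕ → ℕ) → (∀ i → f i ≡ s + i) → applyUpTo f n ≡ range s n
applyUpTo-range s zero    f h = refl
applyUpTo-range s (suc n) f h = cong₂ _∷_ (trans (h 0) (+-identityʳ s))
  (applyUpTo-range (suc s) n (f ∘ suc) (λ i → trans (h (suc i)) (+-suc s i)))

upTo-range : ∀ n → upTo n ≡ range 0 n
upTo-range n = applyUpTo-range 0 n id (λ _ → refl)

∈-range⁺ : ∀ s m {x} → s ≤ x → x < s + m → x ∈ range s m
∈-range⁺ s zero    s≤x x< = ⊥-elim (<⇒≱ x< (≤-trans (≤-reflexive (+-identityʳ s)) s≤x))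
∈-range⁺ s (suc m) {x} s≤x x< with s ≟ x
... | yes refl = here refl
... | no s≢x = there (∈-range⁺ (suc s) m (≤∧≢⇒< s≤x s≢x) (≤-trans x< (≤-reflexive (+-suc s m))))

map-nth : ∀ s → map (nth s) (upTo (length s)) ≡ s
map-nth s = trans (cong (map (nth s)) (upTo-range (length s))) (go [] s)
  where
  nth-++ : ∀ (p : List ℕ) {x s} → nth (p ++ x ∷ s) (length p) ≡ x
  nth-++ []      = refl
  nth-++ (_ ∷ p) = nth-++ p
  go : ∀ p s → map (nth (p ++ s)) (range (length p) (length s)) ≡ s
  go p []      = refl
  go p (x ∷ s) = cong₂ _∷_ (nth-++ p) (trans
    (cong₂ (λ t i → map (nth t) (range i (length s))) (sym (++-assoc p (x ∷ []) s))
      (trans (+-comm 1 (length p)) (sym (length-++ p)))) (go (p ++ x ∷ []) s))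

isEven-suc : ∀ n → isEven (suc n) ≡ not (isEven n)
isEven-suc zero          = refl
isEven-suc (suc zero)    = refl
isEven-suc (suc (suc n)) = isEven-suc n

isEven-2*+ : ∀ j n → isEven (2 * j + n) ≡ isEven n
isEven-2*+ zero    n = refl
isEven-2*+ (suc j) n = trans (cong (λ t → isEven (t + n)) (2*suc j)) (isEven-2*+ j n)

isEven-2* : ∀ j → isEven (2 * j) ≡ true
isEven-2* j = trans (cong isEven (sym (+-identityʳ (2 * j)))) (isEven-2*+ j 0)

alt-range : ∀ s m → isEven s ≡ b → Alt b (range s m)
alt-range s zero    h = tt
alt-range s (suc m) h = h , alt-range (suc s) m (trans (isEven-suc s) (cong not h))

blocks : ℕ → List ℕ → List (List ℕ)
blocks s []       = []
blocks s (m ∷ ms) = range s m ∷ blocks (s + m) ms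

-- The permutation `tau` with a variable starting point, as required for induction on the blocks.
tauFrom : ℕ → List ℕ → ℕ → ℕ
tauFrom s ms x = let (t , m) = block s ms x in if suc x <ᵇ t + m then suc x else t

tau-tauFrom : ∀ ms x → tau ms x ≡ tauFrom 0 ms x
tau-tauFrom ms x with block 0 ms x
... | s , m = refl

path-range : ∀ s m → (∀ i → s ≤ i → i < s + m → σ i ≡ suc i) → σ (s + m) ≡ z → Path σ s (range (suc s) m) z
path-range {σ} s zero    h e = trans (cong σ (sym (+-identityʳ s))) e
path-range {σ} s (suc m) h e = h s ≤-refl (m<m+n s (s≤s z≤n)) ,
  path-range (suc s) m (λ i p q → h i (<⇒≤ p) (≤-trans q (≤-reflexive (sym (+-suc s m)))))
    (trans (cong σ (sym (+-suc s m))) e)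

-- Agreement is asked only from `s` on: `block` puts smaller points into the first block, so
-- `tauFrom` of the remaining blocks is correct only beyond the earlier ones.
cyc-blocks : ∀ s ms → All (0 <_) ms → (∀ x → s ≤ x → σ x ≡ tauFrom s ms x) → All (Cyc σ) (blocks s ms)
cyc-blocks s [] _ h = []
cyc-blocks {σ} s (suc m ∷ ms) (_ ∷ pos) h =
  path-range s m (λ i p q → trans (σ≡ i p (≤-trans q (+-monoʳ-≤ s (n≤1+n m)))) (inside i (≤-trans (s≤s q) (≤-reflexive (sym (+-suc s m))))))
    (trans (σ≡ (s + m) (m≤m+n s m) (≤-reflexive (sym (+-suc s m)))) last) ∷
  cyc-blocks (s + suc m) ms pos rest
  where
  σ≡ : ∀ x → s ≤ x → x < s + suc m → σ x ≡ (if suc x <ᵇ s + suc m then suc x else s)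
  σ≡ x s≤x x< = trans (h x s≤x) eq
    where
    eq : tauFrom s (suc m ∷ ms) x ≡ (if suc x <ᵇ s + suc m then suc x else s)
    eq rewrite true-<ᵇ x< = refl
  inside : ∀ i → suc i < s + suc m → (if suc i <ᵇ s + suc m then suc i else s) ≡ suc i
  inside i q rewrite true-<ᵇ q = refl
  last : (if suc (s + m) <ᵇ s + suc m then suc (s + m) else s) ≡ s
  last rewrite false-<ᵇ {suc (s + m)} {s + suc m} (≤-reflexive (+-suc s m)) = refl
  rest : ∀ x → s + suc m ≤ x → σ x ≡ tauFrom (s + suc m) ms x
  rest x le = trans (h x (≤-trans (m≤m+n s (suc m)) le)) eq
    where
    eq : tauFrom s (suc m ∷ ms) x ≡ tauFrom (s + suc m) ms x
    eq rewrite false-<ᵇ {x} {s + suc m} le = refl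

cyc-tau : ∀ ms → All (0 <_) ms → All (Cyc (tau ms)) (blocks 0 ms)
cyc-tau ms pos = cyc-blocks 0 ms pos (λ x _ → tau-tauFrom ms x)

EvenList : List ℕ → Set
EvenList = All (λ m → ∃ λ j → m ≡ 2 * j)

block-start : ∀ i ms x → EvenList ms → 2 * i ≤ x → ∃ λ j → proj₁ (block (2 * i) ms x) ≡ 2 * j × 2 * j ≤ x
block-start i [] x _ h = i , refl , h
block-start i (m ∷ ms) x ((j , refl) ∷ ev) h with x <ᵇ 2 * i + 2 * j in eq
... | true  = i , refl , h
... | false with block-start (i + j) ms x ev (≤-trans (≤-reflexive (*-distribˡ-+ 2 i j)) (≮⇒≥ λ lt → f≢t (trans (sym eq) (true-<ᵇ lt))))
  where
  f≢t : false ≢ true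
  f≢t ()
...   | l , p , q = l , trans (cong (λ t → proj₁ (block t ms x)) (sym (*-distribˡ-+ 2 i j))) p , q

-- All blocks start at even points, so the colour, defined by the offset within the block, is the
-- parity of the point itself.
isEven-offset : ∀ ms x → EvenList ms → isEven (offset ms x) ≡ isEven x
isEven-offset ms x ev with block-start 0 ms x ev z≤n
... | j , p , q = begin
  isEven (x ∸ proj₁ (block 0 ms x))   ≡⟨ cong (λ t → isEven (x ∸ t)) p ⟩
  isEven (x ∸ 2 * j)                  ≡⟨ isEven-2*+ j (x ∸ 2 * j) ⟨
  isEven (2 * j + (x ∸ 2 * j))        ≡⟨ cong isEven (m+[n∸m]≡n q) ⟩
  isEven x                            ∎
  where open ≡-Reasoning

-- White points are sent to black ones; as there are at least as many whites as blacks, no black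
-- point is left over to be paired with another black point.
black-to-white : ∀ n (ι : ℕ → ℕ) → (∀ {z} → z < n → ι z < n × ι (ι z) ≡ z) →
  (∀ {z} → z < n → isEven z ≡ true → isEven (ι z) ≡ false) →
  ∀ {z} → z < n → isEven z ≡ false → isEven (ι z) ≡ true
black-to-white n ι inv-ι h {z} z< zb with isEven (ι z) in eq
... | true  = refl
... | false = ⊥-elim (<⇒≱ more fewer)
  where
  whites blacks : List ℕ
  whites = filterᵇ isEven (upTo n)
  blacks = filterᵇ (not ∘ isEven) (upTo n)
  white⁻ : ∀ {x} → x ∈ whites → x < n × isEven x ≡ true
  white⁻ x∈ with ∈-filterᵇ⁻ isEven (upTo n) x∈
  ... | x∈′ , e = ∈-upTo⁻ x∈′ , e
  black⁻ : ∀ {x} → x ∈ blacks → x < n × isEven x ≡ false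
  black⁻ x∈ with ∈-filterᵇ⁻ (not ∘ isEven) (upTo n) x∈
  ... | x∈′ , e = ∈-upTo⁻ x∈′ , not-true e
  black⁺ : ∀ {x} → x < n → isEven x ≡ false → x ∈ blacks
  black⁺ x< e = ∈-filterᵇ⁺ (not ∘ isEven) (upTo n) (∈-upTo⁺ x<) (cong not e)
  pred-white : ∀ {x} → x < n → isEven x ≡ false → pred x ∈ whites
  pred-white {suc x} x< e = ∈-filterᵇ⁺ isEven (upTo n) (∈-upTo⁺ (<-trans (n<1+n x) x<))
    (trans (sym (not-involutive (isEven x))) (cong not (trans (sym (isEven-suc x)) e)))
  black-suc : ∀ {x} → isEven x ≡ false → suc (pred x) ≡ x
  black-suc {suc x} _ = refl
  fewer : length blacks ≤ length whites
  fewer = subst (_≤ length whites) (length-map pred blacks) (unique-⊆-length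
    (Unique-map-on pred (λ x∈ y∈ e → trans (sym (black-suc (proj₂ (black⁻ x∈))))
       (trans (cong suc e) (black-suc (proj₂ (black⁻ y∈))))) (Unique-filterᵇ (not ∘ isEven) (upTo⁺ n)))
    (λ {x} x∈ → let (y , y∈ , e) = ∈-map⁻ pred x∈ ; (y< , yb) = black⁻ y∈ in
       subst (_∈ whites) (sym e) (pred-white y< yb)))
  unique-images : Unique (z ∷ map ι whites)
  unique-images = ≢-All z∉ ∷ Unique-map-on ι
    (λ x∈ y∈ e → trans (sym (proj₂ (inv-ι (proj₁ (white⁻ x∈))))) (trans (cong ι e) (proj₂ (inv-ι (proj₁ (white⁻ y∈))))))
    (Unique-filterᵇ isEven (upTo⁺ n))
    where
    z∉ : ∀ {y} → y ∈ map ι whites → z ≢ y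
    z∉ y∈ refl with ∈-map⁻ ι y∈
    ... | x , x∈ , refl with white⁻ x∈
    ...   | x< , xw with trans (sym xw) (trans (cong isEven (sym (proj₂ (inv-ι x<)))) eq)
    ...     | ()
  more : length whites < length blacks
  more = subst (_≤ length blacks) (cong suc (length-map ι whites)) (unique-⊆-length unique-images λ
    { (here refl) → black⁺ z< zb
    ; (there y∈) → let (x , x∈ , e) = ∈-map⁻ ι y∈ ; (x< , xw) = white⁻ x∈ in
        subst (_∈ blacks) (sym e) (black⁺ (proj₁ (inv-ι x<)) (h x< xw)) })

-- Good data

nth-∈ : ∀ s {i} → i < length s → nth s i ∈ s
nth-∈ (x ∷ s) {zero}  _       = here refl
nth-∈ (x ∷ s) {suc i} (s≤s l) = there (nth-∈ s l)

∧-true : ∀ {a b} → a ≡ true → b ≡ true → a ∧ b ≡ true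
∧-true refl refl = refl

not-≡ᵇ : ∀ {x y} → x ≢ y → not (x ≡ᵇ y) ≡ true
not-≡ᵇ {x} {y} h with x ≡ᵇ y in eq
... | true  = ⊥-elim (h (≡ᵇ-true {x} {y} eq))
... | false = refl

all-even : ∀ ms → EvenList ms → all isEven ms ≡ true
all-even []       _               = refl
all-even (m ∷ ms) ((j , refl) ∷ ev) = ∧-true (isEven-2* j) (all-even ms ev)

opp-∨ : ∀ {a b} → a ≢ b → not a ∨ not b ≡ true
opp-∨ {true}  {true}  h = ⊥-elim (h refl)
opp-∨ {true}  {false} h = refl
opp-∨ {false}         h = refl

∨-opp : ∀ {a b} → not a ∨ not b ≡ true → a ≡ true → b ≡ false
∨-opp {true} {false} _ _ = refl

∨-split : ∀ {a b} → a ∨ b ≡ true → a ≡ true ⊎ b ≡ true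
∨-split {true}  h = inj₁ h
∨-split {false} h = inj₂ h

module _ (N K : ℕ) (ms : List ℕ) (ev : EvenList ms) where

  private
    n : ℕ
    n = 2 * N

  -- `Closed` on all points gathers involutivity, absence of fixed points and both directions of the
  -- colour condition; the definition tests only that white goes to black.
  goodDatum⁻ : ∀ s → s ∈ allMaps n → goodDatum 0 N K ms s ≡ true →
    Closed (nth s) (upTo n) × isTransitive n (nth s) (tau ms) ≡ true ×
    numCycles n (tau ms ∘ nth s) + K ≡ N + 2
  goodDatum⁻ s s∈ g = closed , proj₁ (∧-split g₁) ,
    trans (sym (+-identityʳ _)) (≡ᵇ-true {numCycles n (tau ms ∘ nth s) + K + 0} (proj₂ (∧-split {isBicolored n ms (nth s)} g₂)))
    where
    ι′ = nth s
    g₁ = proj₂ (∧-split {isFPFInvolution n ι′} g)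
    g₂ = proj₂ (∧-split {isTransitive n ι′ (tau ms)} g₁)
    g₃ = proj₂ (∧-split {all isEven ms} (proj₁ (∧-split g₂)))
    inv-ι : ∀ {z} → z < n → ι′ z < n × ι′ (ι′ z) ≡ z
    inv-ι {z} z< with ∈-allMaps⁻ n s∈
    ... | l , h = h (nth-∈ s (subst (z <_) (sym l) z<)) ,
      ≡ᵇ-true (proj₁ (∧-split (all⁻ _ (upTo n) (proj₁ (∧-split g)) (∈-upTo⁺ z<))))
    white : ∀ {z} → z < n → isEven z ≡ true → isEven (ι′ z) ≡ false
    white {z} z< zw = trans (sym (isEven-offset ms (ι′ z) ev))
      (∨-opp (all⁻ _ (upTo n) g₃ (∈-upTo⁺ z<)) (trans (isEven-offset ms z ev) zw))
    opp : ∀ {z} → z < n → Opp z (ι′ z)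
    opp {z} z< e with isEven z in eq
    ... | true  = true≢false (trans e (white z< eq))
      where
      true≢false : true ≢ false
      true≢false ()
    ... | false = false≢true (trans e (black-to-white n ι′ inv-ι white z< eq))
      where
      false≢true : false ≢ true
      false≢true ()
    closed : Closed ι′ (upTo n)
    closed z∈ = let z< = ∈-upTo⁻ z∈ ; (p , q) = inv-ι z< in ∈-upTo⁺ p , q , opp z<

  goodDatum⁺ : ∀ s → Closed (nth s) (upTo n) → (∀ {y} → y < n → reach n (nth s) (tau ms) n y ≡ true) →
    numCycles n (tau ms ∘ nth s) + K ≡ N + 2 → goodDatum 0 N K ms s ≡ true
  goodDatum⁺ s c tr g = ∧-true
    (all⁺ _ (upTo n) λ {z} z∈ → let (_ , i , o) = c z∈ in
      ∧-true (true-≡ᵇ i) (not-≡ᵇ {nth s z} {z} λ e → o (cong isEven (sym e))))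
    (∧-true (all⁺ _ (upTo n) (λ z∈ → tr (∈-upTo⁻ z∈)))
    (∧-true (∧-true (all-even ms ev) (all⁺ _ (upTo n) λ {z} z∈ → let (_ , _ , o) = c z∈ in
       opp-∨ λ e → o (trans (sym (isEven-offset ms z ev)) (trans e (isEven-offset ms (nth s z) ev)))))
    (true-≡ᵇ (trans (+-identityʳ _) g))))

-- Connectedness and the number of steps it takes

module _ {n : ℕ} {ι τ : ℕ → ℕ} where

  private
    reached : ℕ → ℕ → Set
    reached k y = reach n ι τ k y ≡ true

  reach-mono : ∀ k m y → k ≤ m → reached k y → reached m y
  reach-mono k m y k≤m h = subst (λ t → reached t y) (m∸n+n≡m k≤m) (up (m ∸ k))
    where
    up : ∀ i → reached (i + k) y
    up zero    = h
    up (suc i) rewrite up i = refl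

  reach-ι : ∀ k x → reached k x → x < n → reached (suc k) (ι x)
  reach-ι k x h x< rewrite any⁺ (λ z → reach n ι τ k z ∧ ((ι z == ι x) ∨ (τ z == ι x))) (upTo n) (∈-upTo⁺ x<)
    (∧-true h (cong (_∨ (τ x == ι x)) (true-≡ᵇ {ι x} refl))) = ∨-zeroʳ _

  reach-τ : ∀ k x → reached k x → x < n → reached (suc k) (τ x)
  reach-τ k x h x< rewrite any⁺ (λ z → reach n ι τ k z ∧ ((ι z == τ x) ∨ (τ z == τ x))) (upTo n) (∈-upTo⁺ x<)
    (∧-true h (trans (cong ((ι x == τ x) ∨_) (true-≡ᵇ {τ x} refl)) (∨-zeroʳ _))) = ∨-zeroʳ _

  reach-iter : ∀ k x → reached k x → (∀ j → iter j τ x < n) → ∀ j → reached (j + k) (iter j τ x)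
  reach-iter k x h lt zero    = h
  reach-iter k x h lt (suc j) = reach-τ (j + k) (iter j τ x) (reach-iter k x h lt j) (lt j)

  reach-invariant : ∀ {P : ℕ → Set} → P 0 → (∀ {x} → P x → P (ι x) × P (τ x)) → ∀ k {y} → reached k y → P y
  reach-invariant {P} p₀ h zero {y} r = subst P (sym (≡ᵇ-true {y} {0} r)) p₀
  reach-invariant {P} p₀ h (suc k) {y} r with reach n ι τ k y in eq
  ... | true  = reach-invariant {P} p₀ h k {y} eq
  ... | false with any⁻ (λ z → reach n ι τ k z ∧ ((ι z == y) ∨ (τ z == y))) (upTo n) r
  ...   | x , _ , s with ∧-split {reach n ι τ k x} s
  ...     | rx , t with h (reach-invariant {P} p₀ h k {x} rx) | ∨-split {ι x == y} t
  ...       | pι , pτ | inj₁ e = subst P (≡ᵇ-true {ι x} {y} e) pι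
  ...       | pι , pτ | inj₂ e = subst P (≡ᵇ-true {τ x} {y} e) pτ

  -- The exact number of steps is kept, because `isTransitive` allows only `n` of them.
  reach-start : ∀ m → m ≤ n → (∀ i → suc i < m → τ i ≡ suc i) → ∀ x → x < m → reached x x
  reach-start m m≤n h zero    _  = refl
  reach-start m m≤n h (suc x) x< = subst (reached (suc x)) (h x x<)
    (reach-τ x x (reach-start m m≤n h x (<-trans (n<1+n x) x<)) (<-≤-trans (<-trans (n<1+n x) x<) m≤n))

tau-start : ∀ m ms i → suc i < m → tau (m ∷ ms) i ≡ suc i
tau-start m ms i i< rewrite tau-tauFrom (m ∷ ms) i | true-<ᵇ {i} {m} (<-trans (n<1+n i) i<)
  | true-<ᵇ {suc i} {m} i< = refl

∈-range⇒< : ∀ s m {x} → x ∈ range s m → x < s + m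
∈-range⇒< s (suc m) (here refl) = m<m+n s (s≤s z≤n)
∈-range⇒< s (suc m) (there x∈) = <-≤-trans (∈-range⇒< (suc s) m x∈) (≤-reflexive (sym (+-suc s m)))

2*-injective : ∀ {a b} → 2 * a ≡ 2 * b → a ≡ b
2*-injective {a} {b} = *-cancelˡ-≡ a b 2

-- Planar gluings of one polygon: brute force against enumeration

module Disk (N : ℕ) (N>0 : 0 < N) where

  n : ℕ
  n = 2 * N

  ms₁ : List ℕ
  ms₁ = n ∷ []

  ev : EvenList ms₁
  ev = (N , refl) ∷ []

  cyc : All (Cyc (tau ms₁)) (upTo n ∷ [])
  cyc = subst (λ t → All (Cyc (tau ms₁)) (t ∷ [])) (sym (upTo-range n)) (cyc-tau ms₁ (<-≤-trans N>0 (m≤m+n N (N + 0)) ∷ []))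

  alt : Alt true (upTo n)
  alt = subst (Alt true) (sym (upTo-range n)) (alt-range 0 n refl)

  len : length (upTo n) ≡ 2 * N
  len = length-upTo n

  -- Genus 0 means N + 1 vertices, which is equality in Euler's inequality for a component without
  -- other polygons.
  good-NC : ∀ {s} → s ∈ allMaps n → goodDatum 0 N 1 ms₁ s ≡ true → NC (nth s) (upTo n)
  good-NC {s} s∈ g with goodDatum⁻ N 1 ms₁ ev s s∈ g
  ... | closed , _ , genus = planar-NC (C.tight tight) inside≡[]
    where
    un : Unique (upTo n ++ [])
    un = subst Unique (sym (++-identityʳ (upTo n))) (upTo⁺ n)
    cl : Closed (nth s) (upTo n ++ [])
    cl = subst (Closed (nth s)) (sym (++-identityʳ (upTo n))) closed
    comp : Component (nth s) (upTo n) []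
    comp = component _ (upTo n) [] ≤-refl un cl
    module C = Component comp
    both : C.inside ++ C.outside ≡ []
    both = ↭-empty-inv (↭-sym C.part)
    inside≡[] : C.inside ≡ []
    inside≡[] = ++-conicalˡ C.inside C.outside both
    V≡ : numCycles n (tau ms₁ ∘ nth s) ≡ C.vertices + 0
    V≡ = numCycles-deriv n (upTo n ∷ []) cyc (++-identityʳ (upTo n)) (λ z< → proj₁ (proj₂ (closed (∈-upTo⁺ z<))))
      (C.deriv (subst (λ t → Deriv (nth s) t 0) (sym (++-conicalʳ C.inside C.outside both)) nil))
    V≡′ : C.vertices ≡ suc N
    V≡′ = suc-injective (begin
      suc C.vertices                         ≡⟨ cong suc (trans (sym (+-identityʳ _)) (sym V≡)) ⟩
      suc (numCycles n (tau ms₁ ∘ nth s))    ≡⟨ +-comm 1 _ ⟩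
      numCycles n (tau ms₁ ∘ nth s) + 1      ≡⟨ genus ⟩
      N + 2                                  ≡⟨ +-comm N 2 ⟩
      suc (suc N)                            ∎)
      where open ≡-Reasoning
    tight : excess C.vertices C.inside ≡ capacity (upTo n) C.inside
    tight rewrite inside≡[] | V≡′ | len = lem N
      where
      lem : ∀ N → 2 * suc N + 0 ≡ 2 * N + 0 + 2
      lem = solve-∀

  NC-good : ∀ {s} → NC (nth s) (upTo n) → goodDatum 0 N 1 ms₁ s ≡ true
  NC-good {s} nc with nc-deriv nc nil
  ... | V , e , D = goodDatum⁺ N 1 ms₁ ev s (nc-closed nc)
    (λ {y} y< → reach-mono {n} {nth s} {tau ms₁} y n y (<⇒≤ y<) (reach-start n ≤-refl (tau-start n []) y y<))
    (trans (cong (_+ 1) (trans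
      (numCycles-deriv n (upTo n ∷ []) cyc (++-identityʳ (upTo n)) (λ z< → proj₁ (proj₂ (nc-closed nc (∈-upTo⁺ z<)))) D)
      V≡)) (lem′ N))
    where
    lem : ∀ N → 2 * N + 2 + 0 ≡ 2 * suc N
    lem = solve-∀
    lem′ : ∀ N → suc N + 1 ≡ N + 2
    lem′ = solve-∀
    V≡ : V ≡ suc N
    V≡ = 2*-injective (trans e (trans (cong (λ t → t + 2 + 0) len) (lem N)))

  count : ∀ f → N ≤ f → length (filterᵇ (goodDatum 0 N 1 ms₁) (allMaps n)) ≡ cat f N
  count f N≤f = trans (unique-set-length (Unique-filterᵇ (goodDatum 0 N 1 ms₁) (unique-allMaps n))
      (unique-enumNC f N (upTo n) len (upTo⁺ n)) to from)
    (length-enumNC f N (upTo n))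
    where
    upTo≡ : ∀ {s} → length s ≡ n → map (nth s) (upTo n) ≡ s
    upTo≡ {s} l = subst (λ k → map (nth s) (upTo k) ≡ s) l (map-nth s)
    to : ∀ {s} → s ∈ filterᵇ (goodDatum 0 N 1 ms₁) (allMaps n) → s ∈ enumNC f N (upTo n)
    to {s} s∈ with ∈-filterᵇ⁻ (goodDatum 0 N 1 ms₁) (allMaps n) s∈
    ... | s∈′ , g = subst (_∈ enumNC f N (upTo n)) (upTo≡ (proj₁ (∈-allMaps⁻ n s∈′)))
      (NC-complete f N (upTo n) N≤f len alt (good-NC s∈′ g))
    from : ∀ {s} → s ∈ enumNC f N (upTo n) → s ∈ filterᵇ (goodDatum 0 N 1 ms₁) (allMaps n)
    from {s} s∈ = ∈-filterᵇ⁺ (goodDatum 0 N 1 ms₁) (allMaps n) (∈-allMaps⁺ n l bounded) (NC-good {s} nc)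
      where
      l : length s ≡ n
      l = trans (enumNC-length f N (upTo n) len s∈) len
      nc : NC (nth s) (upTo n)
      nc = NC-sound f N (upTo n) len alt (subst (_∈ enumNC f N (upTo n)) (sym (upTo≡ l)) s∈)
      bounded : ∀ {z} → z ∈ s → z < n
      bounded {z} z∈ with ∈-map⁻ (nth s) (subst (z ∈_) (sym (upTo≡ l)) z∈)
      ... | i , i∈ , refl = ∈-upTo⁻ (proj₁ (nc-closed nc i∈))

-- Planar gluings of two polygons: brute force against enumeration

module Annulus (p q : ℕ) (p>0 : 0 < p) (q>0 : 0 < q) where

  N n : ℕ
  N = p + q
  n = 2 * N

  w₁ w₂ ms₂ : List ℕ
  w₁  = range 0 (2 * p)
  w₂  = range (2 * p) (2 * q)
  ms₂ = 2 * p ∷ 2 * q ∷ []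

  ev : EvenList ms₂
  ev = (p , refl) ∷ (q , refl) ∷ []

  w₂∋2p : 2 * p ∈ w₂
  w₂∋2p = ∈-range⁺ (2 * p) (2 * q) ≤-refl (m<m+n (2 * p) (<-≤-trans q>0 (m≤m+n q (q + 0))))

  w₁∋0 : 0 ∈ w₁
  w₁∋0 = ∈-range⁺ 0 (2 * p) z≤n (<-≤-trans p>0 (m≤m+n p (p + 0)))

  cyc : All (Cyc (tau ms₂)) (w₁ ∷ w₂ ∷ [])
  cyc = cyc-tau ms₂ (<-≤-trans p>0 (m≤m+n p (p + 0)) ∷ <-≤-trans q>0 (m≤m+n q (q + 0)) ∷ [])

  cyc₁ : Cyc (tau ms₂) w₁
  cyc₁ = All.lookup cyc (here refl)

  cyc₂ : Cyc (tau ms₂) w₂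
  cyc₂ = All.lookup cyc (there (here refl))

  alt₁ : Alt true w₁
  alt₁ = alt-range 0 (2 * p) refl

  alt₂ : Alt (start true true) w₂
  alt₂ = alt-range (2 * p) (2 * q) (isEven-2* p)

  len₁ : length w₁ ≡ 2 * p
  len₁ = length-range 0 (2 * p)

  len₂ : length w₂ ≡ 2 * q
  len₂ = length-range (2 * p) (2 * q)

  n≡ : 2 * p + 2 * q ≡ n
  n≡ = sym (*-distribˡ-+ 2 p q)

  points : w₁ ++ w₂ ≡ upTo n
  points = trans (range-++ 0 (2 * p) (2 * q)) (trans (cong (range 0) n≡) (sym (upTo-range n)))

  points′ : w₁ ++ w₂ ++ [] ≡ upTo n
  points′ = trans (cong (w₁ ++_) (++-identityʳ w₂)) points

  unique-points : Unique (w₁ ++ w₂)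
  unique-points = subst Unique (sym points) (upTo⁺ n)

  -- The search from the first polygon must meet the second one, which would otherwise be closed
  -- under `ι`. Genus 0 then means N vertices, equality in Euler's inequality.
  good-Ann : ∀ {s} → s ∈ allMaps n → goodDatum 0 N 2 ms₂ s ≡ true → Ann (nth s) w₁ w₂
  good-Ann {s} s∈ g with goodDatum⁻ N 2 ms₂ ev s s∈ g
  ... | closed , transitive , genus = cases (component _ w₁ (w₂ ∷ []) ≤-refl
          (subst Unique (sym points′) (upTo⁺ n)) (subst (Closed (nth s)) (sym points′) closed))
    where
    τ′ ι′ : ℕ → ℕ
    τ′ = tau ms₂
    ι′ = nth s
    disconnected : Closed ι′ w₂ → ⊥
    -- The first polygon would contain 0, where `reach` starts, and be invariant under `ι` and
    -- `tau`; hence it would contain `2 * p`.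
    disconnected c₂ = Unique-disjoint w₁ unique-points
      (reach-invariant {n} {ι′} {τ′} {_∈ w₁} w₁∋0 (λ x∈ → stay x∈ , cyc-closed cyc₁ x∈) n
        (all⁻ _ (upTo n) transitive (subst (2 * p ∈_) points (∈-++⁺ʳ w₁ w₂∋2p)))) w₂∋2p
      where
      stay : ∀ {x} → x ∈ w₁ → ι′ x ∈ w₁
      stay {x} x∈ with closed (subst (x ∈_) points (∈-++⁺ˡ x∈))
      ... | h , i , _ with ∈-++⁻ w₁ (subst (ι′ x ∈_) (sym points) h)
      ...   | inj₁ k = k
      ...   | inj₂ k = ⊥-elim (Unique-disjoint w₁ unique-points x∈ (subst (_∈ w₂) i (proj₁ (c₂ k))))
    cases : Component ι′ w₁ (w₂ ∷ []) → Ann ι′ w₁ w₂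
    cases comp = go C.inside C.outside refl refl (↭-singleton-inv (↭-sym C.part))
      where
      module C = Component comp
      go : ∀ Q R → C.inside ≡ Q → C.outside ≡ R → Q ++ R ≡ w₂ ∷ [] → Ann ι′ w₁ w₂
      go [] R hi ho refl = ⊥-elim (disconnected (subst (Closed ι′)
        (trans (cong concat ho) (++-identityʳ w₂)) C.closed))
      go (_ ∷ []) [] hi ho refl = planar-Ann (C.tight tight) hi
        where
        V≡ : numCycles n (τ′ ∘ ι′) ≡ C.vertices + 0
        V≡ = numCycles-deriv n (w₁ ∷ w₂ ∷ []) cyc points′ (λ z< → proj₁ (proj₂ (closed (∈-upTo⁺ z<))))
          (C.deriv (subst (λ t → Deriv ι′ t 0) (sym ho) nil))
        V≡′ : C.vertices ≡ N
        V≡′ = trans (sym (+-identityʳ _)) (trans (sym V≡) (+-cancelʳ-≡ 2 _ N genus))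
        lem : ∀ p q → 2 * (p + q) + 2 * 1 ≡ 2 * p + 2 * q + 2
        lem = solve-∀
        tight : excess C.vertices C.inside ≡ capacity w₁ C.inside
        tight = begin
          2 * C.vertices + 2 * length C.inside          ≡⟨ cong₂ (λ v Q → 2 * v + 2 * length Q) V≡′ hi ⟩
          2 * (p + q) + 2 * 1                           ≡⟨ lem p q ⟩
          2 * p + 2 * q + 2                             ≡⟨ cong₂ (λ s t → s + t + 2) len₁ len₂ ⟨
          length w₁ + length w₂ + 2                     ≡⟨ cong (λ t → length w₁ + length t + 2) (++-identityʳ w₂) ⟨
          length w₁ + length (concat (w₂ ∷ [])) + 2     ≡⟨ cong (λ t → length w₁ + length (concat t) + 2) hi ⟨
          capacity w₁ C.inside                          ∎
          where open ≡-Reasoning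

  Ann-good : ∀ {s} → Ann (nth s) w₁ w₂ → goodDatum 0 N 2 ms₂ s ≡ true
  Ann-good {s} an with ann-deriv an nil
  ... | V , e , D = goodDatum⁺ N 2 ms₂ ev s closed transitive
    (cong (_+ 2) (trans (numCycles-deriv n (w₁ ∷ w₂ ∷ []) cyc points′ (λ z< → proj₁ (proj₂ (closed (∈-upTo⁺ z<)))) D) V≡))
    where
    τ′ ι′ : ℕ → ℕ
    τ′ = tau ms₂
    ι′ = nth s
    closed : Closed ι′ (upTo n)
    closed = subst (Closed ι′) points (ann-closed an)
    V≡ : V ≡ N
    V≡ = 2*-injective (trans e (trans (+-identityʳ _) (trans (cong₂ _+_ len₁ len₂) n≡)))
    2p≤n : 2 * p ≤ n
    2p≤n = ≤-trans (m≤m+n (2 * p) (2 * q)) (≤-reflexive n≡)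
    first : ∀ y → y < 2 * p → reach n ι′ τ′ y y ≡ true
    first = reach-start (2 * p) 2p≤n (tau-start (2 * p) (2 * q ∷ []))
    second : ∀ {y} → y ∈ w₂ → reach n ι′ τ′ n y ≡ true
    second {y} y∈ with ann-cross an
    ... | a , a∈ , ιa∈ with cyc-iter cyc₂ ιa∈ y∈
    ...   | j , j< , h = subst (λ z → reach n ι′ τ′ n z ≡ true) h
      -- It takes `a` steps to reach `a`, one to cross, and `suc j` along the second polygon: at
      -- most 2p + 2q = n in all.
      (reach-mono {n} {ι′} {τ′} (suc j + suc a) n _ (≤-trans (+-mono-≤ (≤-trans j< (≤-reflexive len₂)) a<)
                        (≤-reflexive (trans (+-comm (2 * q) (2 * p)) n≡)))
        (reach-iter {n} {ι′} {τ′} (suc a) (ι′ a) (reach-ι {n} {ι′} {τ′} a a (first a a<) (<-≤-trans a< 2p≤n))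
          (λ i → ∈-upTo⁻ (subst (iter i τ′ (ι′ a) ∈_) points (∈-++⁺ʳ w₁ (cyc-iter-closed cyc₂ ιa∈ i)))) (suc j)))
      where
      a< : a < 2 * p
      a< = ∈-range⇒< 0 (2 * p) a∈
    transitive : ∀ {y} → y < n → reach n ι′ τ′ n y ≡ true
    transitive {y} y< with y <? 2 * p
    ... | yes y<2p = reach-mono {n} {ι′} {τ′} y n y (<⇒≤ y<) (first y y<2p)
    ... | no  y≮2p = second (∈-range⁺ (2 * p) (2 * q) (≮⇒≥ y≮2p) (<-≤-trans y< (≤-reflexive (sym n≡))))

  count : ∀ f → N ≤ f → length (filterᵇ (goodDatum 0 N 2 ms₂) (allMaps n)) ≡ ann f p q
  count f N≤f = trans (unique-set-length (Unique-filterᵇ (goodDatum 0 N 2 ms₂) (unique-allMaps n))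
      (Unique-map-on glue glue-injective (unique-enumAnn f true p q w₁ w₂ len₁ len₂ unique-points alt₁ alt₂)) to from)
    (trans (length-map glue E) (length-enumAnn f true p q w₁ w₂))
    where
    E : List (List ℕ × List ℕ)
    E = enumAnn f true p q w₁ w₂
    glue : List ℕ × List ℕ → List ℕ
    glue (s , t) = s ++ t
    lengths : ∀ {s t} → (s , t) ∈ E → length s ≡ length w₁ × length t ≡ length w₂
    lengths = enumAnn-length f true p q w₁ w₂ len₁ len₂
    glue-injective : ∀ {z z′} → z ∈ E → z′ ∈ E → glue z ≡ glue z′ → z ≡ z′
    glue-injective {s , t} {s′ , t′} z∈ z′∈ h
      with ++-injective s s′ (trans (proj₁ (lengths z∈)) (sym (proj₁ (lengths z′∈)))) h
    ... | refl , refl = refl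
    map-points : ∀ {s} → length s ≡ n → map (nth s) w₁ ++ map (nth s) w₂ ≡ s
    map-points {s} l = trans (sym (map-++ (nth s) w₁ w₂)) (trans (cong (map (nth s)) points)
      (subst (λ k → map (nth s) (upTo k) ≡ s) l (map-nth s)))
    to : ∀ {s} → s ∈ filterᵇ (goodDatum 0 N 2 ms₂) (allMaps n) → s ∈ map glue E
    to {s} s∈ with ∈-filterᵇ⁻ (goodDatum 0 N 2 ms₂) (allMaps n) s∈
    ... | s∈′ , g = subst (_∈ map glue E) (map-points (proj₁ (∈-allMaps⁻ n s∈′)))
      (∈-map⁺ glue (Ann-complete f true p q w₁ w₂ N≤f len₁ len₂ alt₁ alt₂ (good-Ann s∈′ g)))
    from : ∀ {s} → s ∈ map glue E → s ∈ filterᵇ (goodDatum 0 N 2 ms₂) (allMaps n)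
    from s∈ with ∈-map⁻ glue s∈
    ... | (s₁ , s₂) , z∈ , refl = ∈-filterᵇ⁺ (goodDatum 0 N 2 ms₂) (allMaps n)
      (∈-allMaps⁺ n l bounded) (Ann-good {s₁ ++ s₂} an)
      where
      s = s₁ ++ s₂
      l : length s ≡ n
      l = trans (length-++ s₁) (trans (cong₂ _+_ (trans (proj₁ (lengths z∈)) len₁) (trans (proj₂ (lengths z∈)) len₂)) n≡)
      parts : map (nth s) w₁ ≡ s₁ × map (nth s) w₂ ≡ s₂
      parts = ++-injective (map (nth s) w₁) s₁ (trans (length-map (nth s) w₁) (sym (proj₁ (lengths z∈)))) (map-points l)
      an : Ann (nth s) w₁ w₂
      an = Ann-sound f true p q w₁ w₂ len₁ len₂ alt₁ alt₂
        (subst (_∈ E) (sym (cong₂ _,_ (proj₁ parts) (proj₂ parts))) z∈)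
      bounded : ∀ {z} → z ∈ s → z < n
      bounded {z} z∈ with ∈-map⁻ (nth s) (subst (z ∈_) (trans (sym (map-points l)) (sym (map-++ (nth s) w₁ w₂))) z∈)
      ... | i , i∈ , refl = ∈-upTo⁻ (subst (nth s i ∈_) points (proj₁ (ann-closed an i∈)))

-- Summation

sum-applyUpTo : ∀ (f h : ℕ → ℕ) n → sum (map f (applyUpTo h n)) ≡ ∑ n (f ∘ h)
sum-applyUpTo f h zero    = refl
sum-applyUpTo f h (suc n) = cong (f (h 0) +_) (sum-applyUpTo f (h ∘ suc) n)

sum-upTo : ∀ f n → sum (map f (upTo n)) ≡ ∑ n f
sum-upTo f n = sum-applyUpTo f id n

∑-+ : ∀ n (f g : ℕ → ℕ) → ∑ n (λ i → f i + g i) ≡ ∑ n f + ∑ n g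
∑-+ zero    f g = refl
∑-+ (suc n) f g = trans (cong (f 0 + g 0 +_) (∑-+ n (f ∘ suc) (g ∘ suc)))
  (lem (f 0) (g 0) (∑ n (f ∘ suc)) (∑ n (g ∘ suc)))
  where
  lem : ∀ a b c d → a + b + (c + d) ≡ a + c + (b + d)
  lem = solve-∀

∑-*ˡ : ∀ n c (f : ℕ → ℕ) → ∑ n (λ i → c * f i) ≡ c * ∑ n f
∑-*ˡ zero    c f = sym (*-zeroʳ c)
∑-*ˡ (suc n) c f = trans (cong (c * f 0 +_) (∑-*ˡ n c (f ∘ suc))) (sym (*-distribˡ-+ c (f 0) (∑ n (f ∘ suc))))

∑-const : ∀ n c → ∑ n (λ _ → c) ≡ n * c
∑-const zero    c = refl
∑-const (suc n) c = cong (c +_) (∑-const n c)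

∑-zero : ∀ n {f : ℕ → ℕ} → (∀ i → i < n → f i ≡ 0) → ∑ n f ≡ 0
∑-zero n h = trans (∑-cong n h) (trans (∑-const n 0) (*-zeroʳ n))

∑-last : ∀ n (f : ℕ → ℕ) → ∑ (suc n) f ≡ ∑ n f + f n
∑-last zero    f = +-identityʳ (f 0)
∑-last (suc n) f = trans (cong (f 0 +_) (∑-last n (f ∘ suc))) (sym (+-assoc (f 0) _ _))

∑-reflect : ∀ n (f : ℕ → ℕ) → ∑ (suc n) (λ i → f (n ∸ i)) ≡ ∑ (suc n) f
∑-reflect zero    f = refl
∑-reflect (suc n) f = begin
  f (suc n) + ∑ (suc n) (λ i → f (n ∸ i))   ≡⟨ cong (f (suc n) +_) (∑-reflect n f) ⟩
  f (suc n) + ∑ (suc n) f                   ≡⟨ +-comm (f (suc n)) _ ⟩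
  ∑ (suc n) f + f (suc n)                   ≡⟨ ∑-last (suc n) f ⟨
  ∑ (suc (suc n)) f                         ∎
  where open ≡-Reasoning

∑-single : ∀ n j {f : ℕ → ℕ} → j < n → (∀ i → i ≢ j → f i ≡ 0) → ∑ n f ≡ f j
∑-single (suc n) zero    {f} _       h = trans (cong (f 0 +_) (∑-zero n (λ i _ → h (suc i) λ ()))) (+-identityʳ (f 0))
∑-single (suc n) (suc j) {f} (s≤s l) h = trans (cong (_+ ∑ n (f ∘ suc)) (h 0 λ ()))
  (∑-single n j l (λ i i≢j → h (suc i) (i≢j ∘ suc-injective)))

∑-evens : ∀ n {f : ℕ → ℕ} → (∀ i → isEven i ≡ false → f i ≡ 0) → ∑ (suc (2 * n)) f ≡ ∑ (suc n) (λ i → f (2 * i))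
∑-evens zero        h = refl
∑-evens (suc n) {f} h = begin
  ∑ (suc (2 * suc n)) f                                        ≡⟨ cong (λ t → ∑ (suc t) f) (2*suc n) ⟩
  f 0 + (f 1 + ∑ (suc (2 * n)) (f ∘ suc ∘ suc))                ≡⟨ cong (λ t → f 0 + (t + ∑ (suc (2 * n)) (f ∘ suc ∘ suc))) (h 1 refl) ⟩
  f 0 + ∑ (suc (2 * n)) (f ∘ suc ∘ suc)                        ≡⟨ cong (f 0 +_) (∑-evens n (λ i e → h (suc (suc i)) e)) ⟩
  f 0 + ∑ (suc n) (λ i → f (suc (suc (2 * i))))                ≡⟨ cong (f 0 +_) (∑-cong (suc n) λ i _ → cong f (sym (2*suc i))) ⟩
  f 0 + ∑ (suc n) (λ i → f (2 * suc i))                        ∎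
  where open ≡-Reasoning

-- Both sides run over the pairs j, r with j + r < n, on the left grouped by their sum.
∑-triangle : ∀ n (F : ℕ → ℕ → ℕ) →
  ∑ n (λ p → ∑ (suc p) (λ j → F j (p ∸ j))) ≡ ∑ n (λ j → ∑ (n ∸ j) (F j))
∑-triangle zero    F = refl
∑-triangle (suc n) F = begin
  ∑ (suc n) (λ p → F 0 p + ∑ p (λ j → F (suc j) (p ∸ suc j)))
    ≡⟨ ∑-+ (suc n) (F 0) (λ p → ∑ p (λ j → F (suc j) (p ∸ suc j))) ⟩
  ∑ (suc n) (F 0) + ∑ n (λ p → ∑ (suc p) (λ j → F (suc j) (p ∸ j)))
    ≡⟨ cong (∑ (suc n) (F 0) +_) (∑-triangle n (F ∘ suc)) ⟩
  ∑ (suc n) (F 0) + ∑ n (λ j → ∑ (n ∸ j) (F (suc j)))               ∎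
  where open ≡-Reasoning

2*∑-descending : ∀ n → ∑ n (λ p → n ∸ p) * 2 ≡ suc n * n
2*∑-descending zero    = refl
2*∑-descending (suc n) = trans (*-distribʳ-+ 2 (suc n) (∑ n (λ p → n ∸ p)))
  (trans (cong (suc n * 2 +_) (2*∑-descending n)) (lem n))
  where
  lem : ∀ n → suc n * 2 + suc n * n ≡ suc (suc n) * suc n
  lem = solve-∀

-- Sums over compositions into one or two parts

sum-filterᵇ : ∀ (P : X → Bool) (h : X → ℕ) xs →
  sum (map h (filterᵇ P xs)) ≡ sum (map (λ x → if P x then h x else 0) xs)
sum-filterᵇ P h []       = refl
sum-filterᵇ P h (x ∷ xs) with P x
... | true  = cong (h x +_) (sum-filterᵇ P h xs)
... | false = sum-filterᵇ P h xs

sum-allTuples : ∀ k (xs : List X) (h : List X → ℕ) →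
  sum (map h (allTuples (suc k) xs)) ≡ sum (map (λ x → sum (map (h ∘ (x ∷_)) (allTuples k xs))) xs)
sum-allTuples {X} k xs h = go xs
  where
  go : ∀ ys → sum (map h (concatMap (λ x → map (x ∷_) (allTuples k xs)) ys)) ≡
              sum (map (λ x → sum (map (h ∘ (x ∷_)) (allTuples k xs))) ys)
  go []       = refl
  go (y ∷ ys) = begin
    sum (map h (front ++ rest))                 ≡⟨ cong sum (map-++ h front rest) ⟩
    sum (map h front ++ map h rest)             ≡⟨ sum-++ (map h front) (map h rest) ⟩
    sum (map h front) + sum (map h rest)        ≡⟨ cong₂ _+_ (cong sum (sym (map-∘ (allTuples k xs)))) (go ys) ⟩
    _                                    ∎
    where
    open ≡-Reasoning
    front rest : List (List X)
    front = map (y ∷_) (allTuples k xs)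
    rest = concatMap (λ x → map (x ∷_) (allTuples k xs)) ys

isComposition : ℕ → List ℕ → Bool
isComposition n ms = all (λ m → 1 ≤ᵇ m) ms ∧ (sum ms == n)

if-false : ∀ c (x : ℕ) → (c ≡ true → ⊥) → (if c then x else 0) ≡ 0
if-false true  x h = ⊥-elim (h refl)
if-false false x h = refl

sum-compositions-1 : ∀ n (h : List ℕ → ℕ) → 0 < n → sum (map h (compositions n 1)) ≡ h (n ∷ [])
sum-compositions-1 n h n>0 = begin
  sum (map h (compositions n 1))                         ≡⟨ sum-filterᵇ (isComposition n) h (allTuples 1 (upTo (suc n))) ⟩
  sum (map h′ (allTuples 1 (upTo (suc n))))              ≡⟨ sum-allTuples 0 (upTo (suc n)) h′ ⟩
  sum (map (λ m → h′ (m ∷ []) + 0) (upTo (suc n)))       ≡⟨ sum-upTo (λ m → h′ (m ∷ []) + 0) (suc n) ⟩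
  ∑ (suc n) (λ m → h′ (m ∷ []) + 0)                      ≡⟨ ∑-single (suc n) n (n<1+n n) (λ m m≢n → trans (+-identityʳ (h′ (m ∷ [])))
      (if-false (isComposition n (m ∷ [])) (h (m ∷ [])) λ e → m≢n (trans (sym (+-identityʳ m)) (≡ᵇ-true {m + 0} {n} (proj₂ (∧-split e)))))) ⟩
  h′ (n ∷ []) + 0                                        ≡⟨ +-identityʳ _ ⟩
  h′ (n ∷ [])                                            ≡⟨ cong (λ c → if c then h (n ∷ []) else 0)
      (∧-true (∧-true (true-≤ᵇ n>0) refl) (true-≡ᵇ {n + 0} (+-identityʳ n))) ⟩
  h (n ∷ [])                                             ∎
  where
  open ≡-Reasoning
  h′ : List ℕ → ℕ
  h′ ms = if isComposition n ms then h ms else 0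

-- The first part determines the second. The test stays in the summand to discard a = 0 and a = n,
-- where a part vanishes.
sum-compositions-2 : ∀ n (h : List ℕ → ℕ) → sum (map h (compositions n 2)) ≡
  ∑ (suc n) (λ a → if isComposition n (a ∷ n ∸ a ∷ []) then h (a ∷ n ∸ a ∷ []) else 0)
sum-compositions-2 n h = begin
  sum (map h (compositions n 2))
    ≡⟨ sum-filterᵇ (isComposition n) h (allTuples 2 (upTo (suc n))) ⟩
  sum (map h′ (allTuples 2 (upTo (suc n))))
    ≡⟨ sum-allTuples 1 (upTo (suc n)) h′ ⟩
  sum (map (λ a → sum (map (h′ ∘ (a ∷_)) (allTuples 1 (upTo (suc n))))) (upTo (suc n)))
    ≡⟨ sum-upTo _ (suc n) ⟩
  ∑ (suc n) (λ a → sum (map (h′ ∘ (a ∷_)) (allTuples 1 (upTo (suc n)))))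
    ≡⟨ ∑-cong (suc n) (λ a _ → trans (sum-allTuples 0 (upTo (suc n)) (h′ ∘ (a ∷_))) (sum-upTo _ (suc n))) ⟩
  ∑ (suc n) (λ a → ∑ (suc n) (λ b → h′ (a ∷ b ∷ []) + 0))
    ≡⟨ ∑-cong (suc n) (λ a _ → ∑-single (suc n) (n ∸ a) (s≤s (m∸n≤m n a)) (others a)) ⟩
  ∑ (suc n) (λ a → h′ (a ∷ n ∸ a ∷ []) + 0)
    ≡⟨ ∑-cong (suc n) (λ a _ → +-identityʳ (h′ (a ∷ n ∸ a ∷ []))) ⟩
  ∑ (suc n) (λ a → h′ (a ∷ n ∸ a ∷ []))    ∎
  where
  open ≡-Reasoning
  h′ : List ℕ → ℕ
  h′ ms = if isComposition n ms then h ms else 0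
  others : ∀ a b → b ≢ n ∸ a → h′ (a ∷ b ∷ []) + 0 ≡ 0
  others a b b≢ = trans (+-identityʳ _) (if-false (isComposition n (a ∷ b ∷ [])) (h (a ∷ b ∷ [])) λ e → b≢ (begin
    b                 ≡⟨ m+n∸m≡n a b ⟨
    a + b ∸ a         ≡⟨ cong (λ t → a + t ∸ a) (+-identityʳ b) ⟨
    a + (b + 0) ∸ a   ≡⟨ cong (_∸ a) (≡ᵇ-true {a + (b + 0)} {n} (proj₂ (∧-split {all (λ m → 1 ≤ᵇ m) (a ∷ b ∷ [])} e))) ⟩
    n ∸ a             ∎))

filterᵇ-none : (P : X → Bool) (xs : List X) → (∀ x → P x ≡ false) → filterᵇ P xs ≡ []
filterᵇ-none P []       h = refl
filterᵇ-none P (x ∷ xs) h rewrite h x = filterᵇ-none P xs h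

∧-falseʳ : ∀ a {b} → b ≡ false → a ∧ b ≡ false
∧-falseʳ true  refl = refl
∧-falseʳ false refl = refl

odd-not-good : ∀ g N K m ms s → isEven m ≡ false → goodDatum g N K (m ∷ ms) s ≡ false
odd-not-good g N K m ms s h = ∧-falseʳ (isFPFInvolution (2 * N) (nth s))
  (∧-falseʳ (isTransitive (2 * N) (nth s) (tau (m ∷ ms))) (cong (_∧ hasGenus g N K (m ∷ ms) (nth s))
    (cong (_∧ all (λ x → not (isEven (offset (m ∷ ms) x)) ∨ not (isEven (offset (m ∷ ms) (nth s x)))) (upTo (2 * N)))
      (cong (_∧ all isEven ms) h))))

-- Holding at every sufficient fuel, it lets each `cat` in the recursion be replaced by `B₁`
-- whatever fuel is left.
B-disk : ∀ f k → k ≤ f → B₁ 0 k ≡ cat f k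
B-disk f zero    _   = refl
B-disk f (suc k) k≤f = trans
  (sum-compositions-1 (2 * suc k) (λ ms → length (filterᵇ (goodDatum 0 (suc k) 1 ms) (allMaps (2 * suc k)))) (s≤s z≤n))
  (Disk.count (suc k) (s≤s z≤n) f k≤f)

annuli : ℕ → ℕ → ℕ
annuli f N = ∑ N (λ p → ann f p (N ∸ p))

module _ (N f : ℕ) (N≤f : N ≤ f) where

  private
    h : List ℕ → ℕ
    h ms = length (filterᵇ (goodDatum 0 N 2 ms) (allMaps (2 * N)))
    G : ℕ → ℕ
    G a = if isComposition (2 * N) (a ∷ 2 * N ∸ a ∷ []) then h (a ∷ 2 * N ∸ a ∷ []) else 0

    G-odd : ∀ i → isEven i ≡ false → G i ≡ 0
    G-odd i e with isComposition (2 * N) (i ∷ 2 * N ∸ i ∷ [])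
    ... | true  = cong length (filterᵇ-none _ (allMaps (2 * N)) (λ s → odd-not-good 0 N 2 i (2 * N ∸ i ∷ []) s e))
    ... | false = refl

    G-even : ∀ p → p < N → G (2 * p) ≡ ann f p (N ∸ p)
    -- At p = 0 both sides are 0: the part 0 fails the composition test, and `ann` vanishes on an
    -- empty first polygon.
    G-even zero        _   = refl
    G-even (suc p) p<N = trans (cong (λ c → if c then h (2 * suc p ∷ 2 * N ∸ 2 * suc p ∷ []) else 0) comp)
      (trans (cong (λ t → h (2 * suc p ∷ t ∷ [])) (sym (*-distribˡ-∸ 2 N (suc p)))) counted)
      where
      q>0 : 0 < N ∸ suc p
      q>0 = m<n⇒0<n∸m p<N
      p+q : suc p + (N ∸ suc p) ≡ N
      p+q = m+[n∸m]≡n (<⇒≤ p<N)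
      comp : isComposition (2 * N) (2 * suc p ∷ 2 * N ∸ 2 * suc p ∷ []) ≡ true
      comp = ∧-true (∧-true refl (∧-true (true-≤ᵇ (m<n⇒0<n∸m (*-monoʳ-< 2 p<N))) refl))
        (true-≡ᵇ {2 * suc p + (2 * N ∸ 2 * suc p + 0)}
          (trans (cong (2 * suc p +_) (+-identityʳ _)) (m+[n∸m]≡n (*-monoʳ-≤ 2 (<⇒≤ p<N)))))
      counted : h (2 * suc p ∷ 2 * (N ∸ suc p) ∷ []) ≡ ann f (suc p) (N ∸ suc p)
      counted = subst
        (λ M → length (filterᵇ (goodDatum 0 M 2 (2 * suc p ∷ 2 * (N ∸ suc p) ∷ [])) (allMaps (2 * M))) ≡ ann f (suc p) (N ∸ suc p))
        p+q (Annulus.count (suc p) (N ∸ suc p) (s≤s z≤n) q>0 f (≤-trans (≤-reflexive p+q) N≤f))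

    G-last : G (2 * N) ≡ 0
    G-last = if-false (isComposition (2 * N) (2 * N ∷ 2 * N ∸ 2 * N ∷ [])) _ λ e → empty-part
      (proj₁ (∧-split (proj₂ (∧-split {1 ≤ᵇ 2 * N} (proj₁ (∧-split e))))))
      where
      empty-part : (1 ≤ᵇ 2 * N ∸ 2 * N) ≡ true → ⊥
      empty-part e with subst (1 ≤_) (n∸n≡0 (2 * N)) (≤ᵇ-true {1} {2 * N ∸ 2 * N} e)
      ... | ()

  sum-annuli : sum (map h (compositions (2 * N) 2)) ≡ annuli f N
  sum-annuli = begin
    sum (map h (compositions (2 * N) 2))      ≡⟨ sum-compositions-2 (2 * N) h ⟩
    ∑ (suc (2 * N)) G                         ≡⟨ ∑-evens N G-odd ⟩
    ∑ (suc N) (λ i → G (2 * i))               ≡⟨ ∑-last N (λ i → G (2 * i)) ⟩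
    ∑ N (λ i → G (2 * i)) + G (2 * N)         ≡⟨ cong (∑ N (λ i → G (2 * i)) +_) G-last ⟩
    ∑ N (λ i → G (2 * i)) + 0                 ≡⟨ +-identityʳ _ ⟩
    ∑ N (λ i → G (2 * i))                     ≡⟨ ∑-cong N G-even ⟩
    annuli f N                                ∎
    where open ≡-Reasoning

B-annulus : ∀ f N → 0 < N → N ≤ f → B 0 N 2 ≡ annuli f N
B-annulus f (suc N) _ N≤f = sum-annuli (suc N) f N≤f

-- Replacing j by p - j turns the loops whose front piece is joined to the second polygon into those
-- whose rear piece is: hence the factor 2.
ann-step : ∀ f p q → ann (suc f) (suc p) q ≡
  2 * ∑ (suc p) (λ j → cat f j * ann f (p ∸ j) q) + q * cat f (p + q)
ann-step f p q = cong₂ _+_ (begin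
  ∑ (suc p) (λ j → F j + ann f j q * cat f (p ∸ j))          ≡⟨ ∑-+ (suc p) F (λ j → ann f j q * cat f (p ∸ j)) ⟩
  ∑ (suc p) F + ∑ (suc p) (λ j → ann f j q * cat f (p ∸ j))  ≡⟨ cong (∑ (suc p) F +_) (∑-cong (suc p) λ { j (s≤s j≤p) → flip j j≤p }) ⟩
  ∑ (suc p) F + ∑ (suc p) (λ j → F (p ∸ j))                  ≡⟨ cong (∑ (suc p) F +_) (trans (∑-reflect p F) (sym (+-identityʳ _))) ⟩
  2 * ∑ (suc p) F                                            ∎) (∑-const q (cat f (p + q)))
  where
  open ≡-Reasoning
  F : ℕ → ℕ
  F j = cat f j * ann f (p ∸ j) q
  flip : ∀ j → j ≤ p → ann f j q * cat f (p ∸ j) ≡ F (p ∸ j)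
  flip j j≤p = trans (*-comm (ann f j q) _) (cong (λ t → cat f (p ∸ j) * ann f t q) (sym (m∸[m∸n]≡n j≤p)))

-- Put r = p - j and sum over j last: for fixed j, the sizes r and N - p run over all splittings of
-- N - j, which gives `annuli f (N ∸ j)`. In the bridge term the merged polygon has N edges for
-- every p, so only the factors N - p are summed.
annuli-step : ∀ f N → annuli (suc f) (suc N) ≡
  2 * ∑ N (λ j → cat f j * annuli f (N ∸ j)) + ∑ N (λ p → N ∸ p) * cat f N
annuli-step f N = begin
  ∑ N (λ p → ann (suc f) (suc p) (N ∸ p))
    ≡⟨ ∑-cong N (λ p p<N → trans (ann-step f p (N ∸ p))
         (cong (λ t → 2 * L p + (N ∸ p) * cat f t) (m+[n∸m]≡n (<⇒≤ p<N)))) ⟩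
  ∑ N (λ p → 2 * L p + (N ∸ p) * cat f N)
    ≡⟨ ∑-+ N (λ p → 2 * L p) (λ p → (N ∸ p) * cat f N) ⟩
  ∑ N (λ p → 2 * L p) + ∑ N (λ p → (N ∸ p) * cat f N)
    ≡⟨ cong₂ _+_ (∑-*ˡ N 2 L) (trans (∑-cong N (λ p _ → *-comm (N ∸ p) (cat f N)))
         (trans (∑-*ˡ N (cat f N) (N ∸_)) (*-comm (cat f N) _))) ⟩
  2 * ∑ N L + ∑ N (λ p → N ∸ p) * cat f N
    ≡⟨ cong (λ t → 2 * t + ∑ N (λ p → N ∸ p) * cat f N) triangle ⟩
  2 * ∑ N (λ j → cat f j * annuli f (N ∸ j)) + ∑ N (λ p → N ∸ p) * cat f N  ∎
  where
  open ≡-Reasoning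
  L : ℕ → ℕ
  L p = ∑ (suc p) (λ j → cat f j * ann f (p ∸ j) (N ∸ p))
  F : ℕ → ℕ → ℕ
  F j r = cat f j * ann f r (N ∸ j ∸ r)
  triangle : ∑ N L ≡ ∑ N (λ j → cat f j * annuli f (N ∸ j))
  triangle = begin
    ∑ N L
      ≡⟨ ∑-cong N (λ p _ → ∑-cong (suc p) λ { j (s≤s j≤p) → cong (λ t → cat f j * ann f (p ∸ j) t)
           (trans (cong (N ∸_) (sym (m+[n∸m]≡n j≤p))) (sym (∸-+-assoc N j (p ∸ j)))) }) ⟩
    ∑ N (λ p → ∑ (suc p) (λ j → F j (p ∸ j)))
      ≡⟨ ∑-triangle N F ⟩
    ∑ N (λ j → ∑ (N ∸ j) (F j))
      ≡⟨ ∑-cong N (λ j _ → ∑-*ˡ (N ∸ j) (cat f j) (λ r → ann f r (N ∸ j ∸ r))) ⟩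
    ∑ N (λ j → cat f j * annuli f (N ∸ j))  ∎

theorem3 : (N : ℕ) → 2 ≤ N →
    B 0 N 2 ≡ 2 * sum (map (λ i → B₁ 0 i * B 0 (N ∸ i ∸ 1) 2) (upTo (N ∸ 2)))
    + (N * (N ∸ 1)) / 2 * B₁ 0 (N ∸ 1)
theorem3 (suc zero) (s≤s ())
theorem3 (suc (suc M)) _ = begin
  B 0 (suc (suc M)) 2
    ≡⟨ B-annulus (suc (suc M)) (suc (suc M)) (s≤s z≤n) ≤-refl ⟩
  annuli (suc N′) (suc N′)
    -- The fuel is N itself; one unfolding leaves N - 1, which still bounds all sizes that occur.
    ≡⟨ annuli-step N′ N′ ⟩
  2 * ∑ (suc M) weighted + ∑ N′ (λ p → N′ ∸ p) * cat N′ N′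
    ≡⟨ cong₂ _+_ (cong (2 *_) terms) (cong₂ _*_ coefficient (sym (B-disk N′ N′ ≤-refl))) ⟩
  2 * sum (map summand (upTo M)) + (suc N′ * N′) / 2 * B₁ 0 N′  ∎
  where
  open ≡-Reasoning
  N′ : ℕ
  N′ = suc M
  summand weighted : ℕ → ℕ
  summand i = B₁ 0 i * B 0 (suc (suc M) ∸ i ∸ 1) 2
  weighted j = cat N′ j * annuli N′ (N′ ∸ j)
  -- The sum (N - 1) + ... + 1; the product is even, so the truncating division is exact.
  coefficient : ∑ N′ (λ p → N′ ∸ p) ≡ (suc N′ * N′) / 2
  coefficient = trans (sym (m*n/n≡m (∑ N′ (λ p → N′ ∸ p)) 2)) (cong (_/ 2) (2*∑-descending N′))
  -- The recursion runs up to j = N - 2, where a single edge would have to form two nonempty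
  -- polygons. That term is 0, whence the upper limit N - 3.
  weighted-last : weighted M ≡ 0
  weighted-last = trans (cong (λ t → cat N′ M * annuli N′ t) (m+n∸n≡m 1 M)) (*-zeroʳ (cat N′ M))
  weighted≡ : ∀ i → i < M → weighted i ≡ summand i
  weighted≡ i i<M = cong₂ _*_ (sym (B-disk N′ i (<⇒≤ (<-trans i<M (n<1+n M)))))
    (trans (sym (B-annulus N′ (N′ ∸ i) (m<n⇒0<n∸m (<-trans i<M (n<1+n M))) (m∸n≤m N′ i)))
      (cong (λ t → B 0 t 2) (trans (cong (_∸ i) (sym (m+n∸n≡m N′ 1))) (trans (∸-comm (N′ + 1) 1 i) (cong (λ t → t ∸ i ∸ 1) (+-comm N′ 1))))))
    where
    ∸-comm : ∀ a b c → a ∸ b ∸ c ≡ a ∸ c ∸ b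
    ∸-comm a b c = trans (∸-+-assoc a b c) (trans (cong (a ∸_) (+-comm b c)) (sym (∸-+-assoc a c b)))
  terms : ∑ (suc M) weighted ≡ sum (map summand (upTo M))
  terms = trans (∑-last M weighted) (trans (cong (∑ M weighted +_) weighted-last) (trans (+-identityʳ _)
    (trans (∑-cong M weighted≡) (sym (sum-upTo summand M)))))
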